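{- For a matroid $M$, the number of cocircuits of size $s$, the number of circuits of size $s$, and the number of cyclic sets (that is, unions of circuits) of size $s$ and rank $j$ are derivable from the catenary data of $M$. In particular, one can deduce whether the matroid has a spanning circuit, so one can determine whether a graph is Hamiltonian from the $\mathcal{G}$-invariant of its cycle matroid.
   Context: For a rank-$r$ matroid $M$ on an $n$-element set $E$: an $(n,r)$-composition is an integer sequence $(a_0,\ldots,a_r)$ with $a_0\ge0$, $a_j>0$ for $1\le j\le r$, and sum $n$. A flag is a chain $X_0\subset X_1\subset\cdots\subset X_r=E$ of flats with $r(X_j)=j$; its composition is $(|X_0|,|X_1-X_0|,\ldots,|X_r-X_{r-1}|)$. $\nu(M;a_0,\ldots,a_r)$ is the number of flags with composition $(a_0,\ldots,a_r)$; the catenary data of $M$ is the vector of these numbers indexed by $(n,r)$-compositions. A quantity is derivable from the catenary data if it is determined by the catenary data. $\mathcal{G}(n,r)$ is the vector space over a field of characteristic zero with basis the formal symbols $[\underline{r}]$, one for each $0,1$-sequence of length $n$ with exactly $r$ ones. For a permutation (linear ordering) $\pi$ of $E$, the rank sequence $\underline{r}(\pi)=r_1\ldots r_n$ has $r_j=r(\{\pi(1),\ldots,\pi(j)\})-r(\{\pi(1),\ldots,\pi(j-1)\})$, and $\mathcal{G}(M)=\sum_\pi[\underline{r}(\pi)]\in\mathcal{G}(n,r)$ over all $n!$ permutations of $E$. The $\mathcal{G}$-invariant and the catenary data of a matroid determine each other. A spanning circuit is a circuit $C$ with $r(C)=r(M)$. A graph is Hamiltonian if it has a cycle passing through every vertex.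 The empty set is a cyclic set (the empty union).
   Formalization: The Hamiltonian claim is stated for graphs with the same number of vertices, and for connected graphs; without this it is false, since a triangle and a triangle plus an isolated vertex have the same cycle matroid but only the first is Hamiltonian. -}

module Defs where

open import Algebra.Apartness.Bundles using (HeytingCommutativeRing; HeytingField)
open import Algebra.Bundles using (CommutativeRing)
import Algebra.Definitions.RawMonoid as RawMonoidDefs
import Data.Bool.Properties as Bool
open import Data.Bool.Base using (Bool; true; false; if_then_else_)
open import Data.Fin.Base using (Fin; zero; suc; inject₁; fromℕ; toℕ)
open import Data.Fin.Properties using (all?) renaming (_≟_ to _≟ᶠ_)
open import Data.Fin.Subset
open import Data.Fin.Subset.Properties
open import Data.List.Base as List using (List; []; _∷_; length; filter; cartesianProductWith; allFin)
import Data.List.Membership.Propositional as ListMem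
open import Data.List.Membership.Propositional.Properties using (∈-cartesianProductWith⁺; ∈-filter⁺)
open import Data.List.Relation.Unary.All as All using (All; []; _∷_)
open import Data.List.Relation.Unary.All.Properties using (all-filter)
open import Data.List.Relation.Unary.Any using (here; there)
open import Data.Nat.Base
open import Data.Nat.DivMod using (_mod_)
open import Data.Nat.Properties hiding (_≟_)
open import Data.Nat.Properties using (_≟_)
open import Data.Product.Base using (Σ; ∃; ∃-syntax; _×_; _,_; proj₁; proj₂)
open import Data.Sum.Base using (_⊎_; inj₁; inj₂; [_,_]′)
open import Data.Vec.Base as Vec using (Vec; []; _∷_; lookup; tabulate; count; head)
open import Data.Vec.Properties using (≡-dec)
import Data.Vec.Relation.Unary.All as VecAll
import Data.Vec.Relation.Unary.AllPairs as VecAllPairs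
open import Data.Vec.Relation.Unary.Unique.Propositional using (Unique)
open import Function.Base using (_∘_; id)
open import Function.Bundles using (_⇔_)
open import Function.Definitions using (Injective)
open import Level using (Level)
open import Relation.Binary.Construct.Closure.ReflexiveTransitive using (Star)
open import Relation.Binary.PropositionalEquality
open import Relation.Nullary using (¬_; Dec; yes; no; does; contradiction)
open import Relation.Nullary.Decidable using (_×-dec_; _→-dec_; ¬?; map′; decidable-stable)
open import Relation.Unary using (Decidable)

------------------------------------------------------------------------
-- Exhaustive enumeration

vectors : ∀ {A : Set} → List A → ∀ k → List (Vec A k)
vectors xs zero    = [] ∷ []
vectors xs (suc k) = cartesianProductWith _∷_ xs (vectors xs k)

subsets : ∀ n → List (Subset n)
subsets = vectors (outside ∷ inside ∷ [])

∈-subsets : ∀ {n} (X : Subset n) → X ListMem.∈ subsets n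
∈-subsets []      = here refl
∈-subsets (b ∷ X) = ∈-cartesianProductWith⁺ _∷_ (side b) (∈-subsets X)
  where
  side : ∀ b → b ListMem.∈ (outside ∷ inside ∷ [])
  side false = here refl
  side true  = there (here refl)

#⟨_⟩ : ∀ {n} {P : Subset n → Set} → Decidable P → ℕ
#⟨ P? ⟩ = length (filter P? (subsets _))

infix 4 _≟ˢ_
_≟ˢ_ : ∀ {n} (X Y : Subset n) → Dec (X ≡ Y)
_≟ˢ_ = ≡-dec Bool._≟_

allSubset? : ∀ {n} {P : Subset n → Set} → Decidable P → Dec (∀ X → P X)
allSubset? P? with anySubset? (λ X → ¬? (P? X))
... | yes (X , ¬PX) = no λ ∀P → ¬PX (∀P X)
... | no ¬∃¬P       = yes λ X → decidable-stable (P? X) λ ¬PX → ¬∃¬P (X , ¬PX)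

------------------------------------------------------------------------
-- Matroids of rank r on the ground set Fin n, given by the rank axioms

record Matroid (n r : ℕ) : Set where
  field
    rank        : Subset n → ℕ
    rank-size   : ∀ X → rank X ≤ ∣ X ∣
    rank-mono   : ∀ {X Y} → X ⊆ Y → rank X ≤ rank Y
    rank-submod : ∀ X Y → rank (X ∪ Y) + rank (X ∩ Y) ≤ rank X + rank Y
    rank-⊤      : rank ⊤ ≡ r

  rank-⊥ : rank ⊥ ≡ 0
  rank-⊥ = n≤0⇒n≡0 (≤-trans (rank-size ⊥) (≤-reflexive (∣⊥∣≡0 n)))

  rank-subadd : ∀ X Y → rank (X ∪ Y) ≤ rank X + rank Y
  rank-subadd X Y = ≤-trans (m≤m+n _ _) (rank-submod X Y)

  Independent : Subset n → Set
  Independent X = rank X ≡ ∣ X ∣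

  Circuit : Subset n → Set
  Circuit X = ¬ Independent X × (∀ Y → Y ⊂ X → Independent Y)

  Flat : Subset n → Set
  Flat X = ∀ x → x ∉ X → rank X < rank (X ∪ ⁅ x ⁆)

  Cyclic : Subset n → Set
  Cyclic X = ∃[ Cs ] All Circuit Cs × ⋃ Cs ≡ X

  SpanningCircuit : Subset n → Set
  SpanningCircuit C = Circuit C × rank C ≡ r

  Flag : Vec (Subset n) (suc r) → Set
  Flag X = (∀ j → Flat (lookup X j))
         × (∀ j → rank (lookup X j) ≡ toℕ j)
         × (∀ j → lookup X (inject₁ j) ⊂ lookup X (suc j))
         × lookup X (fromℕ r) ≡ ⊤

  independent? : Decidable Independent
  independent? X = rank X ≟ ∣ X ∣

  circuit? : Decidable Circuit
  circuit? X = ¬? (independent? X)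
         ×-dec allSubset? (λ Y → (Y ⊂? X) →-dec independent? Y)

  flat? : Decidable Flat
  flat? X = all? (λ x → ¬? (x ∈? X) →-dec (rank X <? rank (X ∪ ⁅ x ⁆)))

  flag? : Decidable Flag
  flag? X = all? (λ j → flat? (lookup X j))
      ×-dec all? (λ j → rank (lookup X j) ≟ toℕ j)
      ×-dec all? (λ j → lookup X (inject₁ j) ⊂? lookup X (suc j))
      ×-dec lookup X (fromℕ r) ≟ˢ ⊤

  circuitsWithin : Subset n → List (Subset n)
  circuitsWithin X = filter (λ C → circuit? C ×-dec (C ⊆? X)) (subsets n)

  cyclic? : Decidable Cyclic
  cyclic? X = map′ to from (⋃ (circuitsWithin X) ≟ˢ X)
    where
    within : All (λ C → Circuit C × C ⊆ X) (circuitsWithin X)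
    within = all-filter _ (subsets n)

    to : ⋃ (circuitsWithin X) ≡ X → Cyclic X
    to eq = circuitsWithin X , All.map proj₁ within , eq

    ⋃-least : ∀ Cs → All (λ C → Circuit C × C ⊆ X) Cs → ⋃ Cs ⊆ X
    ⋃-least []       _                   x∈ = contradiction x∈ ∉⊥
    ⋃-least (C ∷ Cs) ((_ , C⊆X) ∷ rest) x∈ =
      [ C⊆X , ⋃-least Cs rest ]′ (x∈p∪q⁻ C (⋃ Cs) x∈)

    ⊆-⋃ : ∀ {C} Ds → C ListMem.∈ Ds → C ⊆ ⋃ Ds
    ⊆-⋃ (D ∷ Ds) (here refl) x∈ = x∈p∪q⁺ (inj₁ x∈)
    ⊆-⋃ (D ∷ Ds) (there C∈)  x∈ = x∈p∪q⁺ (inj₂ (⊆-⋃ Ds C∈ x∈))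

    covered : ∀ Cs → All Circuit Cs → ⋃ Cs ⊆ X → ⋃ Cs ⊆ ⋃ (circuitsWithin X)
    covered []       _          _ x∈ = contradiction x∈ ∉⊥
    covered (C ∷ Cs) (cC ∷ cCs) ⊆X x∈ =
      [ ⊆-⋃ _ (∈-filter⁺ (λ D → circuit? D ×-dec (D ⊆? X)) (∈-subsets C)
                         (cC , λ y∈ → ⊆X (x∈p∪q⁺ (inj₁ y∈))))
      , covered Cs cCs (λ y∈ → ⊆X (x∈p∪q⁺ (inj₂ y∈)))
      ]′ (x∈p∪q⁻ C (⋃ Cs) x∈)

    from : Cyclic X → ⋃ (circuitsWithin X) ≡ X
    from (Cs , cCs , refl) =
      ⊆-antisym (⋃-least _ within) (covered Cs cCs id)

open Matroid

------------------------------------------------------------------------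
-- Duality: r*(X) = |X| + r(E - X) - r(E)

∣q∩p∣+∣q─p∣≡∣q∣ : ∀ {n} (q p : Subset n) → ∣ q ∩ p ∣ + ∣ q ─ p ∣ ≡ ∣ q ∣
∣q∩p∣+∣q─p∣≡∣q∣ []          []          = refl
∣q∩p∣+∣q─p∣≡∣q∣ (true  ∷ q) (true  ∷ p) = cong suc (∣q∩p∣+∣q─p∣≡∣q∣ q p)
∣q∩p∣+∣q─p∣≡∣q∣ (true  ∷ q) (false ∷ p) =
  trans (+-suc _ _) (cong suc (∣q∩p∣+∣q─p∣≡∣q∣ q p))
∣q∩p∣+∣q─p∣≡∣q∣ (false ∷ q) (true  ∷ p) = ∣q∩p∣+∣q─p∣≡∣q∣ q p
∣q∩p∣+∣q─p∣≡∣q∣ (false ∷ q) (false ∷ p) = ∣q∩p∣+∣q─p∣≡∣q∣ q p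

∣p∪q∣+∣p∩q∣≡∣p∣+∣q∣ : ∀ {n} (p q : Subset n) → ∣ p ∪ q ∣ + ∣ p ∩ q ∣ ≡ ∣ p ∣ + ∣ q ∣
∣p∪q∣+∣p∩q∣≡∣p∣+∣q∣ []          []          = refl
∣p∪q∣+∣p∩q∣≡∣p∣+∣q∣ (true  ∷ p) (true  ∷ q) = cong suc
  (trans (+-suc _ _) (trans (cong suc (∣p∪q∣+∣p∩q∣≡∣p∣+∣q∣ p q)) (sym (+-suc _ _))))
∣p∪q∣+∣p∩q∣≡∣p∣+∣q∣ (true  ∷ p) (false ∷ q) = cong suc (∣p∪q∣+∣p∩q∣≡∣p∣+∣q∣ p q)
∣p∪q∣+∣p∩q∣≡∣p∣+∣q∣ (false ∷ p) (true  ∷ q) =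
  trans (cong suc (∣p∪q∣+∣p∩q∣≡∣p∣+∣q∣ p q)) (sym (+-suc _ _))
∣p∪q∣+∣p∩q∣≡∣p∣+∣q∣ (false ∷ p) (false ∷ q) = ∣p∪q∣+∣p∩q∣≡∣p∣+∣q∣ p q

dual : ∀ {n r} → Matroid n r → Matroid n (n ∸ r)
dual {n} {r} M = record
  { rank        = λ X → f X ∸ r
  ; rank-size   = λ X → m≤n+o⇒m∸n≤o (f X) r (size X)
  ; rank-mono   = λ {X} {Y} X⊆Y → ∸-monoˡ-≤ r (mono X⊆Y)
  ; rank-submod = submod∸
  ; rank-⊤      = cong (_∸ r) f⊤
  }
  where
  open ≤-Reasoning

  f : Subset n → ℕ
  f X = ∣ X ∣ + rank M (∁ X)

  rank≤r : ∀ X → rank M X ≤ r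
  rank≤r X = ≤-trans (rank-mono M (⊆-max X)) (≤-reflexive (rank-⊤ M))

  size : ∀ X → f X ≤ r + ∣ X ∣
  size X = ≤-trans (+-monoʳ-≤ ∣ X ∣ (rank≤r (∁ X))) (≤-reflexive (+-comm ∣ X ∣ r))

  r≤f : ∀ X → r ≤ f X
  r≤f X = begin
    r                        ≡⟨ rank-⊤ M ⟨
    rank M ⊤                 ≡⟨ cong (rank M) (p∪∁p≡⊤ X) ⟨
    rank M (X ∪ ∁ X)         ≤⟨ rank-subadd M X (∁ X) ⟩
    rank M X + rank M (∁ X)  ≤⟨ +-monoˡ-≤ _ (rank-size M X) ⟩
    f X                      ∎

  f⊤ : f ⊤ ≡ n
  f⊤ = trans (cong₂ _+_ (∣⊤∣≡n n) (trans (cong (rank M) ∁⊤) (rank-⊥ M))) (+-identityʳ n)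
    where
    ∁⊤ : ∁ ⊤ ≡ ⊥ {n}
    ∁⊤ = ⊆-antisym (λ x∈ → contradiction ∈⊤ (x∈∁p⇒x∉p x∈)) (⊆-min _)

  mono : ∀ {X Y} → X ⊆ Y → f X ≤ f Y
  mono {X} {Y} X⊆Y = begin
    ∣ X ∣ + rank M (∁ X)
      ≤⟨ +-mono-≤ (p⊆q⇒∣p∣≤∣q∣ X⊆Y∩X) (rank-mono M ∁X⊆) ⟩
    ∣ Y ∩ X ∣ + rank M ((Y ─ X) ∪ ∁ Y)
      ≤⟨ +-monoʳ-≤ ∣ Y ∩ X ∣ (rank-subadd M (Y ─ X) (∁ Y)) ⟩
    ∣ Y ∩ X ∣ + (rank M (Y ─ X) + rank M (∁ Y))
      ≤⟨ +-monoʳ-≤ ∣ Y ∩ X ∣ (+-monoˡ-≤ _ (rank-size M (Y ─ X))) ⟩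
    ∣ Y ∩ X ∣ + (∣ Y ─ X ∣ + rank M (∁ Y))
      ≡⟨ +-assoc ∣ Y ∩ X ∣ _ _ ⟨
    (∣ Y ∩ X ∣ + ∣ Y ─ X ∣) + rank M (∁ Y)
      ≡⟨ cong (_+ rank M (∁ Y)) (∣q∩p∣+∣q─p∣≡∣q∣ Y X) ⟩
    f Y ∎
    where
    X⊆Y∩X : X ⊆ Y ∩ X
    X⊆Y∩X x∈ = x∈p∩q⁺ (X⊆Y x∈ , x∈)
    ∁X⊆ : ∁ X ⊆ (Y ─ X) ∪ ∁ Y
    ∁X⊆ {x} x∈ with x ∈? Y
    ... | yes x∈Y = x∈p∪q⁺ (inj₁ (x∈p∧x∉q⇒x∈p─q x∈Y (x∈∁p⇒x∉p x∈)))
    ... | no  x∉Y = x∈p∪q⁺ (inj₂ (x∉p⇒x∈∁p x∉Y))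

  interchange : ∀ a b c d → (a + b) + (c + d) ≡ (a + c) + (b + d)
  interchange a b c d = trans (+-assoc a b _) (trans (cong (a +_)
    (trans (sym (+-assoc b c d)) (trans (cong (_+ d) (+-comm b c)) (+-assoc c b d))))
    (sym (+-assoc a c _)))

  submod : ∀ X Y → f (X ∪ Y) + f (X ∩ Y) ≤ f X + f Y
  submod X Y = begin
    f (X ∪ Y) + f (X ∩ Y)
      ≡⟨ interchange (∣ X ∪ Y ∣) _ (∣ X ∩ Y ∣) _ ⟩
    (∣ X ∪ Y ∣ + ∣ X ∩ Y ∣) + (rank M (∁ (X ∪ Y)) + rank M (∁ (X ∩ Y)))
      ≤⟨ +-mono-≤ (≤-reflexive (∣p∪q∣+∣p∩q∣≡∣p∣+∣q∣ X Y))
                  (+-mono-≤ (rank-mono M ∁∪) (rank-mono M ∁∩)) ⟩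
    (∣ X ∣ + ∣ Y ∣) + (rank M (∁ X ∩ ∁ Y) + rank M (∁ X ∪ ∁ Y))
      ≡⟨ cong ((∣ X ∣ + ∣ Y ∣) +_) (+-comm (rank M (∁ X ∩ ∁ Y)) _) ⟩
    (∣ X ∣ + ∣ Y ∣) + (rank M (∁ X ∪ ∁ Y) + rank M (∁ X ∩ ∁ Y))
      ≤⟨ +-monoʳ-≤ (∣ X ∣ + ∣ Y ∣) (rank-submod M (∁ X) (∁ Y)) ⟩
    (∣ X ∣ + ∣ Y ∣) + (rank M (∁ X) + rank M (∁ Y))
      ≡⟨ interchange ∣ X ∣ ∣ Y ∣ _ _ ⟩
    f X + f Y ∎
    where
    ∁∪ : ∁ (X ∪ Y) ⊆ ∁ X ∩ ∁ Y
    ∁∪ x∈ = x∈p∩q⁺ ( x∉p⇒x∈∁p (λ x∈X → x∈∁p⇒x∉p x∈ (x∈p∪q⁺ (inj₁ x∈X)))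
                    , x∉p⇒x∈∁p (λ x∈Y → x∈∁p⇒x∉p x∈ (x∈p∪q⁺ (inj₂ x∈Y))))
    ∁∩ : ∁ (X ∩ Y) ⊆ ∁ X ∪ ∁ Y
    ∁∩ {x} x∈ with x ∈? X
    ... | no  x∉X = x∈p∪q⁺ (inj₁ (x∉p⇒x∈∁p x∉X))
    ... | yes x∈X = x∈p∪q⁺ (inj₂ (x∉p⇒x∈∁p (λ x∈Y → x∈∁p⇒x∉p x∈ (x∈p∩q⁺ (x∈X , x∈Y)))))

  f∸ : ∀ X → f X ∸ r + r ≡ f X
  f∸ X = m∸n+n≡m (r≤f X)

  pair : ∀ X Y → ((f X ∸ r) + (f Y ∸ r)) + (r + r) ≡ f X + f Y
  pair X Y = trans (interchange (f X ∸ r) _ r r) (cong₂ _+_ (f∸ X) (f∸ Y))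

  submod∸ : ∀ X Y → (f (X ∪ Y) ∸ r) + (f (X ∩ Y) ∸ r) ≤ (f X ∸ r) + (f Y ∸ r)
  submod∸ X Y = +-cancelʳ-≤ (r + r) _ _
    (≤-trans (≤-reflexive (pair (X ∪ Y) (X ∩ Y)))
    (≤-trans (submod X Y) (≤-reflexive (sym (pair X Y)))))

Cocircuit : ∀ {n r} → Matroid n r → Subset n → Set
Cocircuit M = Circuit (dual M)

cocircuit? : ∀ {n r} (M : Matroid n r) → Decidable (Cocircuit M)
cocircuit? M = circuit? (dual M)

#circuits : ∀ {n r} → Matroid n r → ℕ → ℕ
#circuits M s = #⟨ (λ X → circuit? M X ×-dec ∣ X ∣ ≟ s) ⟩

#cocircuits : ∀ {n r} → Matroid n r → ℕ → ℕ
#cocircuits M s = #⟨ (λ X → cocircuit? M X ×-dec ∣ X ∣ ≟ s) ⟩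

#cyclicSets : ∀ {n r} → Matroid n r → ℕ → ℕ → ℕ
#cyclicSets M s j = #⟨ (λ X → cyclic? M X ×-dec ∣ X ∣ ≟ s ×-dec rank M X ≟ j) ⟩

HasSpanningCircuit : ∀ {n r} → Matroid n r → Set
HasSpanningCircuit M = ∃[ C ] SpanningCircuit M C

------------------------------------------------------------------------
-- Catenary data

record Composition (n r : ℕ) : Set where
  field
    parts    : Vec ℕ (suc r)
    positive : ∀ (j : Fin r) → 0 < lookup parts (suc j)
    total    : Vec.sum parts ≡ n

open Composition

flagComposition : ∀ {n r} → Vec (Subset n) (suc r) → Vec ℕ (suc r)
flagComposition X = ∣ head X ∣ ∷ tabulate λ j → ∣ lookup X (suc j) ─ lookup X (inject₁ j) ∣

ν : ∀ {n r} → Matroid n r → Composition n r → ℕ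
ν {n} {r} M a =
  length (filter (λ X → flag? M X ×-dec ≡-dec _≟_ (flagComposition X) (parts a))
                 (vectors (subsets n) (suc r)))

SameCatenaryData : ∀ {n r} → Matroid n r → Matroid n r → Set
SameCatenaryData M N = ∀ a → ν M a ≡ ν N a

-- The index set of the catenary data fixes n and r, so only matroids of
-- the same size and rank need to be compared.

Derivable : (∀ {n r} → Matroid n r → ℕ) → Set
Derivable Q = ∀ {n r} (M N : Matroid n r) → SameCatenaryData M N → Q M ≡ Q N

DerivableProperty : (∀ {n r} → Matroid n r → Set) → Set
DerivableProperty P = ∀ {n r} (M N : Matroid n r) → SameCatenaryData M N → P M ⇔ P N

------------------------------------------------------------------------
-- The 𝒢-invariant

record Symbol (n r : ℕ) : Set where
  field
    bits   : Vec ℕ n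
    binary : VecAll.All (_≤ 1) bits
    ones   : count (_≟ 1) bits ≡ r

open Symbol

record LinearOrdering (n : ℕ) : Set where
  constructor ordering
  field
    sequence : Vec (Fin n) n
    distinct : Unique sequence

open LinearOrdering

orderings : ∀ n → List (LinearOrdering n)
orderings n =
  List.map (λ (π , π!) → ordering π π!)
    (All.toList (all-filter (VecAllPairs.allPairs? λ x y → ¬? (x ≟ᶠ y))
                            (vectors (allFin n) n)))

module _ {n r : ℕ} (M : Matroid n r) where

  -- X is the set of elements preceding the given ones.
  rankIncrements : ∀ {k} → Subset n → Vec (Fin n) k → Vec ℕ k
  rankIncrements X []       = []
  rankIncrements X (x ∷ xs) = (rank M (X ∪ ⁅ x ⁆) ∸ rank M X) ∷ rankIncrements (X ∪ ⁅ x ⁆) xs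

  rankSequence : LinearOrdering n → Vec ℕ n
  rankSequence π = rankIncrements ⊥ (sequence π)

  increment≤1 : ∀ X x → rank M (X ∪ ⁅ x ⁆) ∸ rank M X ≤ 1
  increment≤1 X x = m≤n+o⇒m∸n≤o _ (rank M X)
    (≤-trans (rank-subadd M X ⁅ x ⁆)
             (+-monoʳ-≤ (rank M X) (≤-trans (rank-size M ⁅ x ⁆) (≤-reflexive (∣⁅x⁆∣≡1 x)))))

  rankIncrements-binary : ∀ {k} X (xs : Vec (Fin n) k) → VecAll.All (_≤ 1) (rankIncrements X xs)
  rankIncrements-binary X []       = VecAll.[]
  rankIncrements-binary X (x ∷ xs) = increment≤1 X x VecAll.∷ rankIncrements-binary _ xs

  extend : ∀ {k} → Subset n → Vec (Fin n) k → Subset n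
  extend X []       = X
  extend X (x ∷ xs) = extend (X ∪ ⁅ x ⁆) xs

  ∣extend∣ : ∀ {k} X (xs : Vec (Fin n) k) → Unique xs → VecAll.All (_∉ X) xs →
             ∣ extend X xs ∣ ≡ ∣ X ∣ + k
  ∣extend∣ X [] _ _ = sym (+-identityʳ _)
  ∣extend∣ {suc k} X (x ∷ xs) (x≢ VecAllPairs.∷ u) (x∉ VecAll.∷ xs∉) =
    trans (∣extend∣ (X ∪ ⁅ x ⁆) xs u
             (VecAll.map (λ (y∉ , x≢y) y∈ →
                [ y∉ , (λ y∈x → x≢y (sym (x∈⁅y⁆⇒x≡y x y∈x))) ]′ (x∈p∪q⁻ X ⁅ x ⁆ y∈))
                (VecAll.zip (xs∉ , x≢))))
          (trans (cong (_+ k) card) (sym (+-suc ∣ X ∣ k)))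
    where
    empty : X ∩ ⁅ x ⁆ ≡ ⊥
    empty = ⊆-antisym
      (λ y∈ → let y∈X , y∈x = x∈p∩q⁻ X ⁅ x ⁆ y∈ in
              contradiction (subst (_∈ X) (x∈⁅y⁆⇒x≡y x y∈x) y∈X) x∉)
      (⊆-min _)
    card : ∣ X ∪ ⁅ x ⁆ ∣ ≡ suc ∣ X ∣
    card = trans (sym (+-identityʳ _))
      (trans (cong (∣ X ∪ ⁅ x ⁆ ∣ +_) (sym (trans (cong ∣_∣ empty) (∣⊥∣≡0 n))))
      (trans (∣p∪q∣+∣p∩q∣≡∣p∣+∣q∣ X ⁅ x ⁆)
      (trans (cong (∣ X ∣ +_) (∣⁅x⁆∣≡1 x)) (+-comm ∣ X ∣ 1))))

  extend-ordering : ∀ π → extend ⊥ (sequence π) ≡ ⊤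
  extend-ordering (ordering xs u) = ∣p∣≡n⇒p≡⊤
    (trans (∣extend∣ ⊥ xs u (VecAll.universal (λ _ → ∉⊥) xs)) (cong (_+ n) (∣⊥∣≡0 n)))

  count-∷ : ∀ {k} b (bs : Vec ℕ k) → b ≤ 1 → count (_≟ 1) (b ∷ bs) ≡ b + count (_≟ 1) bs
  count-∷ 0 bs _ = refl
  count-∷ 1 bs _ = refl
  count-∷ (suc (suc _)) bs (s≤s ())

  telescope : ∀ {k} X (xs : Vec (Fin n) k) →
              rank M X + count (_≟ 1) (rankIncrements X xs) ≡ rank M (extend X xs)
  telescope X []       = +-identityʳ _
  telescope X (x ∷ xs) =
    trans (cong (rank M X +_) (count-∷ _ (rankIncrements _ xs) (increment≤1 X x)))
    (trans (sym (+-assoc (rank M X) _ _))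
    (trans (cong (_+ count (_≟ 1) (rankIncrements (X ∪ ⁅ x ⁆) xs))
                 (m+[n∸m]≡n (rank-mono M (p⊆p∪q ⁅ x ⁆))))
           (telescope (X ∪ ⁅ x ⁆) xs)))

  rankSymbol : LinearOrdering n → Symbol n r
  rankSymbol π = record
    { bits   = rankSequence π
    ; binary = rankIncrements-binary ⊥ (sequence π)
    ; ones   = trans (cong (_+ count (_≟ 1) (rankSequence π)) (sym (rank-⊥ M)))
               (trans (telescope ⊥ (sequence π))
               (trans (cong (rank M) (extend-ordering π)) (rank-⊤ M)))
    }

module _ {c ℓ₁ ℓ₂ : Level} (K : HeytingField c ℓ₁ ℓ₂) where

  open CommutativeRing (HeytingCommutativeRing.commutativeRing (HeytingField.heytingCommutativeRing K))
    using (Carrier; _≈_; 0#; 1#; +-rawMonoid)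
    renaming (_+_ to _+ᴷ_)
  open RawMonoidDefs +-rawMonoid using () renaming (_×_ to _×ᴷ_)

  CharacteristicZero : Set ℓ₁
  CharacteristicZero = ∀ k → k ×ᴷ 1# ≈ 0# → k ≡ 0

  -- Vectors are given by their coordinates in the basis of symbols.
  𝒢Space : ℕ → ℕ → Set c
  𝒢Space n r = Symbol n r → Carrier

  𝒢Equal : ∀ {n r} → 𝒢Space n r → 𝒢Space n r → Set ℓ₁
  𝒢Equal u v = ∀ σ → u σ ≈ v σ

  basis : ∀ {n r} → Symbol n r → 𝒢Space n r
  basis σ τ = if does (≡-dec _≟_ (bits σ) (bits τ)) then 1# else 0#

  𝒢 : ∀ {n r} → Matroid n r → 𝒢Space n r
  𝒢 {n} M = List.foldr (λ u v σ → u σ +ᴷ v σ) (λ _ → 0#)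
              (List.map (basis ∘ rankSymbol M) (orderings n))

------------------------------------------------------------------------
-- Graphs with vertex set Fin v and edge set Fin n.  Loops and parallel
-- edges are allowed; the order of the two ends of an edge is irrelevant.

record Graph (v n : ℕ) : Set where
  field
    ends : Fin n → Fin v × Fin v

  Joins : Fin n → Fin v → Fin v → Set
  Joins e x y = ends e ≡ (x , y) ⊎ ends e ≡ (y , x)

  Adjacent : Fin v → Fin v → Set
  Adjacent x y = ∃[ e ] Joins e x y

  Connected : Set
  Connected = ∀ x y → Star Adjacent x y

  -- Length-one cycles are loops and length-two cycles are pairs of
  -- parallel edges, so in a simple graph every cycle has length ≥ 3.
  record Cycle : Set where
    field
      length-1   : ℕ
      vertex     : Fin (suc length-1) → Fin v
      edge       : Fin (suc length-1) → Fin n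
      vertex-inj : Injective _≡_ _≡_ vertex
      edge-inj   : Injective _≡_ _≡_ edge
      joins      : ∀ i → Joins (edge i) (vertex i) (vertex (suc (toℕ i) mod suc length-1))

    HasEdgeSet : Subset n → Set
    HasEdgeSet X = ∀ e → e ∈ X ⇔ (∃[ i ] edge i ≡ e)

    PassesThroughEveryVertex : Set
    PassesThroughEveryVertex = ∀ x → ∃[ i ] vertex i ≡ x

  open Cycle public

  Hamiltonian : Set
  Hamiltonian = Σ Cycle PassesThroughEveryVertex

open Graph

-- The cycle matroid does not see isolated vertices: a triangle and a
-- triangle plus an isolated vertex have the same one.  It therefore
-- determines Hamiltonicity only if the number of vertices is known or the
-- graph is assumed to be connected.
IsCycleMatroid : ∀ {v n r} → Graph v n → Matroid n r → Set
IsCycleMatroid G M = ∀ X → Circuit M X ⇔ Σ (Cycle G) (λ C → HasEdgeSet C X)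

{-# OPTIONS --safe #-}
module Submission where

-- Everything is read off from the chain sums: for weights φ, sum over the maximal
-- chains ∅ ⊂ S₁ ⊂ ⋯ ⊂ E of the ground set the product of the numbers φ |Sᵢ| r(Sᵢ).
-- They are linear in the 𝒢-invariant, whose coefficients count the chains by rank
-- sequence, and linear in the catenary data, since the number of chains with a given
-- rank sequence whose closures run through a given flag depends only on the
-- composition of the flag.  Conversely, weights that force the rank to rise in the t
-- steps before size s count the pairs (X, t coloops of X) with |X| = s and r(X) = j,
-- so inclusion-exclusion yields the number of such X without coloops, that is, of
-- cyclic sets.  Circuits are the cyclic sets of nullity 1, and cocircuits follow
-- because complementing the chains of M gives those of its dual.  Finally, a graph on
-- v vertices is Hamiltonian iff it has a circuit of size v, and a connected graph iff
-- its cycle matroid has a spanning circuit.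

open import Defs
open import Algebra.Apartness.Bundles using (HeytingCommutativeRing; HeytingField)
open import Algebra.Bundles using (CommutativeRing)
import Algebra.Properties.Group as GroupProperties
import Algebra.Properties.Monoid.Mult as Mult
open import Data.Bool.Base using (true; if_then_else_)
import Data.Bool.Properties as Bool
open import Data.Empty using (⊥-elim)
open import Data.Fin.Base using (Fin; zero; suc; inject₁; fromℕ; toℕ)
open import Data.Fin.Properties
  using (any?; toℕ-injective; toℕ<n; toℕ-fromℕ<; toℕ-inject₁; toℕ-fromℕ; injective⇒≤)
  renaming (_≟_ to _≟ᶠ_; suc-injective to sucᶠ-injective)
open import Data.Fin.Subset hiding (⋂)
open import Data.Fin.Subset.Properties
open import Data.List.Base as List
  using (List; []; _∷_; _++_; map; length; filter; tabulate; allFin; cartesianProductWith)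
import Data.List.Membership.Propositional as ListMem
open import Data.List.Membership.Propositional.Properties
  using (∈-filter⁺; ∈-filter⁻; ∈-allFin; ∈-∃++; ∈-++⁺ˡ; ∈-++⁺ʳ; ∈-++⁻; ∈-map⁻)
open import Data.List.Relation.Unary.All as All using (All; []; _∷_)
open import Data.List.Relation.Unary.All.Properties using (all-filter)
import Data.List.Relation.Unary.Any as Any
open import Data.Nat.Base hiding (∣_-_∣)
open import Data.Nat.Combinatorics using (nC1≡n; nCk+nC[k+1]≡[n+1]C[k+1]; k>n⇒nCk≡0)
  renaming (_C_ to _choose_)
open import Data.Nat.DivMod using (_mod_; m<n⇒m%n≡m; n%n≡0; m%n<n)
open import Data.Nat.Properties
open import Data.Product.Base using (Σ; ∃-syntax; _×_; _,_; proj₁; proj₂)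
open import Data.Product.Properties using (,-injective)
open import Data.Sum.Base as Sum using (_⊎_; inj₁; inj₂; [_,_]′)
open import Data.Unit.Base using (tt) renaming (⊤ to Unit)
open import Data.Vec.Base as Vec using (Vec; []; _∷_; here; there; lookup)
open import Data.Vec.Properties
  using (≡-dec; ∷-injectiveˡ; ∷-injectiveʳ; lookup∘tabulate; lookup⇒[]=; []=⇒lookup)
import Data.Vec.Relation.Unary.All as VecAll
import Data.Vec.Relation.Unary.AllPairs as VecAllPairs
open import Data.Vec.Relation.Unary.Unique.Propositional using (Unique)
open import Function.Base using (_∘_; id)
open import Function.Bundles using (_⇔_; mk⇔; Equivalence)
open import Function.Definitions using (Injective)
open import Level using (Level)
open import Relation.Binary.Construct.Closure.ReflexiveTransitive using (Star; ε; _◅_)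
open import Relation.Binary.Definitions using (DecidableEquality)
open import Relation.Binary.PropositionalEquality
open import Relation.Nullary using (¬_; Dec; yes; no; does; contradiction)
open import Relation.Nullary.Decidable using (_×-dec_; ¬?; dec-true)
open import Relation.Unary using (Decidable)

-- Finite sums and indicators

-- Whether `X` has a coloop is a statement about all the sets `X - x` at once, while a single chain
-- through `X` meets only one of them. What rescues the count is that, for a coloop `x` of `X`, the
-- coloops of `X - x` are exactly the other coloops of `X`. The downward runs of `t` rank drops from
-- `X` are therefore the ordered choices of `t` coloops of `X`. Chain sums thus give, for every `t`,
-- the sum of the binomial coefficients of the coloop numbers, and these sums fix how many `X` have
-- no coloop. All counting stays in ℕ: signs and quotients are replaced by cancelling factorials and
-- summands already known to agree. Weights that see only size and rank also serve the dual, since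
-- the dual rank of a set is a function of the size and rank of its complement.

private variable
  A B C P Q : Set
  n r : ℕ

infixr 5 ∑-syntax

∑ : List A → (A → ℕ) → ℕ
∑ []       f = 0
∑ (x ∷ xs) f = f x + ∑ xs f

∑-syntax : List A → (A → ℕ) → ℕ
∑-syntax = ∑

syntax ∑-syntax xs (λ x → e) = ∑[ x ← xs ] e

∑-cong : ∀ (xs : List A) {f g : A → ℕ} → (∀ x → f x ≡ g x) → ∑ xs f ≡ ∑ xs g
∑-cong []       f≗g = refl
∑-cong (x ∷ xs) f≗g = cong₂ _+_ (f≗g x) (∑-cong xs f≗g)

∑-zero : ∀ (xs : List A) {f : A → ℕ} → (∀ x → f x ≡ 0) → ∑ xs f ≡ 0
∑-zero []       f≗0 = refl
∑-zero (x ∷ xs) f≗0 = cong₂ _+_ (f≗0 x) (∑-zero xs f≗0)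

+-interchange : ∀ a b c d → (a + b) + (c + d) ≡ (a + c) + (b + d)
+-interchange a b c d = begin
  (a + b) + (c + d)  ≡⟨ +-assoc a b (c + d) ⟩
  a + (b + (c + d))  ≡⟨ cong (a +_) (+-assoc b c d) ⟨
  a + ((b + c) + d)  ≡⟨ cong (λ z → a + (z + d)) (+-comm b c) ⟩
  a + ((c + b) + d)  ≡⟨ cong (a +_) (+-assoc c b d) ⟩
  a + (c + (b + d))  ≡⟨ +-assoc a c (b + d) ⟨
  (a + c) + (b + d)  ∎
  where open ≡-Reasoning

∑-+ : ∀ (xs : List A) (f g : A → ℕ) → ∑[ x ← xs ] (f x + g x) ≡ ∑ xs f + ∑ xs g
∑-+ []       f g = refl
∑-+ (x ∷ xs) f g =
  trans (cong (f x + g x +_) (∑-+ xs f g)) (+-interchange (f x) (g x) (∑ xs f) (∑ xs g))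

∑-*ˡ : ∀ (xs : List A) c (f : A → ℕ) → ∑[ x ← xs ] c * f x ≡ c * ∑ xs f
∑-*ˡ []       c f = sym (*-zeroʳ c)
∑-*ˡ (x ∷ xs) c f = trans (cong (c * f x +_) (∑-*ˡ xs c f)) (sym (*-distribˡ-+ c (f x) (∑ xs f)))

∑-*ʳ : ∀ (xs : List A) c (f : A → ℕ) → ∑[ x ← xs ] f x * c ≡ ∑ xs f * c
∑-*ʳ xs c f = begin
  ∑[ x ← xs ] f x * c  ≡⟨ ∑-cong xs (λ x → *-comm (f x) c) ⟩
  ∑[ x ← xs ] c * f x  ≡⟨ ∑-*ˡ xs c f ⟩
  c * ∑ xs f           ≡⟨ *-comm c (∑ xs f) ⟩
  ∑ xs f * c           ∎
  where open ≡-Reasoning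

∑-swap : ∀ (xs : List A) (ys : List B) (f : A → B → ℕ) →
         ∑[ x ← xs ] (∑[ y ← ys ] f x y) ≡ ∑[ y ← ys ] (∑[ x ← xs ] f x y)
∑-swap []       ys f = sym (∑-zero ys (λ _ → refl))
∑-swap (x ∷ xs) ys f =
  trans (cong (∑ ys (f x) +_) (∑-swap xs ys f)) (sym (∑-+ ys (f x) (λ y → ∑ xs (λ x → f x y))))

∑-++ : ∀ (xs ys : List A) f → ∑ (xs ++ ys) f ≡ ∑ xs f + ∑ ys f
∑-++ []       ys f = refl
∑-++ (x ∷ xs) ys f = trans (cong (f x +_) (∑-++ xs ys f)) (sym (+-assoc (f x) (∑ xs f) (∑ ys f)))

∑-map : ∀ (g : A → B) xs f → ∑ (map g xs) f ≡ ∑ xs (f ∘ g)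
∑-map g []       f = refl
∑-map g (x ∷ xs) f = cong (f (g x) +_) (∑-map g xs f)

∑-cartesianProductWith : ∀ (_∙_ : A → B → C) xs ys f →
  ∑ (cartesianProductWith _∙_ xs ys) f ≡ ∑[ x ← xs ] (∑[ y ← ys ] f (x ∙ y))
∑-cartesianProductWith _∙_ []       ys f = refl
∑-cartesianProductWith _∙_ (x ∷ xs) ys f =
  trans (∑-++ (map (x ∙_) ys) (cartesianProductWith _∙_ xs ys) f)
        (cong₂ _+_ (∑-map (x ∙_) ys f) (∑-cartesianProductWith _∙_ xs ys f))

∑-vectors : ∀ (xs : List A) k (f : Vec A (suc k) → ℕ) →
  ∑ (vectors xs (suc k)) f ≡ ∑[ x ← xs ] (∑[ v ← vectors xs k ] f (x ∷ v))
∑-vectors xs k = ∑-cartesianProductWith _∷_ xs (vectors xs k)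

∑-tabulate : ∀ {n} (g : Fin n → A) f → ∑ (tabulate g) f ≡ ∑ (allFin n) (f ∘ g)
∑-tabulate {n = zero}  g f = refl
∑-tabulate {n = suc n} g f = cong (f (g zero) +_)
  (trans (∑-tabulate (g ∘ suc) f) (sym (∑-tabulate suc (f ∘ g))))

∑-allFin-suc : ∀ n (f : Fin (suc n) → ℕ) → ∑ (allFin (suc n)) f ≡ f zero + ∑ (allFin n) (f ∘ suc)
∑-allFin-suc n f = cong (f zero +_) (∑-tabulate suc f)

χ : Dec P → ℕ
χ p = if does p then 1 else 0

χ-yes : (p : Dec P) → P → χ p ≡ 1
χ-yes (yes _) _ = refl
χ-yes (no ¬p) p = contradiction p ¬p

χ-no : (p : Dec P) → ¬ P → χ p ≡ 0
χ-no (yes p) ¬p = contradiction p ¬p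
χ-no (no _)  _  = refl

χ-cong : (p : Dec P) (q : Dec Q) → (P → Q) → (Q → P) → χ p ≡ χ q
χ-cong (yes p) q P⇒Q Q⇒P = sym (χ-yes q (P⇒Q p))
χ-cong (no ¬p) q P⇒Q Q⇒P = sym (χ-no q (¬p ∘ Q⇒P))

χ-× : (p : Dec P) (q : Dec Q) → χ (p ×-dec q) ≡ χ p * χ q
χ-× (yes _) (yes _) = refl
χ-× (yes _) (no _)  = refl
χ-× (no _)  _       = refl

-- Restricted sums are written as indicator-weighted sums over everything, and this is how the
-- restricting condition becomes available as a hypothesis inside a term.
χ-*-cong : (p : Dec P) {a b : ℕ} → (P → a ≡ b) → χ p * a ≡ χ p * b
χ-*-cong (yes p) a≡b = cong (_+ 0) (a≡b p)
χ-*-cong (no _)  _   = refl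

χ-restrict : (p : Dec P) {a : ℕ} → (¬ P → a ≡ 0) → a ≡ χ p * a
χ-restrict (yes _) {a} _   = sym (+-identityʳ a)
χ-restrict (no ¬p)     a≡0 = a≡0 ¬p

∑-filter : ∀ {P : A → Set} (P? : Decidable P) xs f →
           ∑ (filter P? xs) f ≡ ∑[ x ← xs ] χ (P? x) * f x
∑-filter P? []       f = refl
∑-filter P? (x ∷ xs) f with P? x
... | yes _ = cong₂ _+_ (sym (+-identityʳ (f x))) (∑-filter P? xs f)
... | no _  = ∑-filter P? xs f

length-filter : ∀ {P : A → Set} (P? : Decidable P) xs →
                length (filter P? xs) ≡ ∑[ x ← xs ] χ (P? x)
length-filter P? []       = refl
length-filter P? (x ∷ xs) with P? x
... | yes _ = cong suc (length-filter P? xs)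
... | no _  = length-filter P? xs

-- Every element of A occurs exactly once in the list.
Enumerates : List A → Set₁
Enumerates {A} xs = ∀ {P : A → Set} (P? : Decidable P) (f : A → ℕ) {a} →
  P a → (∀ {x} → P x → x ≡ a) → ∑[ x ← xs ] χ (P? x) * f x ≡ f a

χ*-zero : (p : Dec P) {a : ℕ} → ¬ P → χ p * a ≡ 0
χ*-zero p {a} ¬p = cong (_* a) (χ-no p ¬p)

χ*-one : (p : Dec P) {a : ℕ} → P → χ p * a ≡ a
χ*-one p {a} holds = trans (cong (_* a) (χ-yes p holds)) (*-identityˡ a)

allFin-enumerates : ∀ n → Enumerates (allFin n)
allFin-enumerates (suc n) P? f {zero} pa unique = begin
  ∑[ x ← allFin (suc n) ] χ (P? x) * f x                    ≡⟨ ∑-allFin-suc n _ ⟩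
  χ (P? zero) * f zero + (∑[ x ← allFin n ] χ (P? (suc x)) * f (suc x))
    ≡⟨ cong₂ _+_ (χ*-one (P? zero) pa)
         (∑-zero (allFin n) λ x → χ*-zero (P? (suc x)) (λ px → case (unique px))) ⟩
  f zero + 0                                                ≡⟨ +-identityʳ (f zero) ⟩
  f zero                                                    ∎
  where
  open ≡-Reasoning
  case : ∀ {m} {x : Fin m} {R : Set} → suc x ≡ zero → R
  case ()
allFin-enumerates (suc n) P? f {suc a} pa unique = begin
  ∑[ x ← allFin (suc n) ] χ (P? x) * f x                    ≡⟨ ∑-allFin-suc n _ ⟩
  χ (P? zero) * f zero + (∑[ x ← allFin n ] χ (P? (suc x)) * f (suc x))
    ≡⟨ cong₂ _+_ (χ*-zero (P? zero) (λ p0 → case (unique p0)))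
         (allFin-enumerates n (P? ∘ suc) (f ∘ suc) pa (λ px → sucᶠ-injective (unique px))) ⟩
  f (suc a) ∎
  where
  open ≡-Reasoning
  case : ∀ {m} {x : Fin m} {R : Set} → zero ≡ suc x → R
  case ()

subsets-suc : ∀ n (f : Subset (suc n) → ℕ) →
  ∑ (subsets (suc n)) f ≡ ∑ (subsets n) (f ∘ (outside ∷_)) + ∑ (subsets n) (f ∘ (inside ∷_))
subsets-suc n f = trans (∑-vectors (outside ∷ inside ∷ []) n f)
  (cong (∑ (subsets n) (f ∘ (outside ∷_)) +_) (+-identityʳ (∑ (subsets n) (f ∘ (inside ∷_)))))

subsets-enumerates : ∀ n → Enumerates (subsets n)
subsets-enumerates zero P? f {[]} pa unique = trans (+-identityʳ _) (χ*-one (P? []) pa)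
subsets-enumerates (suc n) P? f {outside ∷ X} pa unique = trans (subsets-suc n _) (trans
  (cong₂ _+_
    (subsets-enumerates n (P? ∘ (outside ∷_)) (f ∘ (outside ∷_)) pa (∷-injectiveʳ ∘ unique))
    (∑-zero (subsets n) λ Y → χ*-zero (P? (inside ∷ Y)) λ pY → contradiction (∷-injectiveˡ (unique pY)) λ ()))
  (+-identityʳ _))
subsets-enumerates (suc n) P? f {inside ∷ X} pa unique = trans (subsets-suc n _)
  (cong₂ _+_
    (∑-zero (subsets n) λ Y → χ*-zero (P? (outside ∷ Y)) λ pY → contradiction (∷-injectiveˡ (unique pY)) λ ())
    (subsets-enumerates n (P? ∘ (inside ∷_)) (f ∘ (inside ∷_)) pa (∷-injectiveʳ ∘ unique)))

-- Adding and removing an element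

x∈p─q⇒x∉q : ∀ {x} (p q : Subset n) → x ∈ p ─ q → x ∉ q
x∈p─q⇒x∉q (_ ∷ p) (inside  ∷ q) ()         here
x∈p─q⇒x∉q (_ ∷ p) (_       ∷ q) (there x∈) (there x∈q) = x∈p─q⇒x∉q p q x∈ x∈q

x∈p∪⁅x⁆ : ∀ {x} (p : Subset n) → x ∈ p ∪ ⁅ x ⁆
x∈p∪⁅x⁆ {x = x} p = x∈p∪q⁺ (inj₂ (x∈⁅x⁆ x))

y∈p∪⁅x⁆⁻ : ∀ {x y} (p : Subset n) → y ∈ p ∪ ⁅ x ⁆ → y ∈ p ⊎ y ≡ x
y∈p∪⁅x⁆⁻ {x = x} p y∈ = [ inj₁ , inj₂ ∘ x∈⁅y⁆⇒x≡y x ]′ (x∈p∪q⁻ p ⁅ x ⁆ y∈)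

∪⁅⁆-least : ∀ {x} {p q : Subset n} → p ⊆ q → x ∈ q → p ∪ ⁅ x ⁆ ⊆ q
∪⁅⁆-least {p = p} p⊆q x∈q y∈ = [ p⊆q , (λ y≡x → subst (_∈ _) (sym y≡x) x∈q) ]′ (y∈p∪⁅x⁆⁻ p y∈)

x∈p⇒p∪⁅x⁆≡p : ∀ {x} {p : Subset n} → x ∈ p → p ∪ ⁅ x ⁆ ≡ p
x∈p⇒p∪⁅x⁆≡p {x = x} x∈p = ⊆-antisym (∪⁅⁆-least id x∈p) (p⊆p∪q ⁅ x ⁆)

p-x⊆p : ∀ {x} (p : Subset n) → p - x ⊆ p
p-x⊆p {x = x} p = p─q⊆p p ⁅ x ⁆

x∉p-x : ∀ {x} (p : Subset n) → x ∉ p - x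
x∉p-x {x = x} p x∈ = x∈p─q⇒x∉q p ⁅ x ⁆ x∈ (x∈⁅x⁆ x)

y∈p-x⇒y≢x : ∀ {x y} (p : Subset n) → y ∈ p - x → y ≢ x
y∈p-x⇒y≢x p y∈ refl = x∉p-x p y∈

p-x∪⁅x⁆≡p : ∀ {x} {p : Subset n} → x ∈ p → (p - x) ∪ ⁅ x ⁆ ≡ p
p-x∪⁅x⁆≡p {x = x} {p} x∈p = ⊆-antisym (∪⁅⁆-least (p-x⊆p p) x∈p) ⊇
  where
  ⊇ : p ⊆ (p - x) ∪ ⁅ x ⁆
  ⊇ {y} y∈p with y ≟ᶠ x
  ... | yes refl = x∈p∪⁅x⁆ (p - x)
  ... | no y≢x   = x∈p∪q⁺ (inj₁ (x∈p∧x≢y⇒x∈p-y y∈p y≢x))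

p∪⁅x⁆-x≡p : ∀ {x} {p : Subset n} → x ∉ p → (p ∪ ⁅ x ⁆) - x ≡ p
p∪⁅x⁆-x≡p {x = x} {p} x∉p = ⊆-antisym
  (λ y∈ → [ id , (λ y≡x → contradiction y≡x (y∈p-x⇒y≢x (p ∪ ⁅ x ⁆) y∈)) ]′
            (y∈p∪⁅x⁆⁻ p (p-x⊆p (p ∪ ⁅ x ⁆) y∈)))
  (λ y∈p → x∈p∧x≢y⇒x∈p-y (p⊆p∪q ⁅ x ⁆ y∈p) λ { refl → x∉p y∈p })

∣p∪⁅x⁆∣≡1+∣p∣ : ∀ {x} {p : Subset n} → x ∉ p → ∣ p ∪ ⁅ x ⁆ ∣ ≡ suc ∣ p ∣
∣p∪⁅x⁆∣≡1+∣p∣ {n} {x} {p} x∉p = begin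
  ∣ p ∪ ⁅ x ⁆ ∣                    ≡⟨ +-identityʳ _ ⟨
  ∣ p ∪ ⁅ x ⁆ ∣ + 0                ≡⟨ cong (∣ p ∪ ⁅ x ⁆ ∣ +_) (trans (cong ∣_∣ empty) (∣⊥∣≡0 n)) ⟨
  ∣ p ∪ ⁅ x ⁆ ∣ + ∣ p ∩ ⁅ x ⁆ ∣    ≡⟨ ∣p∪q∣+∣p∩q∣≡∣p∣+∣q∣ p ⁅ x ⁆ ⟩
  ∣ p ∣ + ∣ ⁅ x ⁆ ∣                ≡⟨ cong (∣ p ∣ +_) (∣⁅x⁆∣≡1 x) ⟩
  ∣ p ∣ + 1                        ≡⟨ +-comm ∣ p ∣ 1 ⟩
  suc ∣ p ∣                        ∎
  where
  open ≡-Reasoning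
  empty : p ∩ ⁅ x ⁆ ≡ ⊥
  empty = Empty-unique λ (y , y∈) → let y∈p , y∈x = x∈p∩q⁻ p ⁅ x ⁆ y∈ in
            x∉p (subst (_∈ p) (x∈⁅y⁆⇒x≡y x y∈x) y∈p)

1+∣p-x∣≡∣p∣ : ∀ {x} {p : Subset n} → x ∈ p → suc ∣ p - x ∣ ≡ ∣ p ∣
1+∣p-x∣≡∣p∣ {p = p} x∈p =
  trans (sym (∣p∪⁅x⁆∣≡1+∣p∣ (x∉p-x p))) (cong ∣_∣ (p-x∪⁅x⁆≡p x∈p))

∣p∣≡0⇒p≡⊥ : ∀ {p : Subset n} → ∣ p ∣ ≡ 0 → p ≡ ⊥
∣p∣≡0⇒p≡⊥ {p = p} ∣p∣≡0 = Empty-unique λ (x , x∈p) → 1+n≢0 (trans (1+∣p-x∣≡∣p∣ x∈p) ∣p∣≡0)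

∁-involutive : ∀ (p : Subset n) → ∁ (∁ p) ≡ p
∁-involutive []      = refl
∁-involutive (b ∷ p) = cong₂ _∷_ (Bool.not-involutive b) (∁-involutive p)

∁⊤≡⊥ : ∁ (⊤ {n}) ≡ ⊥
∁⊤≡⊥ = Empty-unique λ (x , x∈) → x∈∁p⇒x∉p x∈ ∈⊤

∁p∪⁅x⁆≡∁[p-x] : ∀ (p : Subset n) x → ∁ p ∪ ⁅ x ⁆ ≡ ∁ (p - x)
∁p∪⁅x⁆≡∁[p-x] p x = ⊆-antisym
  (∪⁅⁆-least (λ y∈ → x∉p⇒x∈∁p (x∈∁p⇒x∉p y∈ ∘ p-x⊆p p)) (x∉p⇒x∈∁p (x∉p-x p)))
  ⊇
  where
  ⊇ : ∁ (p - x) ⊆ ∁ p ∪ ⁅ x ⁆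
  ⊇ {y} y∈ with y ≟ᶠ x
  ... | yes refl = x∈p∪⁅x⁆ (∁ p)
  ... | no y≢x   = x∈p∪q⁺ (inj₁ (x∉p⇒x∈∁p λ y∈p → x∈∁p⇒x∉p y∈ (x∈p∧x≢y⇒x∈p-y y∈p y≢x)))

comprehension : ∀ {P : Fin n → Set} → (∀ x → Dec (P x)) → Subset n
comprehension P? = Vec.tabulate (does ∘ P?)

∈-comprehension⁺ : ∀ {P : Fin n → Set} (P? : ∀ x → Dec (P x)) {x} → P x → x ∈ comprehension P?
∈-comprehension⁺ P? {x} px = lookup⇒[]= x (comprehension P?)
  (trans (lookup∘tabulate (does ∘ P?) x) (dec-true (P? x) px))

∈-comprehension⁻ : ∀ {P : Fin n → Set} (P? : ∀ x → Dec (P x)) {x} → x ∈ comprehension P? → P x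
∈-comprehension⁻ {P = P} P? {x} x∈ =
  does-true (P? x) (trans (sym (lookup∘tabulate (does ∘ P?) x)) ([]=⇒lookup x∈))
  where
  does-true : ∀ {A : Set} (a : Dec A) → does a ≡ true → A
  does-true (yes a) _ = a

subset-induction : ∀ (P : Subset n → Set) → P ⊥ →
  (∀ X {x} → x ∉ X → P X → P (X ∪ ⁅ x ⁆)) → ∀ X → P X
subset-induction {n} P P⊥ P∪ X = go ∣ X ∣ X refl
  where
  go : ∀ k X → ∣ X ∣ ≡ k → P X
  go zero    X ∣X∣≡0 = subst P (sym (∣p∣≡0⇒p≡⊥ ∣X∣≡0)) P⊥
  go (suc k) X ∣X∣≡1+k with nonempty? X
  ... | no empty = subst P (sym (Empty-unique empty)) P⊥
  ... | yes (x , x∈X) = subst P (p-x∪⁅x⁆≡p x∈X)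
    (P∪ (X - x) (x∉p-x X) (go k (X - x) (suc-injective (trans (1+∣p-x∣≡∣p∣ x∈X) ∣X∣≡1+k))))

-- Weighted sums over maximal chains of subsets

-- Inserting `x` and deleting `x` are inverse bijections between the sets avoiding `x` and the sets
-- containing it. Without a reindexing lemma, the second set is introduced as a summation variable,
-- the sums are swapped, and the first set is summed away.
∑-insert-delete : ∀ {n} x (h : Subset n → Subset n → ℕ) →
  ∑[ S ← subsets n ] χ (¬? (x ∈? S)) * h S (S ∪ ⁅ x ⁆) ≡
  ∑[ X ← subsets n ] χ (x ∈? X) * h (X - x) X
∑-insert-delete {n} x h = begin
  ∑[ S ← subsets n ] χ (¬? (x ∈? S)) * h S (S ∪ ⁅ x ⁆)
    ≡⟨ ∑-cong (subsets n) (λ S → cong (χ (¬? (x ∈? S)) *_)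
         (sym (subsets-enumerates n (_≟ˢ S ∪ ⁅ x ⁆) (h S) refl id))) ⟩
  ∑[ S ← subsets n ] χ (¬? (x ∈? S)) * (∑[ X ← subsets n ] χ (X ≟ˢ S ∪ ⁅ x ⁆) * h S X)
    ≡⟨ ∑-cong (subsets n) (λ S → sym (∑-*ˡ (subsets n) (χ (¬? (x ∈? S))) _)) ⟩
  ∑[ S ← subsets n ] (∑[ X ← subsets n ] χ (¬? (x ∈? S)) * (χ (X ≟ˢ S ∪ ⁅ x ⁆) * h S X))
    ≡⟨ ∑-swap (subsets n) (subsets n) _ ⟩
  ∑[ X ← subsets n ] (∑[ S ← subsets n ] χ (¬? (x ∈? S)) * (χ (X ≟ˢ S ∪ ⁅ x ⁆) * h S X))
    ≡⟨ ∑-cong (subsets n) (λ X → ∑-cong (subsets n) (λ S → exchange S X)) ⟩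
  ∑[ X ← subsets n ] (∑[ S ← subsets n ] χ (x ∈? X) * (χ (S ≟ˢ X - x) * h S X))
    ≡⟨ ∑-cong (subsets n) (λ X → ∑-*ˡ (subsets n) (χ (x ∈? X)) _) ⟩
  ∑[ X ← subsets n ] χ (x ∈? X) * (∑[ S ← subsets n ] χ (S ≟ˢ X - x) * h S X)
    ≡⟨ ∑-cong (subsets n) (λ X → cong (χ (x ∈? X) *_)
         (subsets-enumerates n (_≟ˢ X - x) (λ S → h S X) refl id)) ⟩
  ∑[ X ← subsets n ] χ (x ∈? X) * h (X - x) X ∎
  where
  open ≡-Reasoning
  exchange : ∀ S X → χ (¬? (x ∈? S)) * (χ (X ≟ˢ S ∪ ⁅ x ⁆) * h S X) ≡
                     χ (x ∈? X) * (χ (S ≟ˢ X - x) * h S X)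
  exchange S X = begin
    χ (¬? (x ∈? S)) * (χ (X ≟ˢ S ∪ ⁅ x ⁆) * h S X)
      ≡⟨ *-assoc (χ (¬? (x ∈? S))) _ _ ⟨
    χ (¬? (x ∈? S)) * χ (X ≟ˢ S ∪ ⁅ x ⁆) * h S X
      ≡⟨ cong (_* h S X) (χ-× (¬? (x ∈? S)) (X ≟ˢ S ∪ ⁅ x ⁆)) ⟨
    χ (¬? (x ∈? S) ×-dec (X ≟ˢ S ∪ ⁅ x ⁆)) * h S X
      ≡⟨ cong (_* h S X) (χ-cong (¬? (x ∈? S) ×-dec (X ≟ˢ S ∪ ⁅ x ⁆)) ((x ∈? X) ×-dec (S ≟ˢ X - x))
           (λ { (x∉S , refl) → x∈p∪⁅x⁆ S , sym (p∪⁅x⁆-x≡p x∉S) })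
           (λ { (x∈X , refl) → x∉p-x X , sym (p-x∪⁅x⁆≡p x∈X) })) ⟩
    χ ((x ∈? X) ×-dec (S ≟ˢ X - x)) * h S X
      ≡⟨ cong (_* h S X) (χ-× (x ∈? X) (S ≟ˢ X - x)) ⟩
    χ (x ∈? X) * χ (S ≟ˢ X - x) * h S X
      ≡⟨ *-assoc (χ (x ∈? X)) _ _ ⟩
    χ (x ∈? X) * (χ (S ≟ˢ X - x) * h S X) ∎

*-swap : ∀ a b c → a * (b * c) ≡ b * (a * c)
*-swap a b c = begin
  a * (b * c)  ≡⟨ *-assoc a b c ⟨
  a * b * c    ≡⟨ cong (_* c) (*-comm a b) ⟩
  b * a * c    ≡⟨ *-assoc b a c ⟩
  b * (a * c)  ∎
  where open ≡-Reasoning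

-- The up and down operators of the Boolean lattice are adjoint for the pairing that sums
-- `f S * g S`.
∑-adjoint : ∀ {n} (f g : Subset n → ℕ) →
  ∑[ S ← subsets n ] f S * (∑[ x ← allFin n ] χ (¬? (x ∈? S)) * g (S ∪ ⁅ x ⁆)) ≡
  ∑[ X ← subsets n ] (∑[ x ← allFin n ] χ (x ∈? X) * f (X - x)) * g X
∑-adjoint {n} f g = begin
  ∑[ S ← subsets n ] f S * (∑[ x ← allFin n ] χ (¬? (x ∈? S)) * g (S ∪ ⁅ x ⁆))
    ≡⟨ ∑-cong (subsets n) (λ S → trans (sym (∑-*ˡ (allFin n) (f S) _))
         (∑-cong (allFin n) λ x → *-swap (f S) (χ (¬? (x ∈? S))) _)) ⟩
  ∑[ S ← subsets n ] (∑[ x ← allFin n ] χ (¬? (x ∈? S)) * (f S * g (S ∪ ⁅ x ⁆)))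
    ≡⟨ ∑-swap (subsets n) (allFin n) _ ⟩
  ∑[ x ← allFin n ] (∑[ S ← subsets n ] χ (¬? (x ∈? S)) * (f S * g (S ∪ ⁅ x ⁆)))
    ≡⟨ ∑-cong (allFin n) (λ x → ∑-insert-delete x λ S X → f S * g X) ⟩
  ∑[ x ← allFin n ] (∑[ X ← subsets n ] χ (x ∈? X) * (f (X - x) * g X))
    ≡⟨ ∑-swap (allFin n) (subsets n) _ ⟩
  ∑[ X ← subsets n ] (∑[ x ← allFin n ] χ (x ∈? X) * (f (X - x) * g X))
    ≡⟨ ∑-cong (subsets n) (λ X → trans
         (∑-cong (allFin n) λ x → sym (*-assoc (χ (x ∈? X)) (f (X - x)) (g X)))
         (∑-*ʳ (allFin n) (g X) _)) ⟩
  ∑[ X ← subsets n ] (∑[ x ← allFin n ] χ (x ∈? X) * f (X - x)) * g X ∎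
  where open ≡-Reasoning

-- up ψ k S sums the product of the weights ψ over the chains of length k that
-- start at S; dn ψ k X does so for the chains from ⊥ to X, leaving out ψ X.

module _ {n : ℕ} (ψ : Subset n → ℕ) where

  up : ℕ → Subset n → ℕ
  up zero    S = ψ S
  up (suc k) S = ψ S * (∑[ x ← allFin n ] χ (¬? (x ∈? S)) * up k (S ∪ ⁅ x ⁆))

  dn : ℕ → Subset n → ℕ
  dn zero    X = χ (X ≟ˢ ⊥)
  dn (suc k) X = ∑[ x ← allFin n ] χ (x ∈? X) * (ψ (X - x) * dn k (X - x))

  dn-size : ∀ k {X} → ∣ X ∣ ≢ k → dn k X ≡ 0
  dn-size zero    {X} ∣X∣≢0   = χ-no (X ≟ˢ ⊥) λ { refl → ∣X∣≢0 (∣⊥∣≡0 n) }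
  dn-size (suc k) {X} ∣X∣≢1+k = ∑-zero (allFin n) λ x → trans
    (χ-*-cong (x ∈? X) λ x∈X → trans
      (cong (ψ (X - x) *_) (dn-size k λ eq → ∣X∣≢1+k (trans (sym (1+∣p-x∣≡∣p∣ x∈X)) (cong suc eq))))
      (*-zeroʳ (ψ (X - x))))
    (*-zeroʳ (χ (x ∈? X)))

  -- Each chain is cut at its set of size `k`, whose weight is charged to the upper half. The
  -- induction moves the cut one step up: the first factor of `up` passes to `dn`, and the
  -- adjunction carries the choice of the next element across.
  up-split : ∀ k l → up (k + l) ⊥ ≡ ∑[ S ← subsets n ] dn k S * up l S
  up-split zero    l = sym (subsets-enumerates n (_≟ˢ ⊥) (up l) refl id)
  up-split (suc k) l = begin
    up (suc k + l) ⊥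
      ≡⟨ cong (λ m → up m ⊥) (sym (+-suc k l)) ⟩
    up (k + suc l) ⊥
      ≡⟨ up-split k (suc l) ⟩
    ∑[ S ← subsets n ] dn k S * (ψ S * (∑[ x ← allFin n ] χ (¬? (x ∈? S)) * up l (S ∪ ⁅ x ⁆)))
      ≡⟨ ∑-cong (subsets n) (λ S → trans (*-swap (dn k S) (ψ S) _) (sym (*-assoc (ψ S) (dn k S) _))) ⟩
    ∑[ S ← subsets n ] ψ S * dn k S * (∑[ x ← allFin n ] χ (¬? (x ∈? S)) * up l (S ∪ ⁅ x ⁆))
      ≡⟨ ∑-adjoint (λ S → ψ S * dn k S) (up l) ⟩
    ∑[ X ← subsets n ] dn (suc k) X * up l X ∎
    where open ≡-Reasoning

  up-⊥≡dn-⊤ : up n ⊥ ≡ dn n ⊤ * ψ ⊤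
  up-⊥≡dn-⊤ = begin
    up n ⊥                                          ≡⟨ cong (λ m → up m ⊥) (sym (+-identityʳ n)) ⟩
    up (n + 0) ⊥                                    ≡⟨ up-split n 0 ⟩
    ∑[ S ← subsets n ] dn n S * ψ S                 ≡⟨ ∑-cong (subsets n) only⊤ ⟩
    ∑[ S ← subsets n ] χ (S ≟ˢ ⊤) * (dn n S * ψ S)  ≡⟨ subsets-enumerates n (_≟ˢ ⊤) (λ S → dn n S * ψ S) refl id ⟩
    dn n ⊤ * ψ ⊤                                    ∎
    where
    open ≡-Reasoning
    only⊤ : ∀ S → dn n S * ψ S ≡ χ (S ≟ˢ ⊤) * (dn n S * ψ S)
    only⊤ S = χ-restrict (S ≟ˢ ⊤) λ S≢⊤ → cong (_* ψ S) (dn-size n λ ∣S∣≡n → S≢⊤ (∣p∣≡n⇒p≡⊤ ∣S∣≡n))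

-- Complementation turns a chain ascending from `∁ S` into one descending from `S`. The factor `ψ S`
-- appears because `up` includes the weight of its starting set and `dn` does not.
up-∁ : ∀ {n} (ψ : Subset n → ℕ) k {S} → ∣ S ∣ ≡ k → up (ψ ∘ ∁) k (∁ S) ≡ ψ S * dn ψ k S
up-∁ ψ zero {S} ∣S∣≡0 = begin
  ψ (∁ (∁ S))      ≡⟨ cong ψ (∁-involutive S) ⟩
  ψ S              ≡⟨ *-identityʳ (ψ S) ⟨
  ψ S * 1          ≡⟨ cong (ψ S *_) (χ-yes (S ≟ˢ ⊥) (∣p∣≡0⇒p≡⊥ ∣S∣≡0)) ⟨
  ψ S * χ (S ≟ˢ ⊥) ∎
  where open ≡-Reasoning
up-∁ {n} ψ (suc k) {S} ∣S∣≡1+k = cong₂ _*_ (cong ψ (∁-involutive S)) (∑-cong (allFin n) λ x → begin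
  χ (¬? (x ∈? ∁ S)) * up (ψ ∘ ∁) k (∁ S ∪ ⁅ x ⁆)
    ≡⟨ cong₂ _*_ (χ-cong (¬? (x ∈? ∁ S)) (x ∈? S) x∉∁p⇒x∈p x∈p⇒x∉∁p)
                 (cong (up (ψ ∘ ∁) k) (∁p∪⁅x⁆≡∁[p-x] S x)) ⟩
  χ (x ∈? S) * up (ψ ∘ ∁) k (∁ (S - x))
    ≡⟨ χ-*-cong (x ∈? S) (λ x∈S → up-∁ ψ k (suc-injective (trans (1+∣p-x∣≡∣p∣ x∈S) ∣S∣≡1+k))) ⟩
  χ (x ∈? S) * (ψ (S - x) * dn ψ k (S - x)) ∎)
  where open ≡-Reasoning

up-∁-⊥ : ∀ {n} (ψ : Subset n → ℕ) → up (ψ ∘ ∁) n ⊥ ≡ up ψ n ⊥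
up-∁-⊥ {n} ψ = begin
  up (ψ ∘ ∁) n ⊥      ≡⟨ cong (up (ψ ∘ ∁) n) ∁⊤≡⊥ ⟨
  up (ψ ∘ ∁) n (∁ ⊤)  ≡⟨ up-∁ ψ n (∣⊤∣≡n n) ⟩
  ψ ⊤ * dn ψ n ⊤      ≡⟨ *-comm (ψ ⊤) (dn ψ n ⊤) ⟩
  dn ψ n ⊤ * ψ ⊤      ≡⟨ up-⊥≡dn-⊤ ψ ⟨
  up ψ n ⊥            ∎
  where open ≡-Reasoning

up-cong : ∀ {n} {ψ ψ′ : Subset n → ℕ} → (∀ S → ψ S ≡ ψ′ S) → ∀ k S → up ψ k S ≡ up ψ′ k S
up-cong         ψ≗ψ′ zero    S = ψ≗ψ′ S
up-cong {n = n} ψ≗ψ′ (suc k) S = cong₂ _*_ (ψ≗ψ′ S)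
  (∑-cong (allFin n) λ x → cong (χ (¬? (x ∈? S)) *_) (up-cong ψ≗ψ′ k (S ∪ ⁅ x ⁆)))

-- Coloops, circuits and cyclic sets

∑-term≤ : ∀ {A : Set} {xs : List A} (f : A → ℕ) {x} → x ListMem.∈ xs → f x ≤ ∑ xs f
∑-term≤ f (Any.here refl) = m≤m+n _ _
∑-term≤ f (Any.there x∈)  = ≤-trans (∑-term≤ f x∈) (m≤n+m _ _)

x∈⋃⁺ : ∀ {n x} {C : Subset n} {Cs} → C ListMem.∈ Cs → x ∈ C → x ∈ ⋃ Cs
x∈⋃⁺ (Any.here refl) x∈C = x∈p∪q⁺ (inj₁ x∈C)
x∈⋃⁺ (Any.there C∈)  x∈C = x∈p∪q⁺ (inj₂ (x∈⋃⁺ C∈ x∈C))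

x∈⋃⁻ : ∀ {n x} (Cs : List (Subset n)) → x ∈ ⋃ Cs → ∃[ C ] C ListMem.∈ Cs × x ∈ C
x∈⋃⁻ []       x∈ = contradiction x∈ ∉⊥
x∈⋃⁻ (C ∷ Cs) x∈ with x∈p∪q⁻ C (⋃ Cs) x∈
... | inj₁ x∈C  = C , Any.here refl , x∈C
... | inj₂ x∈Cs = let D , D∈ , x∈D = x∈⋃⁻ Cs x∈Cs in D , Any.there D∈ , x∈D

∑-∈≡∣∣ : ∀ {n} (X : Subset n) → ∑[ x ← allFin n ] χ (x ∈? X) ≡ ∣ X ∣
∑-∈≡∣∣ {n} = subset-induction (λ X → ∑[ x ← allFin n ] χ (x ∈? X) ≡ ∣ X ∣)
  (trans (∑-zero (allFin n) λ x → χ-no (x ∈? ⊥) ∉⊥) (sym (∣⊥∣≡0 n)))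
  λ X {x} x∉X ih → begin
    ∑[ y ← allFin n ] χ (y ∈? X ∪ ⁅ x ⁆)
      ≡⟨ ∑-cong (allFin n) (step X x∉X) ⟩
    ∑[ y ← allFin n ] (χ (y ≟ᶠ x) * 1 + χ (y ∈? X))
      ≡⟨ ∑-+ (allFin n) (λ y → χ (y ≟ᶠ x) * 1) (λ y → χ (y ∈? X)) ⟩
    (∑[ y ← allFin n ] χ (y ≟ᶠ x) * 1) + (∑[ y ← allFin n ] χ (y ∈? X))
      ≡⟨ cong₂ _+_ (allFin-enumerates n (_≟ᶠ x) (λ _ → 1) refl id) ih ⟩
    suc ∣ X ∣
      ≡⟨ ∣p∪⁅x⁆∣≡1+∣p∣ x∉X ⟨
    ∣ X ∪ ⁅ x ⁆ ∣ ∎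
  where
  open ≡-Reasoning
  step : ∀ X {x} → x ∉ X → ∀ y → χ (y ∈? X ∪ ⁅ x ⁆) ≡ χ (y ≟ᶠ x) * 1 + χ (y ∈? X)
  step X {x} x∉X y with y ≟ᶠ x
  ... | yes refl = trans (χ-yes (x ∈? X ∪ ⁅ x ⁆) (x∈p∪⁅x⁆ X)) (cong suc (sym (χ-no (x ∈? X) x∉X)))
  ... | no y≢x   = χ-cong (y ∈? X ∪ ⁅ x ⁆) (y ∈? X)
    (λ y∈ → [ id , (λ y≡x → contradiction y≡x y≢x) ]′ (y∈p∪⁅x⁆⁻ X y∈)) (p⊆p∪q ⁅ x ⁆)

module _ {n r : ℕ} (M : Matroid n r) where

  open Matroid M using (rank; rank-size; rank-mono; rank-submod; rank-subadd; rank-⊥; Independent;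
                        Circuit; Cyclic; circuit?; circuitsWithin)

  -- A coloop of the restriction of `M` to `X`.
  Coloop : Subset n → Fin n → Set
  Coloop X x = suc (rank (X - x)) ≡ rank X

  coloop? : ∀ X x → Dec (Coloop X x)
  coloop? X x = suc (rank (X - x)) ≟ rank X

  Coloopless : Subset n → Set
  Coloopless X = ∀ {x} → x ∈ X → rank (X - x) ≡ rank X

  #coloops : Subset n → ℕ
  #coloops X = ∑[ x ← allFin n ] χ (x ∈? X) * χ (coloop? X x)

  rank-∪⁅⁆ : ∀ X x → rank (X ∪ ⁅ x ⁆) ≤ suc (rank X)
  rank-∪⁅⁆ X x = begin
    rank (X ∪ ⁅ x ⁆)      ≤⟨ rank-subadd X ⁅ x ⁆ ⟩
    rank X + rank ⁅ x ⁆   ≤⟨ +-monoʳ-≤ (rank X) (≤-trans (rank-size ⁅ x ⁆) (≤-reflexive (∣⁅x⁆∣≡1 x))) ⟩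
    rank X + 1            ≡⟨ +-comm (rank X) 1 ⟩
    suc (rank X)          ∎
    where open ≤-Reasoning

  rank-delete : ∀ {X x} → x ∈ X → rank X ≤ suc (rank (X - x))
  rank-delete {X} {x} x∈X =
    ≤-trans (≤-reflexive (cong rank (sym (p-x∪⁅x⁆≡p x∈X)))) (rank-∪⁅⁆ (X - x) x)

  rank-delete≤ : ∀ X x → rank (X - x) ≤ rank X
  rank-delete≤ X x = rank-mono (p-x⊆p X)

  ¬coloop⇒rank≡ : ∀ {X x} → x ∈ X → ¬ Coloop X x → rank (X - x) ≡ rank X
  ¬coloop⇒rank≡ {X} {x} x∈X ¬coloop = ≤-antisym (rank-delete≤ X x)
    (≮⇒≥ λ r<r → ¬coloop (≤-antisym r<r (rank-delete x∈X)))

  -- Submodularity applied to `X - x` and `Y`: deleting `x` costs the smaller set at least as much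
  -- rank as the larger one.
  rank-diminishing : ∀ {X Y x} → Y ⊆ X → x ∈ Y → rank X + rank (Y - x) ≤ rank (X - x) + rank Y
  rank-diminishing {X} {Y} {x} Y⊆X x∈Y = begin
    rank X + rank (Y - x)                     ≤⟨ +-mono-≤ (rank-mono ∪⊇) (rank-mono ∩⊇) ⟩
    rank ((X - x) ∪ Y) + rank ((X - x) ∩ Y)   ≤⟨ rank-submod (X - x) Y ⟩
    rank (X - x) + rank Y                     ∎
    where
    open ≤-Reasoning
    ∪⊇ : X ⊆ (X - x) ∪ Y
    ∪⊇ {y} y∈X with y ≟ᶠ x
    ... | yes refl = x∈p∪q⁺ (inj₂ x∈Y)
    ... | no y≢x   = x∈p∪q⁺ (inj₁ (x∈p∧x≢y⇒x∈p-y y∈X y≢x))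
    ∩⊇ : Y - x ⊆ (X - x) ∩ Y
    ∩⊇ y∈ = x∈p∩q⁺ (x∈p∧x≢y⇒x∈p-y (Y⊆X (p-x⊆p Y y∈)) (y∈p-x⇒y≢x Y y∈) , p-x⊆p Y y∈)

  coloop-restrict : ∀ {X Y x} → Y ⊆ X → x ∈ Y → Coloop X x → Coloop Y x
  coloop-restrict {X} {Y} {x} Y⊆X x∈Y coloop = ≤-antisym
    (+-cancelˡ-≤ (rank (X - x)) _ _ (begin
      rank (X - x) + suc (rank (Y - x))  ≡⟨ +-suc _ _ ⟩
      suc (rank (X - x)) + rank (Y - x)  ≡⟨ cong (_+ rank (Y - x)) coloop ⟩
      rank X + rank (Y - x)              ≤⟨ rank-diminishing Y⊆X x∈Y ⟩
      rank (X - x) + rank Y              ∎))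
    (rank-delete x∈Y)
    where open ≤-Reasoning

  rank≡-extend : ∀ {X Y x} → Y ⊆ X → x ∈ Y → rank (Y - x) ≡ rank Y → rank (X - x) ≡ rank X
  rank≡-extend {X} {Y} {x} Y⊆X x∈Y eq = ¬coloop⇒rank≡ (Y⊆X x∈Y) λ coloop →
    1+n≢n (trans (coloop-restrict Y⊆X x∈Y coloop) (sym eq))

  -- Deleting `x` and then `y` lowers the rank by two. In the other order the deletion of `x`
  -- accounts for at most one, so the deletion of `y` must account for the rest.
  coloop-extend : ∀ {X x y} → x ∈ X → y ∈ X → y ≢ x → Coloop X x → Coloop (X - x) y → Coloop X y
  coloop-extend {X} {x} {y} x∈X y∈X y≢x coloopX coloopY = ≤-antisym
    (begin
      suc (rank (X - y))           ≤⟨ s≤s (rank-delete (x∈p∧x≢y⇒x∈p-y x∈X (y≢x ∘ sym))) ⟩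
      2 + rank (X - y - x)         ≡⟨ cong (λ Z → 2 + rank Z) (p─x─y≡p─y─x X y x) ⟩
      2 + rank (X - x - y)         ≡⟨ cong suc coloopY ⟩
      suc (rank (X - x))           ≡⟨ coloopX ⟩
      rank X                       ∎)
    (rank-delete y∈X)
    where open ≤-Reasoning

  -- By `coloop-restrict` and `coloop-extend` the coloops of `X - x` are those of `X` other than
  -- `x`, so a count of successive coloop removals depends on nothing but their number.
  #coloops-delete : ∀ {X x} → x ∈ X → Coloop X x → #coloops X ≡ suc (#coloops (X - x))
  #coloops-delete {X} {x} x∈X coloop = begin
    #coloops X
      ≡⟨ ∑-cong (allFin n) step ⟩
    ∑[ y ← allFin n ] (χ (y ≟ᶠ x) * 1 + χ (y ∈? X - x) * χ (coloop? (X - x) y))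
      ≡⟨ ∑-+ (allFin n) (λ y → χ (y ≟ᶠ x) * 1) _ ⟩
    (∑[ y ← allFin n ] χ (y ≟ᶠ x) * 1) + #coloops (X - x)
      ≡⟨ cong (_+ #coloops (X - x)) (allFin-enumerates n (_≟ᶠ x) (λ _ → 1) refl id) ⟩
    suc (#coloops (X - x)) ∎
    where
    open ≡-Reasoning
    step : ∀ y → χ (y ∈? X) * χ (coloop? X y) ≡
                 χ (y ≟ᶠ x) * 1 + χ (y ∈? X - x) * χ (coloop? (X - x) y)
    step y with y ≟ᶠ x
    ... | yes refl = trans (cong₂ _*_ (χ-yes (y ∈? X) x∈X) (χ-yes (coloop? X y) coloop))
      (cong suc (sym (χ*-zero (y ∈? X - y) (x∉p-x X))))
    ... | no y≢x = trans (sym (χ-× (y ∈? X) (coloop? X y))) (trans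
      (χ-cong ((y ∈? X) ×-dec coloop? X y) ((y ∈? X - x) ×-dec coloop? (X - x) y)
        (λ (y∈X , coloopY) → let y∈ = x∈p∧x≢y⇒x∈p-y y∈X y≢x in
           y∈ , coloop-restrict (p-x⊆p X) y∈ coloopY)
        (λ (y∈ , coloopY) → p-x⊆p X y∈ , coloop-extend x∈X (p-x⊆p X y∈) y≢x coloop coloopY))
      (χ-× (y ∈? X - x) (coloop? (X - x) y)))

  #coloops≤size : ∀ X → #coloops X ≤ ∣ X ∣
  #coloops≤size X = ≤-trans (go (allFin n)) (≤-reflexive (∑-∈≡∣∣ X))
    where
    χ≤ : ∀ {P Q : Set} (p : Dec P) (q : Dec Q) → χ p * χ q ≤ χ p
    χ≤ (yes _) (yes _) = ≤-refl
    χ≤ (yes _) (no _)  = z≤n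
    χ≤ (no _)  q       = z≤n
    go : ∀ xs → ∑[ x ← xs ] χ (x ∈? X) * χ (coloop? X x) ≤ ∑[ x ← xs ] χ (x ∈? X)
    go []       = z≤n
    go (x ∷ xs) = +-mono-≤ (χ≤ (x ∈? X) (coloop? X x)) (go xs)

  coloopless⇒#coloops≡0 : ∀ {X} → Coloopless X → #coloops X ≡ 0
  coloopless⇒#coloops≡0 {X} coloopless = ∑-zero (allFin n) λ x → trans
    (χ-*-cong (x ∈? X) λ x∈X → χ-no (coloop? X x) λ coloop →
       1+n≢n (trans coloop (sym (coloopless x∈X))))
    (*-zeroʳ (χ (x ∈? X)))

  #coloops≡0⇒coloopless : ∀ {X} → #coloops X ≡ 0 → Coloopless X
  #coloops≡0⇒coloopless {X} eq {x} x∈X = ¬coloop⇒rank≡ x∈X λ coloop →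
    1+n≰n (begin
      1                               ≡⟨ cong₂ _*_ (χ-yes (x ∈? X) x∈X) (χ-yes (coloop? X x) coloop) ⟨
      χ (x ∈? X) * χ (coloop? X x)    ≤⟨ ∑-term≤ (λ x → χ (x ∈? X) * χ (coloop? X x)) (∈-allFin x) ⟩
      #coloops X                      ≡⟨ eq ⟩
      0                               ∎)
    where open ≤-Reasoning

  independent-⊆ : ∀ {X Y} → Y ⊆ X → Independent X → Independent Y
  independent-⊆ {X} {Y} Y⊆X indep = ≤-antisym (rank-size Y) (+-cancelʳ-≤ ∣ X ─ Y ∣ _ _ (begin
    ∣ Y ∣ + ∣ X ─ Y ∣         ≤⟨ +-monoˡ-≤ ∣ X ─ Y ∣ (p⊆q⇒∣p∣≤∣q∣ λ y∈Y → x∈p∩q⁺ (Y⊆X y∈Y , y∈Y)) ⟩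
    ∣ X ∩ Y ∣ + ∣ X ─ Y ∣     ≡⟨ ∣q∩p∣+∣q─p∣≡∣q∣ X Y ⟩
    ∣ X ∣                     ≡⟨ indep ⟨
    rank X                    ≤⟨ rank-mono X⊆ ⟩
    rank (Y ∪ (X ─ Y))        ≤⟨ rank-subadd Y (X ─ Y) ⟩
    rank Y + rank (X ─ Y)     ≤⟨ +-monoʳ-≤ (rank Y) (rank-size (X ─ Y)) ⟩
    rank Y + ∣ X ─ Y ∣        ∎))
    where
    open ≤-Reasoning
    X⊆ : X ⊆ Y ∪ (X ─ Y)
    X⊆ {x} x∈X with x ∈? Y
    ... | yes x∈Y = x∈p∪q⁺ (inj₁ x∈Y)
    ... | no x∉Y  = x∈p∪q⁺ (inj₂ (x∈p∧x∉q⇒x∈p─q x∈X x∉Y))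

  -- Coloops of `X` remain coloops of its subsets, so when `X` is built up element by element every
  -- step raises the rank.
  all-coloops⇒independent : ∀ X → (∀ {x} → x ∈ X → Coloop X x) → Independent X
  all-coloops⇒independent = subset-induction (λ X → (∀ {x} → x ∈ X → Coloop X x) → Independent X)
    (λ _ → trans rank-⊥ (sym (∣⊥∣≡0 n)))
    λ X {x} x∉X ih coloops → begin
      rank (X ∪ ⁅ x ⁆)             ≡⟨ coloops (x∈p∪⁅x⁆ X) ⟨
      suc (rank (X ∪ ⁅ x ⁆ - x))   ≡⟨ cong (suc ∘ rank) (p∪⁅x⁆-x≡p x∉X) ⟩
      suc (rank X)                 ≡⟨ cong suc (ih λ y∈X → coloop-restrict (p⊆p∪q ⁅ x ⁆) y∈X
                                                       (coloops (p⊆p∪q ⁅ x ⁆ y∈X))) ⟩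
      suc ∣ X ∣                    ≡⟨ ∣p∪⁅x⁆∣≡1+∣p∣ x∉X ⟨
      ∣ X ∪ ⁅ x ⁆ ∣                ∎
    where open ≡-Reasoning

  circuit⇒coloopless : ∀ {C} → Circuit C → Coloopless C
  circuit⇒coloopless {C} (dependent , minimal) {x} x∈C = ¬coloop⇒rank≡ x∈C λ coloop →
    dependent (begin
      rank C                ≡⟨ coloop ⟨
      suc (rank (C - x))    ≡⟨ cong suc (minimal (C - x) (x∈p⇒p-x⊂p x∈C)) ⟩
      suc ∣ C - x ∣         ≡⟨ 1+∣p-x∣≡∣p∣ x∈C ⟩
      ∣ C ∣                 ∎)
    where open ≡-Reasoning

  circuit⇒nonempty : ∀ {C} → Circuit C → Nonempty C
  circuit⇒nonempty {C} (dependent , _) with nonempty? C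
  ... | yes nonempty = nonempty
  ... | no empty     = contradiction
    (subst Independent (sym (Empty-unique empty)) (trans rank-⊥ (sym (∣⊥∣≡0 n)))) dependent

  circuit⇒1+rank≡size : ∀ {C} → Circuit C → suc (rank C) ≡ ∣ C ∣
  circuit⇒1+rank≡size {C} circuit with circuit⇒nonempty circuit
  ... | x , x∈C = begin
    suc (rank C)          ≡⟨ cong suc (circuit⇒coloopless circuit x∈C) ⟨
    suc (rank (C - x))    ≡⟨ cong suc (proj₂ circuit (C - x) (x∈p⇒p-x⊂p x∈C)) ⟩
    suc ∣ C - x ∣         ≡⟨ 1+∣p-x∣≡∣p∣ x∈C ⟩
    ∣ C ∣                 ∎
    where open ≡-Reasoning

  -- Deleting any `x` from `C` keeps the rank and lowers the size to meet it, so `C - x` is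
  -- independent; every proper subset of `C` lies in some `C - x`.
  coloopless⇒circuit : ∀ {C} → Coloopless C → suc (rank C) ≡ ∣ C ∣ → Circuit C
  coloopless⇒circuit {C} coloopless 1+r≡size =
    (λ indep → 1+n≢n (trans 1+r≡size (sym indep))) ,
    λ Y (Y⊆C , x , x∈C , x∉Y) →
      independent-⊆ (λ y∈Y → x∈p∧x≢y⇒x∈p-y (Y⊆C y∈Y) λ { refl → x∉Y y∈Y })
        (trans (coloopless x∈C) (suc-injective (trans 1+r≡size (sym (1+∣p-x∣≡∣p∣ x∈C)))))

  -- The circuit is Y ∪ ⁅ x ⁆ for a minimal Y whose closure contains x.
  circuit-through : ∀ Y {x} → x ∉ Y → rank (Y ∪ ⁅ x ⁆) ≡ rank Y →
    ∃[ C ] Circuit C × x ∈ C × C ⊆ Y ∪ ⁅ x ⁆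
  circuit-through Y {x} = go ∣ Y ∣ Y refl
    where
    go : ∀ k Y → ∣ Y ∣ ≡ k → x ∉ Y → rank (Y ∪ ⁅ x ⁆) ≡ rank Y →
         ∃[ C ] Circuit C × x ∈ C × C ⊆ Y ∪ ⁅ x ⁆
    go k Y ∣Y∣≡k x∉Y eq
      with any? (λ y → (y ∈? Y) ×-dec (rank ((Y - y) ∪ ⁅ x ⁆) ≟ rank (Y - y)))
    go zero    Y ∣Y∣≡0 x∉Y eq | yes (y , y∈Y , _) =
      contradiction (trans (1+∣p-x∣≡∣p∣ y∈Y) ∣Y∣≡0) 1+n≢0
    go (suc k) Y ∣Y∣≡1+k x∉Y eq | yes (y , y∈Y , eq′) =
      let C , circuit , x∈C , C⊆ = go k (Y - y) (suc-injective (trans (1+∣p-x∣≡∣p∣ y∈Y) ∣Y∣≡1+k))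
                                     (x∉Y ∘ p-x⊆p Y) eq′
      in C , circuit , x∈C ,
         λ z∈C → ∪⁅⁆-least (p⊆p∪q ⁅ x ⁆ ∘ p-x⊆p Y) (x∈p∪⁅x⁆ Y) (C⊆ z∈C)
    ... | no minimal = Y ∪ ⁅ x ⁆ , coloopless⇒circuit coloopless size , x∈p∪⁅x⁆ Y , id
      where
      -- By minimality `x` is outside the closure of `Y - y`, so adding `x` makes up for the one
      -- unit of rank that removing `y` can cost.
      increase : ∀ {y} → y ∈ Y → rank Y ≤ rank ((Y - y) ∪ ⁅ x ⁆)
      increase {y} y∈Y = ≤-trans (rank-delete y∈Y)
        (≤∧≢⇒< (rank-mono (p⊆p∪q ⁅ x ⁆)) (λ eq′ → minimal (y , y∈Y , sym eq′)))

      exchange : ∀ {y} → y ∈ Y → (Y - y) ∪ ⁅ x ⁆ ⊆ (Y ∪ ⁅ x ⁆) - y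
      exchange {y} y∈Y = ∪⁅⁆-least
        (λ z∈ → x∈p∧x≢y⇒x∈p-y (p⊆p∪q ⁅ x ⁆ (p-x⊆p Y z∈)) (y∈p-x⇒y≢x Y z∈))
        (x∈p∧x≢y⇒x∈p-y (x∈p∪⁅x⁆ Y) λ { refl → x∉Y y∈Y })

      coloopless : Coloopless (Y ∪ ⁅ x ⁆)
      coloopless {y} y∈ with y∈p∪⁅x⁆⁻ Y y∈
      ... | inj₂ refl = trans (cong rank (p∪⁅x⁆-x≡p x∉Y)) (sym eq)
      ... | inj₁ y∈Y  = ≤-antisym (rank-delete≤ (Y ∪ ⁅ x ⁆) y) (begin
        rank (Y ∪ ⁅ x ⁆)         ≡⟨ eq ⟩
        rank Y                   ≤⟨ increase y∈Y ⟩
        rank ((Y - y) ∪ ⁅ x ⁆)   ≤⟨ rank-mono (exchange y∈Y) ⟩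
        rank ((Y ∪ ⁅ x ⁆) - y)   ∎)
        where open ≤-Reasoning

      independent : Independent Y
      independent = all-coloops⇒independent Y λ {y} y∈Y → ≤-antisym
        (begin
          suc (rank (Y - y))       ≤⟨ ≤∧≢⇒< (rank-mono (p⊆p∪q ⁅ x ⁆)) (λ eq′ → minimal (y , y∈Y , sym eq′)) ⟩
          rank ((Y - y) ∪ ⁅ x ⁆)   ≤⟨ rank-mono (∪⁅⁆-least (p⊆p∪q ⁅ x ⁆ ∘ p-x⊆p Y) (x∈p∪⁅x⁆ Y)) ⟩
          rank (Y ∪ ⁅ x ⁆)         ≡⟨ eq ⟩
          rank Y                   ∎)
        (rank-delete y∈Y)
        where open ≤-Reasoning

      size : suc (rank (Y ∪ ⁅ x ⁆)) ≡ ∣ Y ∪ ⁅ x ⁆ ∣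
      size = trans (cong suc (trans eq independent)) (sym (∣p∪⁅x⁆∣≡1+∣p∣ x∉Y))

  coloopless⇒cyclic : ∀ {X} → Coloopless X → Cyclic X
  coloopless⇒cyclic {X} coloopless =
    circuitsWithin X , All.map proj₁ within , ⊆-antisym to from
    where
    within : All (λ C → Circuit C × C ⊆ X) (circuitsWithin X)
    within = all-filter _ (subsets n)

    to : ⋃ (circuitsWithin X) ⊆ X
    to x∈ = let C , C∈ , x∈C = x∈⋃⁻ (circuitsWithin X) x∈ in proj₂ (All.lookup within C∈) x∈C

    from : X ⊆ ⋃ (circuitsWithin X)
    from {x} x∈X =
      let X-x∪x = p-x∪⁅x⁆≡p x∈X
          C , circuit , x∈C , C⊆ = circuit-through (X - x) (x∉p-x X)
                                     (trans (cong rank X-x∪x) (sym (coloopless x∈X)))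
      in x∈⋃⁺ (∈-filter⁺ (λ C → circuit? C ×-dec (C ⊆? X)) (∈-subsets C)
                (circuit , λ y∈C → subst (_ ∈_) X-x∪x (C⊆ y∈C))) x∈C

  -- An element of the union lies in one of the circuits, is no coloop there, and a non-coloop stays
  -- one in every larger set.
  cyclic⇒coloopless : ∀ {X} → Cyclic X → Coloopless X
  cyclic⇒coloopless (Cs , circuits , refl) x∈ =
    let C , C∈ , x∈C = x∈⋃⁻ Cs x∈
    in rank≡-extend (x∈⋃⁺ C∈) x∈C (circuit⇒coloopless (All.lookup circuits C∈) x∈C)

-- Chain sums weighted by size and rank

weight : (ℕ → ℕ → ℕ) → Matroid n r → Subset n → ℕ
weight φ M S = φ ∣ S ∣ (Matroid.rank M S)

chainSum : (ℕ → ℕ → ℕ) → Matroid n r → ℕ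
chainSum {n} φ M = up (weight φ M) n ⊥

SameChainSums : Matroid n r → Matroid n r → Set
SameChainSums M N = ∀ φ → chainSum φ M ≡ chainSum φ N

-- The dual weight of `S` is a function of the size `m` and rank `k` of `∁ S` in `M`, so
-- complementing the chains yields a chain sum of `M` with the transformed weight.
chainSum-dual : ∀ (M : Matroid n r) φ →
  chainSum φ (dual M) ≡ chainSum (λ m k → φ (n ∸ m) ((n ∸ m) + k ∸ r)) M
chainSum-dual {n} {r} M φ =
  trans (up-cong reflect n ⊥) (up-∁-⊥ (weight (λ m k → φ (n ∸ m) ((n ∸ m) + k ∸ r)) M))
  where
  reflect : ∀ S → weight φ (dual M) S ≡
                  φ (n ∸ ∣ ∁ S ∣) ((n ∸ ∣ ∁ S ∣) + Matroid.rank M (∁ S) ∸ r)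
  reflect S = cong (λ m → φ m (m + Matroid.rank M (∁ S) ∸ r))
    (sym (trans (cong (n ∸_) (∣∁p∣≡n∸∣p∣ S)) (m∸[m∸n]≡n (∣p∣≤n S))))

dual-sameChainSums : ∀ (M N : Matroid n r) → SameChainSums M N → SameChainSums (dual M) (dual N)
dual-sameChainSums {n} {r} M N same φ =
  trans (chainSum-dual M φ) (trans (same (λ m k → φ (n ∸ m) ((n ∸ m) + k ∸ r))) (sym (chainSum-dual N φ)))

-- Counting sets of given size and rank by their coloops.

dn-factorial : ∀ (ψ : Subset n → ℕ) k → (∀ S → ∣ S ∣ < k → ψ S ≡ 1) →
               ∀ {X} → ∣ X ∣ ≡ k → dn ψ k X ≡ k !
dn-factorial ψ zero one {X} ∣X∣≡0 = χ-yes (X ≟ˢ ⊥) (∣p∣≡0⇒p≡⊥ ∣X∣≡0)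
dn-factorial {n} ψ (suc k) one {X} ∣X∣≡1+k = begin
  ∑[ x ← allFin n ] χ (x ∈? X) * (ψ (X - x) * dn ψ k (X - x))
    ≡⟨ ∑-cong (allFin n) (λ x → χ-*-cong (x ∈? X) λ x∈X →
         let ∣X-x∣≡k = suc-injective (trans (1+∣p-x∣≡∣p∣ x∈X) ∣X∣≡1+k) in
         trans (cong₂ _*_ (one (X - x) (≤-reflexive (cong suc ∣X-x∣≡k)))
                          (dn-factorial ψ k (λ S S<k → one S (m<n⇒m<1+n S<k)) ∣X-x∣≡k))
               (*-identityˡ (k !))) ⟩
  ∑[ x ← allFin n ] χ (x ∈? X) * k !    ≡⟨ ∑-*ʳ (allFin n) (k !) (λ x → χ (x ∈? X)) ⟩
  (∑[ x ← allFin n ] χ (x ∈? X)) * k !  ≡⟨ cong (_* k !) (trans (∑-∈≡∣∣ X) ∣X∣≡1+k) ⟩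
  suc k * k !                           ∎
  where open ≡-Reasoning

∑-∉≡n∸∣∣ : ∀ (X : Subset n) → ∑[ x ← allFin n ] χ (¬? (x ∈? X)) ≡ n ∸ ∣ X ∣
∑-∉≡n∸∣∣ {n} X = begin
  ∑[ x ← allFin n ] χ (¬? (x ∈? X))
    ≡⟨ ∑-cong (allFin n) (λ x → χ-cong (¬? (x ∈? X)) (x ∈? ∁ X) x∉p⇒x∈∁p x∈∁p⇒x∉p) ⟩
  ∑[ x ← allFin n ] χ (x ∈? ∁ X)  ≡⟨ ∑-∈≡∣∣ (∁ X) ⟩
  ∣ ∁ X ∣                         ≡⟨ ∣∁p∣≡n∸∣p∣ X ⟩
  n ∸ ∣ X ∣                       ∎
  where open ≡-Reasoning

up-factorial : ∀ (ψ : Subset n → ℕ) l {X} → ∣ X ∣ + l ≡ n →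
               (∀ S → ∣ X ∣ < ∣ S ∣ → ψ S ≡ 1) → up ψ l X ≡ ψ X * l !
up-factorial ψ zero one-sized _ = sym (*-identityʳ _)
up-factorial {n} ψ (suc l) {X} ∣X∣+1+l≡n one = cong (ψ X *_) (begin
  ∑[ x ← allFin n ] χ (¬? (x ∈? X)) * up ψ l (X ∪ ⁅ x ⁆)
    ≡⟨ ∑-cong (allFin n) (λ x → χ-*-cong (¬? (x ∈? X)) λ x∉X →
         let size = ∣p∪⁅x⁆∣≡1+∣p∣ x∉X
             X<X∪x = ≤-reflexive (sym size)
         in trans (up-factorial ψ l
                    (trans (cong (_+ l) size) (trans (sym (+-suc ∣ X ∣ l)) ∣X∣+1+l≡n))
                    (λ S X∪x<S → one S (<-trans X<X∪x X∪x<S)))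
            (trans (cong (_* l !) (one (X ∪ ⁅ x ⁆) X<X∪x)) (*-identityˡ (l !)))) ⟩
  ∑[ x ← allFin n ] χ (¬? (x ∈? X)) * l !    ≡⟨ ∑-*ʳ (allFin n) (l !) (λ x → χ (¬? (x ∈? X))) ⟩
  (∑[ x ← allFin n ] χ (¬? (x ∈? X))) * l !  ≡⟨ cong (_* l !) (trans (∑-∉≡n∸∣∣ X)
                                                 (trans (cong (_∸ ∣ X ∣) (sym ∣X∣+1+l≡n)) (m+n∸m≡n ∣ X ∣ (suc l)))) ⟩
  suc l * l !                                ∎)
  where open ≡-Reasoning

-- Both sides count the `suc k`-subsets of a set of size `suc n` with one marked element. It
-- converts the choice of one coloop followed by `t` of the others into a choice of `suc t` coloops.
C-absorption : ∀ n k → suc k * (suc n choose suc k) ≡ suc n * (n choose k)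
C-absorption zero    zero    = refl
C-absorption zero    (suc k) = trans
  (cong (suc (suc k) *_) (k>n⇒nCk≡0 {1} {suc (suc k)} (s≤s (s≤s z≤n))))
  (trans (*-zeroʳ (suc (suc k))) (sym (cong (_+ 0) (k>n⇒nCk≡0 {0} {suc k} (s≤s z≤n)))))
C-absorption (suc n) zero    = trans (*-identityˡ _) (trans (nC1≡n (suc (suc n))) (sym (*-identityʳ (suc (suc n)))))
C-absorption (suc n) (suc k) = begin
  suc (suc k) * (suc (suc n) choose suc (suc k))
    ≡⟨ cong (suc (suc k) *_) (nCk+nC[k+1]≡[n+1]C[k+1] (suc n) (suc k)) ⟨
  suc (suc k) * (a + suc n choose suc (suc k))
    ≡⟨ *-distribˡ-+ (suc (suc k)) a _ ⟩
  (a + suc k * a) + suc (suc k) * (suc n choose suc (suc k))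
    ≡⟨ cong₂ (λ u v → (a + u) + v) (C-absorption n k) (C-absorption n (suc k)) ⟩
  (a + suc n * (n choose k)) + suc n * (n choose suc k)
    ≡⟨ +-assoc a _ _ ⟩
  a + (suc n * (n choose k) + suc n * (n choose suc k))
    ≡⟨ cong (a +_) (*-distribˡ-+ (suc n) (n choose k) (n choose suc k)) ⟨
  a + suc n * (n choose k + n choose suc k)
    ≡⟨ cong (λ u → a + suc n * u) (nCk+nC[k+1]≡[n+1]C[k+1] n k) ⟩
  suc (suc n) * (suc n choose suc k) ∎
  where
  open ≡-Reasoning
  a = suc n choose suc k

-- The chains that count are those in which the step from size m to size m + 1
-- raises the rank whenever a ≤ m < b, and whose set of size b has rank j.
window : ℕ → ℕ → ℕ → ℕ → ℕ → ℕ
window a b j m k = if does ((a ≤? m) ×-dec (m ≤? b)) then χ (k + (b ∸ m) ≟ j) else 1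

if-yes : ∀ {P A : Set} (p : Dec P) {x y : A} → P → (if does p then x else y) ≡ x
if-yes (yes _) _ = refl
if-yes (no ¬p) p = contradiction p ¬p

if-no : ∀ {P A : Set} (p : Dec P) {x y : A} → ¬ P → (if does p then x else y) ≡ y
if-no (yes p) ¬p = contradiction p ¬p
if-no (no _)  _  = refl

module _ {n r : ℕ} (M : Matroid n r) where

  -- The last t steps of such a chain remove, downwards from X, distinct coloops of X.
  dn-window : ∀ a b j t {X} → t + a ≤ b → ∣ X ∣ ≡ t + a → Matroid.rank M X + (b ∸ (t + a)) ≡ j →
    dn (weight (window a b j) M) (t + a) X ≡ t ! * a ! * (#coloops M X choose t)
  dn-window a b j zero {X} a≤b ∣X∣≡a eq = begin
    dn (weight (window a b j) M) a X
      ≡⟨ dn-factorial _ a (λ S S<a → if-no ((a ≤? ∣ S ∣) ×-dec (∣ S ∣ ≤? b)) λ (a≤S , _) → <⇒≱ S<a a≤S) ∣X∣≡a ⟩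
    a !                                ≡⟨ *-identityˡ (a !) ⟨
    1 * a !                            ≡⟨ *-identityʳ (1 * a !) ⟨
    1 * a ! * (#coloops M X choose 0)       ∎
    where open ≡-Reasoning
  dn-window a b j (suc t) {X} 1+t+a≤b ∣X∣≡1+t+a eq = begin
    ∑[ x ← allFin n ] χ (x ∈? X) * (ψ (X - x) * dn ψ (t + a) (X - x))
      ≡⟨ ∑-cong (allFin n) (λ x → trans (χ-*-cong (x ∈? X) (step x)) (sym (*-assoc (χ (x ∈? X)) _ K))) ⟩
    ∑[ x ← allFin n ] χ (x ∈? X) * χ (coloop? M X x) * K
      ≡⟨ ∑-*ʳ (allFin n) K _ ⟩
    c * K
      ≡⟨ absorb c ⟩
    suc t ! * a ! * (c choose suc t) ∎
    where
    open ≡-Reasoning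
    ψ = weight (window a b j) M
    c = #coloops M X
    -- Each `X - x` with `x` a coloop has `pred c` coloops, so `K` is the same for every such `x`
    -- and leaves the sum. If `c` is 0 there is no such `x`, and both sides vanish.
    K = t ! * a ! * (pred c choose t)

    level : b ∸ (t + a) ≡ suc (b ∸ suc (t + a))
    level = sym (trans (sym (+-∸-assoc 1 1+t+a≤b)) refl)

    step : ∀ x → x ∈ X → ψ (X - x) * dn ψ (t + a) (X - x) ≡ χ (coloop? M X x) * K
    step x x∈X = trans (cong (_* dn ψ (t + a) (X - x)) ψ≡)
      (χ-*-cong (coloop? M X x) λ coloop → trans
        (dn-window a b j t (<⇒≤ 1+t+a≤b) ∣X-x∣≡t+a (from coloop))
        (cong (λ d → t ! * a ! * (pred d choose t)) (sym (#coloops-delete M x∈X coloop))))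
      where
      ∣X-x∣≡t+a : ∣ X - x ∣ ≡ t + a
      ∣X-x∣≡t+a = suc-injective (trans (1+∣p-x∣≡∣p∣ x∈X) ∣X∣≡1+t+a)
      shift : Matroid.rank M (X - x) + (b ∸ (t + a)) ≡ suc (Matroid.rank M (X - x)) + (b ∸ suc (t + a))
      shift = trans (cong (Matroid.rank M (X - x) +_) level) (+-suc _ _)
      from : Coloop M X x → Matroid.rank M (X - x) + (b ∸ (t + a)) ≡ j
      from coloop = trans shift (trans (cong (_+ (b ∸ suc (t + a))) coloop) eq)
      to : Matroid.rank M (X - x) + (b ∸ (t + a)) ≡ j → Coloop M X x
      to eq′ = +-cancelʳ-≡ (b ∸ suc (t + a)) _ _ (trans (sym shift) (trans eq′ (sym eq)))
      -- Since `X` has the rank prescribed at its own size, `X - x` has the rank prescribed one size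
      -- lower exactly when deleting `x` lowers the rank.
      ψ≡ : ψ (X - x) ≡ χ (coloop? M X x)
      ψ≡ = begin
        window a b j ∣ X - x ∣ (Matroid.rank M (X - x))
          ≡⟨ cong (λ m → window a b j m (Matroid.rank M (X - x))) ∣X-x∣≡t+a ⟩
        window a b j (t + a) (Matroid.rank M (X - x))
          ≡⟨ if-yes ((a ≤? t + a) ×-dec (t + a ≤? b)) (m≤n+m a t , <⇒≤ 1+t+a≤b) ⟩
        χ (Matroid.rank M (X - x) + (b ∸ (t + a)) ≟ j)
          ≡⟨ χ-cong (Matroid.rank M (X - x) + (b ∸ (t + a)) ≟ j) (coloop? M X x) to from ⟩
        χ (coloop? M X x) ∎

    absorb : ∀ c → c * (t ! * a ! * (pred c choose t)) ≡ suc t ! * a ! * (c choose suc t)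
    absorb zero = sym (trans (cong (suc t ! * a ! *_) (k>n⇒nCk≡0 {0} {suc t} (s≤s z≤n))) (*-zeroʳ (suc t ! * a !)))
    absorb (suc c) = begin
      suc c * (t ! * a ! * (c choose t))              ≡⟨ *-swap (suc c) (t ! * a !) _ ⟩
      t ! * a ! * (suc c * (c choose t))              ≡⟨ cong (t ! * a ! *_) (C-absorption c t) ⟨
      t ! * a ! * (suc t * (suc c choose suc t))      ≡⟨ *-assoc (t ! * a !) (suc t) _ ⟨
      t ! * a ! * suc t * (suc c choose suc t)        ≡⟨ cong (_* (suc c choose suc t)) (*-comm (t ! * a !) (suc t)) ⟩
      suc t * (t ! * a !) * (suc c choose suc t)      ≡⟨ cong (_* (suc c choose suc t)) (*-assoc (suc t) (t !) (a !)) ⟨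
      suc t ! * a ! * (suc c choose suc t)            ∎

  coloopSum : ℕ → ℕ → (ℕ → ℕ) → ℕ
  coloopSum s j f = ∑[ X ← subsets n ] χ (∣ X ∣ ≟ s) * (χ (Matroid.rank M X ≟ j) * f (#coloops M X))

  -- The prefactor counts orders: `a !` for the unconstrained elements at the bottom, `t !` for the
  -- chosen coloops, and `l !` for the elements outside `X`, where all weights are 1.
  chainSum-window : ∀ t a l j → (t + a) + l ≡ n →
    chainSum (window a (t + a) j) M ≡ t ! * a ! * l ! * coloopSum (t + a) j (_choose t)
  chainSum-window t a l j s+l≡n = begin
    up ψ n ⊥
      ≡⟨ cong (λ m → up ψ m ⊥) (sym s+l≡n) ⟩
    up ψ (s + l) ⊥
      ≡⟨ up-split ψ s l ⟩
    ∑[ X ← subsets n ] dn ψ s X * up ψ l X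
      ≡⟨ ∑-cong (subsets n) term ⟩
    ∑[ X ← subsets n ] K * (χ (∣ X ∣ ≟ s) * (χ (Matroid.rank M X ≟ j) * (#coloops M X choose t)))
      ≡⟨ ∑-*ˡ (subsets n) K _ ⟩
    K * coloopSum s j (_choose t) ∎
    where
    open ≡-Reasoning
    s = t + a
    K = t ! * a ! * l !
    ψ = weight (window a s j) M

    at-size : ∀ X → ∣ X ∣ ≡ s → dn ψ s X * up ψ l X ≡ χ (Matroid.rank M X ≟ j) * (K * (#coloops M X choose t))
    at-size X ∣X∣≡s = begin
      dn ψ s X * up ψ l X
        ≡⟨ cong (dn ψ s X *_) (up-factorial ψ l (trans (cong (_+ l) ∣X∣≡s) s+l≡n) beyond) ⟩
      dn ψ s X * (ψ X * l !)
        ≡⟨ *-swap (dn ψ s X) (ψ X) (l !) ⟩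
      ψ X * (dn ψ s X * l !)
        ≡⟨ cong (_* (dn ψ s X * l !)) ψ≡ ⟩
      χ (Matroid.rank M X ≟ j) * (dn ψ s X * l !)
        ≡⟨ χ-*-cong (Matroid.rank M X ≟ j) (λ eq → trans
             (cong (_* l !) (dn-window a s j t ≤-refl ∣X∣≡s
               (trans (cong (Matroid.rank M X +_) (n∸n≡0 s)) (trans (+-identityʳ _) eq))))
             (trans (*-assoc (t ! * a !) _ (l !)) (trans (cong (t ! * a ! *_) (*-comm _ (l !)))
               (sym (*-assoc (t ! * a !) (l !) _))))) ⟩
      χ (Matroid.rank M X ≟ j) * (K * (#coloops M X choose t)) ∎
      where
      beyond : ∀ S → ∣ X ∣ < ∣ S ∣ → ψ S ≡ 1
      beyond S X<S = if-no ((a ≤? ∣ S ∣) ×-dec (∣ S ∣ ≤? s)) λ (_ , S≤s) →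
        <⇒≱ (subst (_< ∣ S ∣) ∣X∣≡s X<S) S≤s
      ψ≡ : ψ X ≡ χ (Matroid.rank M X ≟ j)
      ψ≡ = begin
        window a s j ∣ X ∣ (Matroid.rank M X)    ≡⟨ cong (λ m → window a s j m (Matroid.rank M X)) ∣X∣≡s ⟩
        window a s j s (Matroid.rank M X)        ≡⟨ if-yes ((a ≤? s) ×-dec (s ≤? s)) (m≤n+m a t , ≤-refl) ⟩
        χ (Matroid.rank M X + (s ∸ s) ≟ j)       ≡⟨ cong (λ d → χ (Matroid.rank M X + d ≟ j)) (n∸n≡0 s) ⟩
        χ (Matroid.rank M X + 0 ≟ j)             ≡⟨ cong (λ k → χ (k ≟ j)) (+-identityʳ (Matroid.rank M X)) ⟩
        χ (Matroid.rank M X ≟ j)                 ∎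

    term : ∀ X → dn ψ s X * up ψ l X ≡
                 K * (χ (∣ X ∣ ≟ s) * (χ (Matroid.rank M X ≟ j) * (#coloops M X choose t)))
    term X = begin
      dn ψ s X * up ψ l X
        ≡⟨ χ-restrict (∣ X ∣ ≟ s) (λ neq → cong (_* up ψ l X) (dn-size ψ s neq)) ⟩
      χ (∣ X ∣ ≟ s) * (dn ψ s X * up ψ l X)
        ≡⟨ χ-*-cong (∣ X ∣ ≟ s) (at-size X) ⟩
      χ (∣ X ∣ ≟ s) * (χ (Matroid.rank M X ≟ j) * (K * (#coloops M X choose t)))
        ≡⟨ cong (χ (∣ X ∣ ≟ s) *_) (*-swap (χ (Matroid.rank M X ≟ j)) K _) ⟩
      χ (∣ X ∣ ≟ s) * (K * (χ (Matroid.rank M X ≟ j) * (#coloops M X choose t)))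
        ≡⟨ *-swap (χ (∣ X ∣ ≟ s)) K _ ⟩
      K * (χ (∣ X ∣ ≟ s) * (χ (Matroid.rank M X ≟ j) * (#coloops M X choose t))) ∎

  coloopSum-+ : ∀ s j f g → coloopSum s j (λ c → f c + g c) ≡ coloopSum s j f + coloopSum s j g
  coloopSum-+ s j f g = trans
    (∑-cong (subsets n) λ X → trans
      (cong (χ (∣ X ∣ ≟ s) *_) (*-distribˡ-+ (χ (Matroid.rank M X ≟ j)) _ _))
      (*-distribˡ-+ (χ (∣ X ∣ ≟ s)) _ _))
    (∑-+ (subsets n) _ _)

  -- A set of size `s` has at most `s` coloops, so agreement up to `s` is enough; this bound is what
  -- makes the last tail vanish.
  coloopSum-cong : ∀ s j {f g : ℕ → ℕ} → (∀ c → c ≤ s → f c ≡ g c) →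
                   coloopSum s j f ≡ coloopSum s j g
  coloopSum-cong s j f≗g = ∑-cong (subsets n) λ X → χ-*-cong (∣ X ∣ ≟ s) λ { refl →
    cong (χ (Matroid.rank M X ≟ j) *_) (f≗g (#coloops M X) (#coloops≤size M X)) }

  coloopSum-zero : ∀ s j {f : ℕ → ℕ} → (∀ c → c ≤ s → f c ≡ 0) → coloopSum s j f ≡ 0
  coloopSum-zero s j f≗0 = trans (coloopSum-cong s j f≗0)
    (∑-zero (subsets n) λ X → trans (cong (χ (∣ X ∣ ≟ s) *_) (*-zeroʳ (χ (Matroid.rank M X ≟ j)))) (*-zeroʳ (χ (∣ X ∣ ≟ s))))

  coloopSum-oversize : ∀ {s} → n < s → ∀ j f → coloopSum s j f ≡ 0
  coloopSum-oversize {s} n<s j f = ∑-zero (subsets n) λ X →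
    χ*-zero (∣ X ∣ ≟ s) λ { refl → <⇒≱ n<s (∣p∣≤n X) }

-- Inclusion-exclusion without signs: Pascal's rule reads
-- (_choose suc t) = tail t + tail (suc t), and tail t vanishes for t large.
tail : ℕ → ℕ → ℕ
tail t zero    = 0
tail t (suc c) = c choose t

C≡tail+tail : ∀ t c → c choose suc t ≡ tail t c + tail (suc t) c
C≡tail+tail t zero    = k>n⇒nCk≡0 {0} {suc t} (s≤s z≤n)
C≡tail+tail t (suc c) = sym (nCk+nC[k+1]≡[n+1]C[k+1] c t)

module _ {n r : ℕ} (M N : Matroid n r) (same : SameChainSums M N) where

  coloopSum-C : ∀ {s} → s ≤ n → ∀ j {t} → t ≤ s → coloopSum M s j (_choose t) ≡ coloopSum N s j (_choose t)
  coloopSum-C {s} s≤n j {t} t≤s with m≤n⇒∃[o]m+o≡n t≤s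
  ... | a , refl with m≤n⇒∃[o]m+o≡n s≤n
  ... | l , s+l≡n = *-cancelˡ-≡ _ _ (t ! * a ! * l !) (begin
    t ! * a ! * l ! * coloopSum M (t + a) j (_choose t)  ≡⟨ chainSum-window M t a l j s+l≡n ⟨
    chainSum (window a (t + a) j) M                 ≡⟨ same (window a (t + a) j) ⟩
    chainSum (window a (t + a) j) N                 ≡⟨ chainSum-window N t a l j s+l≡n ⟩
    t ! * a ! * l ! * coloopSum N (t + a) j (_choose t)  ∎)
    where
    open ≡-Reasoning
    instance
      _ = m*n≢0 (t ! * a !) (l !) {{t !* a !≢0}} {{l !≢0}}

  -- Descending induction on `t`, with `d` the distance from `t` to `s`. At `t = s` the tail is zero
  -- for all possible coloop numbers; below that, Pascal's rule gives a binomial sum already known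
  -- to agree, from which the next tail is cancelled.
  coloopSum-tail : ∀ {s} → s ≤ n → ∀ j d t → t + d ≡ s →
                   coloopSum M s j (tail t) ≡ coloopSum N s j (tail t)
  coloopSum-tail {s} s≤n j zero t t+0≡s = trans (coloopSum-zero M s j vanish) (sym (coloopSum-zero N s j vanish))
    where
    vanish : ∀ c → c ≤ s → tail t c ≡ 0
    vanish zero    _   = refl
    vanish (suc c) c<s = k>n⇒nCk≡0 (≤-trans c<s (≤-reflexive (trans (sym t+0≡s) (+-identityʳ t))))
  coloopSum-tail {s} s≤n j (suc d) t t+1+d≡s = +-cancelʳ-≡ (coloopSum M s j (tail (suc t))) _ _ (begin
    coloopSum M s j (tail t) + coloopSum M s j (tail (suc t))
      ≡⟨ split M ⟩
    coloopSum M s j (_choose suc t)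
      ≡⟨ coloopSum-C s≤n j (≤-trans (m≤m+n (suc t) d) (≤-reflexive 1+t+d≡s)) ⟩
    coloopSum N s j (_choose suc t)
      ≡⟨ split N ⟨
    coloopSum N s j (tail t) + coloopSum N s j (tail (suc t))
      ≡⟨ cong (coloopSum N s j (tail t) +_) (coloopSum-tail s≤n j d (suc t) 1+t+d≡s) ⟨
    coloopSum N s j (tail t) + coloopSum M s j (tail (suc t)) ∎)
    where
    open ≡-Reasoning
    1+t+d≡s : suc t + d ≡ s
    1+t+d≡s = trans (sym (+-suc t d)) t+1+d≡s
    split : ∀ (L : Matroid n r) → coloopSum L s j (tail t) + coloopSum L s j (tail (suc t)) ≡
                                  coloopSum L s j (_choose suc t)
    split L = trans (sym (coloopSum-+ L s j (tail t) (tail (suc t))))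
                    (coloopSum-cong L s j λ c _ → sym (C≡tail+tail t c))

  -- The constant 1, which is `_choose 0`, is the indicator of no coloops plus `tail 0`, the
  -- indicator of at least one. Sizes beyond `n` contribute nothing.
  coloopSum-coloopless : ∀ s j → coloopSum M s j (λ c → χ (c ≟ 0)) ≡ coloopSum N s j (λ c → χ (c ≟ 0))
  coloopSum-coloopless s j with s ≤? n
  ... | no s≰n  = trans (coloopSum-oversize M (≰⇒> s≰n) j (λ c → χ (c ≟ 0))) (sym (coloopSum-oversize N (≰⇒> s≰n) j (λ c → χ (c ≟ 0))))
  ... | yes s≤n = +-cancelʳ-≡ (coloopSum M s j (tail 0)) _ _ (begin
    coloopSum M s j (λ c → χ (c ≟ 0)) + coloopSum M s j (tail 0)  ≡⟨ split M ⟩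
    coloopSum M s j (_choose 0)                                        ≡⟨ coloopSum-C s≤n j z≤n ⟩
    coloopSum N s j (_choose 0)                                        ≡⟨ split N ⟨
    coloopSum N s j (λ c → χ (c ≟ 0)) + coloopSum N s j (tail 0)
      ≡⟨ cong (coloopSum N s j (λ c → χ (c ≟ 0)) +_) (coloopSum-tail s≤n j s 0 refl) ⟨
    coloopSum N s j (λ c → χ (c ≟ 0)) + coloopSum M s j (tail 0)  ∎)
    where
    open ≡-Reasoning
    split : ∀ (L : Matroid n r) → coloopSum L s j (λ c → χ (c ≟ 0)) + coloopSum L s j (tail 0) ≡
                                  coloopSum L s j (_choose 0)
    split L = trans (sym (coloopSum-+ L s j (λ c → χ (c ≟ 0)) (tail 0)))
                    (coloopSum-cong L s j {λ c → χ (c ≟ 0) + tail 0 c} {_choose 0} λ { zero _ → refl ; (suc c) _ → refl })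

-- Numbers of cyclic sets, circuits and cocircuits.

#cyclicSets≡ : ∀ (M : Matroid n r) s j → #cyclicSets M s j ≡ coloopSum M s j (λ c → χ (c ≟ 0))
#cyclicSets≡ {n} M s j = trans (length-filter _ (subsets n)) (∑-cong (subsets n) λ X → begin
  χ (Matroid.cyclic? M X ×-dec ∣ X ∣ ≟ s ×-dec Matroid.rank M X ≟ j)
    ≡⟨ χ-cong (Matroid.cyclic? M X ×-dec ∣ X ∣ ≟ s ×-dec Matroid.rank M X ≟ j)
              (∣ X ∣ ≟ s ×-dec Matroid.rank M X ≟ j ×-dec #coloops M X ≟ 0)
         (λ (cyc , size , rk) → size , rk , coloopless⇒#coloops≡0 M (cyclic⇒coloopless M cyc))
         (λ (size , rk , none) → coloopless⇒cyclic M (#coloops≡0⇒coloopless M none) , size , rk) ⟩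
  χ (∣ X ∣ ≟ s ×-dec Matroid.rank M X ≟ j ×-dec #coloops M X ≟ 0)
    ≡⟨ χ-× (∣ X ∣ ≟ s) (Matroid.rank M X ≟ j ×-dec #coloops M X ≟ 0) ⟩
  χ (∣ X ∣ ≟ s) * χ (Matroid.rank M X ≟ j ×-dec #coloops M X ≟ 0)
    ≡⟨ cong (χ (∣ X ∣ ≟ s) *_) (χ-× (Matroid.rank M X ≟ j) (#coloops M X ≟ 0)) ⟩
  χ (∣ X ∣ ≟ s) * (χ (Matroid.rank M X ≟ j) * χ (#coloops M X ≟ 0)) ∎)
  where open ≡-Reasoning

#circuits-0≡ : ∀ (M : Matroid n r) → #circuits M 0 ≡ 0
#circuits-0≡ {n} M = trans (length-filter _ (subsets n)) (∑-zero (subsets n) λ X →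
  χ-no (Matroid.circuit? M X ×-dec ∣ X ∣ ≟ 0) λ (circuit , ∣X∣≡0) →
    1+n≢0 (trans (circuit⇒1+rank≡size M circuit) ∣X∣≡0))

#circuits-suc≡ : ∀ (M : Matroid n r) s → #circuits M (suc s) ≡ #cyclicSets M (suc s) s
#circuits-suc≡ {n} M s = trans (length-filter _ (subsets n)) (trans
  (∑-cong (subsets n) λ X →
    χ-cong (Matroid.circuit? M X ×-dec ∣ X ∣ ≟ suc s)
           (Matroid.cyclic? M X ×-dec ∣ X ∣ ≟ suc s ×-dec Matroid.rank M X ≟ s)
      (λ (circuit , size) → coloopless⇒cyclic M (circuit⇒coloopless M circuit) , size ,
         suc-injective (trans (circuit⇒1+rank≡size M circuit) size))
      (λ (cyc , size , rk) → coloopless⇒circuit M (cyclic⇒coloopless M cyc)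
         (trans (cong suc rk) (sym size)) , size))
  (sym (length-filter _ (subsets n))))

module _ {n r : ℕ} (M N : Matroid n r) (same : SameChainSums M N) where

  sameChainSums⇒#cyclicSets : ∀ s j → #cyclicSets M s j ≡ #cyclicSets N s j
  sameChainSums⇒#cyclicSets s j = trans (#cyclicSets≡ M s j)
    (trans (coloopSum-coloopless M N same s j) (sym (#cyclicSets≡ N s j)))

  sameChainSums⇒#circuits : ∀ s → #circuits M s ≡ #circuits N s
  sameChainSums⇒#circuits zero    = trans (#circuits-0≡ M) (sym (#circuits-0≡ N))
  sameChainSums⇒#circuits (suc s) = trans (#circuits-suc≡ M s)
    (trans (sameChainSums⇒#cyclicSets (suc s) s) (sym (#circuits-suc≡ N s)))

sameChainSums⇒#cocircuits : ∀ (M N : Matroid n r) → SameChainSums M N →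
                            ∀ s → #cocircuits M s ≡ #cocircuits N s
sameChainSums⇒#cocircuits M N same =
  sameChainSums⇒#circuits (dual M) (dual N) (dual-sameChainSums M N same)

#circuits-positive : ∀ (M : Matroid n r) {C} → Matroid.Circuit M C → 0 < #circuits M ∣ C ∣
#circuits-positive {n} M {C} circuit = begin
  1                                                    ≡⟨ χ-yes (counted? C) (circuit , refl) ⟨
  χ (counted? C)                                       ≤⟨ ∑-term≤ (χ ∘ counted?) (∈-subsets C) ⟩
  ∑[ X ← subsets n ] χ (counted? X)                    ≡⟨ length-filter counted? (subsets n) ⟨
  #circuits M ∣ C ∣                                    ∎
  where
  open ≤-Reasoning
  counted? = λ X → Matroid.circuit? M X ×-dec ∣ X ∣ ≟ ∣ C ∣

#circuits-positive⁻ : ∀ (M : Matroid n r) s → 0 < #circuits M s → ∃[ C ] Matroid.Circuit M C × ∣ C ∣ ≡ s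
#circuits-positive⁻ {n} M s 0<# with anySubset? (λ X → Matroid.circuit? M X ×-dec ∣ X ∣ ≟ s)
... | yes found = found
... | no none   = contradiction 0<# (≤⇒≯ (≤-reflexive (trans (length-filter _ (subsets n))
  (∑-zero (subsets n) λ X → χ-no (Matroid.circuit? M X ×-dec ∣ X ∣ ≟ s) λ p → none (X , p)))))

-- The rank of a circuit is one less than its size, so whether it spans is visible in its size and
-- the circuit counts decide.
sameChainSums⇒spanningCircuit : ∀ (M N : Matroid n r) → SameChainSums M N →
                                HasSpanningCircuit M → HasSpanningCircuit N
sameChainSums⇒spanningCircuit {r = r} M N same (C , circuit , rk) =
  let C′ , circuit′ , size = #circuits-positive⁻ N ∣ C ∣
        (subst (0 <_) (sameChainSums⇒#circuits M N same ∣ C ∣) (#circuits-positive M circuit))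
  in C′ , circuit′ , suc-injective (begin
       suc (Matroid.rank N C′)   ≡⟨ circuit⇒1+rank≡size N circuit′ ⟩
       ∣ C′ ∣            ≡⟨ size ⟩
       ∣ C ∣             ≡⟨ circuit⇒1+rank≡size M circuit ⟨
       suc (Matroid.rank M C)    ≡⟨ cong suc rk ⟩
       suc r             ∎)
  where open ≡-Reasoning

-- Lists with the same multiplicities

∑-mid : ∀ {A : Set} us {x : A} {vs} f → ∑ (us ++ x ∷ vs) f ≡ f x + ∑ (us ++ vs) f
∑-mid us {x} {vs} f = begin
  ∑ (us ++ x ∷ vs) f        ≡⟨ ∑-++ us (x ∷ vs) f ⟩
  ∑ us f + (f x + ∑ vs f)   ≡⟨ +-assoc (∑ us f) (f x) _ ⟨
  ∑ us f + f x + ∑ vs f     ≡⟨ cong (_+ ∑ vs f) (+-comm (∑ us f) (f x)) ⟩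
  f x + ∑ us f + ∑ vs f     ≡⟨ +-assoc (f x) (∑ us f) _ ⟩
  f x + (∑ us f + ∑ vs f)   ≡⟨ cong (f x +_) (∑-++ us vs f) ⟨
  f x + ∑ (us ++ vs) f      ∎
  where open ≡-Reasoning

module _ {A : Set} (_≟ᴬ_ : DecidableEquality A) where

  multiplicity : A → List A → ℕ
  multiplicity z xs = ∑[ x ← xs ] χ (x ≟ᴬ z)

  multiplicity-positive : ∀ {z xs} → z ListMem.∈ xs → 0 < multiplicity z xs
  multiplicity-positive {z} {xs} z∈ = ≤-trans (≤-reflexive (sym (χ-yes (z ≟ᴬ z) refl)))
    (∑-term≤ (λ x → χ (x ≟ᴬ z)) z∈)

  multiplicity-positive⁻ : ∀ {z} xs → 0 < multiplicity z xs → z ListMem.∈ xs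
  multiplicity-positive⁻ {z} (x ∷ xs) 0<m with x ≟ᴬ z
  ... | yes refl = Any.here refl
  ... | no _     = Any.there (multiplicity-positive⁻ xs 0<m)

  -- Agreement is asked only of values that occur in a list: catenary data are indexed by
  -- compositions and 𝒢-coefficients by symbols, and an arbitrary vector is neither. The induction
  -- removes the head of `xs` together with one occurrence of it in `ys`.
  ∑-multiplicity : ∀ xs ys →
    (∀ z → z ListMem.∈ xs ⊎ z ListMem.∈ ys → multiplicity z xs ≡ multiplicity z ys) →
    ∀ f → ∑ xs f ≡ ∑ ys f
  ∑-multiplicity []       []       same f = refl
  ∑-multiplicity []       (y ∷ ys) same f = contradiction
    (subst (0 <_) (sym (same y (inj₂ (Any.here refl)))) (multiplicity-positive {xs = y ∷ ys} (Any.here refl))) λ ()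
  ∑-multiplicity (x ∷ xs) ys       same f
    with ∈-∃++ (multiplicity-positive⁻ ys (subst (0 <_) (same x (inj₁ (Any.here refl)))
                                                 (multiplicity-positive {xs = x ∷ xs} (Any.here refl))))
  ... | us , vs , refl = trans
    (cong (f x +_) (∑-multiplicity xs (us ++ vs) (λ z z∈ → +-cancelˡ-≡ (χ (x ≟ᴬ z)) _ _
      (trans (same z (Sum.map Any.there insert z∈)) (∑-mid us (λ y → χ (y ≟ᴬ z))))) f))
    (sym (∑-mid us f))
    where
    insert : ∀ {z} → z ListMem.∈ us ++ vs → z ListMem.∈ us ++ x ∷ vs
    insert z∈ = [ ∈-++⁺ˡ , ∈-++⁺ʳ us ∘ Any.there ]′ (∈-++⁻ us z∈)

-- Closure

module _ {n r : ℕ} (M : Matroid n r) where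

  open Matroid M using (rank; rank-size; rank-mono; rank-submod; rank-subadd; rank-⊥; rank-⊤; Flat; flat?;
                        Flag; flag?)

  rank-∪⁅⁆-diminishing : ∀ {S X} → S ⊆ X → ∀ x →
    rank (X ∪ ⁅ x ⁆) + rank S ≤ rank X + rank (S ∪ ⁅ x ⁆)
  rank-∪⁅⁆-diminishing {S} {X} S⊆X x = begin
    rank (X ∪ ⁅ x ⁆) + rank S
      ≤⟨ +-mono-≤ (rank-mono (∪⁅⁆-least (p⊆p∪q (S ∪ ⁅ x ⁆)) (q⊆p∪q X (S ∪ ⁅ x ⁆) (x∈p∪⁅x⁆ S))))
                  (rank-mono λ y∈S → x∈p∩q⁺ (S⊆X y∈S , p⊆p∪q ⁅ x ⁆ y∈S)) ⟩
    rank (X ∪ (S ∪ ⁅ x ⁆)) + rank (X ∩ (S ∪ ⁅ x ⁆))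
      ≤⟨ rank-submod X (S ∪ ⁅ x ⁆) ⟩
    rank X + rank (S ∪ ⁅ x ⁆) ∎
    where open ≤-Reasoning

  rank-∪⁅⁆-absorb : ∀ {S X} → S ⊆ X → ∀ x → rank (S ∪ ⁅ x ⁆) ≡ rank S → rank (X ∪ ⁅ x ⁆) ≡ rank X
  rank-∪⁅⁆-absorb {S} {X} S⊆X x eq = ≤-antisym
    (+-cancelʳ-≤ (rank S) _ _ (≤-trans (rank-∪⁅⁆-diminishing S⊆X x) (≤-reflexive (cong (rank X +_) eq))))
    (rank-mono (p⊆p∪q ⁅ x ⁆))

  rank-∪-absorb : ∀ {S} X → (∀ {x} → x ∈ X → rank (S ∪ ⁅ x ⁆) ≡ rank S) → rank (S ∪ X) ≡ rank S
  rank-∪-absorb {S} = subset-induction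
    (λ X → (∀ {x} → x ∈ X → rank (S ∪ ⁅ x ⁆) ≡ rank S) → rank (S ∪ X) ≡ rank S)
    (λ _ → cong rank (∪-identityʳ S))
    λ X {x} x∉X ih absorbed → begin
      rank (S ∪ (X ∪ ⁅ x ⁆))    ≡⟨ cong rank (∪-assoc S X ⁅ x ⁆) ⟨
      rank ((S ∪ X) ∪ ⁅ x ⁆)    ≡⟨ rank-∪⁅⁆-absorb (p⊆p∪q X) x (absorbed (x∈p∪⁅x⁆ X)) ⟩
      rank (S ∪ X)              ≡⟨ ih (absorbed ∘ p⊆p∪q ⁅ x ⁆) ⟩
      rank S                    ∎
    where open ≡-Reasoning

  closure : Subset n → Subset n
  closure S = comprehension λ x → rank (S ∪ ⁅ x ⁆) ≟ rank S

  ∈-closure⁻ : ∀ {S x} → x ∈ closure S → rank (S ∪ ⁅ x ⁆) ≡ rank S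
  ∈-closure⁻ {S} = ∈-comprehension⁻ λ x → rank (S ∪ ⁅ x ⁆) ≟ rank S

  ∈-closure⁺ : ∀ {S x} → rank (S ∪ ⁅ x ⁆) ≡ rank S → x ∈ closure S
  ∈-closure⁺ {S} = ∈-comprehension⁺ λ x → rank (S ∪ ⁅ x ⁆) ≟ rank S

  ⊆-closure : ∀ {S} → S ⊆ closure S
  ⊆-closure {S} x∈S = ∈-closure⁺ (cong rank (x∈p⇒p∪⁅x⁆≡p x∈S))

  rank-closure : ∀ S → rank (closure S) ≡ rank S
  rank-closure S = ≤-antisym
    (≤-trans (rank-mono (q⊆p∪q S (closure S))) (≤-reflexive (rank-∪-absorb (closure S) ∈-closure⁻)))
    (rank-mono ⊆-closure)

  closure-flat : ∀ S → Flat (closure S)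
  closure-flat S x x∉ = begin-strict
    rank (closure S)            ≡⟨ rank-closure S ⟩
    rank S                      <⟨ ≤∧≢⇒< (rank-mono (p⊆p∪q ⁅ x ⁆)) (x∉ ∘ ∈-closure⁺ ∘ sym) ⟩
    rank (S ∪ ⁅ x ⁆)            ≤⟨ rank-mono (∪⁅⁆-least (p⊆p∪q ⁅ x ⁆ ∘ ⊆-closure) (x∈p∪⁅x⁆ (closure S))) ⟩
    rank (closure S ∪ ⁅ x ⁆)    ∎
    where open ≤-Reasoning

  closure-unique : ∀ {S F} → Flat F → S ⊆ F → rank F ≡ rank S → F ≡ closure S
  closure-unique {S} {F} flat S⊆F eq = ⊆-antisym
    (λ {x} x∈F → ∈-closure⁺ (≤-antisym
      (≤-trans (rank-mono (∪⁅⁆-least S⊆F x∈F)) (≤-reflexive eq))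
      (rank-mono (p⊆p∪q ⁅ x ⁆))))
    ⊇
    where
    ⊇ : closure S ⊆ F
    ⊇ {x} x∈ with x ∈? F
    ... | yes x∈F = x∈F
    ... | no x∉F  = contradiction (rank-∪⁅⁆-absorb S⊆F x (∈-closure⁻ x∈)) (>⇒≢ (flat x x∉F))

  rank≤r : ∀ X → rank X ≤ r
  rank≤r X = ≤-trans (rank-mono (⊆-max X)) (≤-reflexive rank-⊤)

  flat-spanning : ∀ {F} → Flat F → rank F ≡ r → F ≡ ⊤
  flat-spanning {F} flat rk = ⊆-antisym (⊆-max F) all
    where
    all : ⊤ ⊆ F
    all {x} _ with x ∈? F
    ... | yes x∈F = x∈F
    ... | no x∉F  = contradiction (≤-trans (flat x x∉F) (rank≤r (F ∪ ⁅ x ⁆))) (≤⇒≯ (≤-reflexive (sym rk)))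

-- Flags

  Cover : Subset n → Subset n → Set
  Cover F Y = Flat Y × rank Y ≡ suc (rank F) × F ⊂ Y

  cover? : ∀ F Y → Dec (Cover F Y)
  cover? F Y = flat? Y ×-dec rank Y ≟ suc (rank F) ×-dec F ⊂? Y

  FlagFrom : ∀ {d} → Subset n → Vec (Subset n) d → Set
  FlagFrom F []       = Unit
  FlagFrom F (Y ∷ Ys) = Cover F Y × FlagFrom Y Ys

  flagFrom? : ∀ {d} F (Ys : Vec (Subset n) d) → Dec (FlagFrom F Ys)
  flagFrom? F []       = yes tt
  flagFrom? F (Y ∷ Ys) = cover? F Y ×-dec flagFrom? Y Ys

  -- With `cover-unique` this says that the flats covering `F` partition the elements outside `F`.
  cover-through : ∀ {F x} → Flat F → x ∉ F → Cover F (closure (F ∪ ⁅ x ⁆)) × x ∈ closure (F ∪ ⁅ x ⁆)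
  cover-through {F} {x} flat x∉F =
    ( closure-flat (F ∪ ⁅ x ⁆)
    , trans (rank-closure (F ∪ ⁅ x ⁆)) (≤-antisym (rank-∪⁅⁆ M F x) (flat x x∉F))
    , ⊆-closure ∘ p⊆p∪q ⁅ x ⁆ , x , ⊆-closure (x∈p∪⁅x⁆ F) , x∉F )
    , ⊆-closure (x∈p∪⁅x⁆ F)

  cover-unique : ∀ {F x Y} → Flat F → x ∉ F → Cover F Y → x ∈ Y → Y ≡ closure (F ∪ ⁅ x ⁆)
  cover-unique {F} {x} flat x∉F (flatY , rk , F⊆Y , _) x∈Y =
    closure-unique flatY (∪⁅⁆-least F⊆Y x∈Y)
      (trans rk (≤-antisym (flat x x∉F) (rank-∪⁅⁆ M F x)))

increments : ∀ {n d} → Subset n → Vec (Subset n) d → Vec ℕ d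
increments F []       = []
increments F (Y ∷ Ys) = ∣ Y ─ F ∣ ∷ increments Y Ys

flagComposition≡ : ∀ {n d} (X : Subset n) (Xs : Vec (Subset n) d) →
                   flagComposition (X ∷ Xs) ≡ ∣ X ∣ ∷ increments X Xs
flagComposition≡ X []       = refl
flagComposition≡ X (Y ∷ Ys) = cong (λ as → ∣ X ∣ ∷ ∣ Y ─ X ∣ ∷ as) (cong Vec.tail (flagComposition≡ Y Ys))

∣p∣+∣q─p∣≡∣q∣ : ∀ {n} {p q : Subset n} → p ⊆ q → ∣ p ∣ + ∣ q ─ p ∣ ≡ ∣ q ∣
∣p∣+∣q─p∣≡∣q∣ {p = p} {q} p⊆q = trans (cong (λ s → ∣ s ∣ + ∣ q ─ p ∣) p≡q∩p) (∣q∩p∣+∣q─p∣≡∣q∣ q p)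
  where
  p≡q∩p : p ≡ q ∩ p
  p≡q∩p = ⊆-antisym (λ x∈p → x∈p∩q⁺ (p⊆q x∈p , x∈p)) (p∩q⊆q q p)

sum-flagComposition : ∀ {n d} (X : Vec (Subset n) (suc d)) →
  (∀ j → lookup X (inject₁ j) ⊆ lookup X (suc j)) → Vec.sum (flagComposition X) ≡ ∣ lookup X (fromℕ d) ∣
sum-flagComposition (X ∷ [])     chain = +-identityʳ ∣ X ∣
sum-flagComposition (X ∷ Y ∷ Ys) chain = trans
  (sym (+-assoc ∣ X ∣ ∣ Y ─ X ∣ _))
  (trans (cong (_+ Vec.sum (Vec.tail (flagComposition (Y ∷ Ys)))) (∣p∣+∣q─p∣≡∣q∣ (chain zero)))
         (sum-flagComposition (Y ∷ Ys) (λ j → chain (suc j))))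

module _ {n r : ℕ} (M : Matroid n r) where

  open Matroid M using (rank; rank-⊤; rank-⊥; rank-mono; Flat; flat?; Flag; flag?)

  -- `ν` can be evaluated only at a vector carrying its proofs of positivity and total; a flag
  -- supplies both.
  composition : ∀ {X} → Flag X → Composition n r
  composition {X} (_ , _ , chain , top) = record
    { parts    = flagComposition X
    ; positive = λ j → let X⊆Y , x , x∈Y , x∉X = chain j in
        ≤-trans (≤-trans (≤-reflexive (sym (∣⁅x⁆∣≡1 x)))
          (p⊆q⇒∣p∣≤∣q∣ λ y∈ → subst (_∈ _) (sym (x∈⁅y⁆⇒x≡y x y∈)) (x∈p∧x∉q⇒x∈p─q x∈Y x∉X)))
          (≤-reflexive (sym (part j)))
    ; total    = trans (sum-flagComposition X λ j → proj₁ (chain j)) (trans (cong ∣_∣ top) (∣⊤∣≡n n))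
    }
    where
    part : ∀ j → lookup (flagComposition X) (suc j) ≡ ∣ lookup X (suc j) ─ lookup X (inject₁ j) ∣
    part = lookup∘tabulate (λ j → ∣ lookup X (suc j) ─ lookup X (inject₁ j) ∣)

  flag⇒flagFrom : ∀ {d} (X : Vec (Subset n) (suc d)) → (∀ j → Flat (lookup X j)) →
    (∀ j → rank (lookup X (suc j)) ≡ suc (rank (lookup X (inject₁ j)))) →
    (∀ j → lookup X (inject₁ j) ⊂ lookup X (suc j)) → FlagFrom M (Vec.head X) (Vec.tail X)
  flag⇒flagFrom (X ∷ [])     flats ranks chain = tt
  flag⇒flagFrom (X ∷ Y ∷ Ys) flats ranks chain =
    (flats (suc zero) , ranks zero , chain zero) ,
    flag⇒flagFrom (Y ∷ Ys) (λ j → flats (suc j)) (λ j → ranks (suc j)) (λ j → chain (suc j))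

  flagFrom⇒flats : ∀ {d} F (Ys : Vec (Subset n) d) → Flat F → FlagFrom M F Ys → ∀ j → Flat (lookup (F ∷ Ys) j)
  flagFrom⇒flats F Ys       flat flag               zero    = flat
  flagFrom⇒flats F (Y ∷ Ys) flat ((flatY , _) , flag) (suc j) = flagFrom⇒flats Y Ys flatY flag j

  flagFrom⇒ranks : ∀ {d} F (Ys : Vec (Subset n) d) → FlagFrom M F Ys →
                   ∀ j → rank (lookup (F ∷ Ys) j) ≡ toℕ j + rank F
  flagFrom⇒ranks F Ys       flag                 zero    = refl
  flagFrom⇒ranks F (Y ∷ Ys) ((_ , rk , _) , flag) (suc j) =
    trans (flagFrom⇒ranks Y Ys flag j) (trans (cong (toℕ j +_) rk) (+-suc (toℕ j) (rank F)))

  flagFrom⇒chain : ∀ {d} F (Ys : Vec (Subset n) d) → FlagFrom M F Ys →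
                   ∀ j → lookup (F ∷ Ys) (inject₁ j) ⊂ lookup (F ∷ Ys) (suc j)
  flagFrom⇒chain F (Y ∷ Ys) ((_ , _ , F⊂Y) , flag) zero    = F⊂Y
  flagFrom⇒chain F (Y ∷ Ys) (_ , flag)             (suc j) = flagFrom⇒chain Y Ys flag j

  flag-∷⁻ : ∀ {X} {Xs : Vec (Subset n) r} → Flag (X ∷ Xs) → (Flat X × rank X ≡ 0) × FlagFrom M X Xs
  flag-∷⁻ {X} {Xs} (flats , ranks , chain , _) = (flats zero , ranks zero) ,
    flag⇒flagFrom (X ∷ Xs) flats
      (λ j → trans (ranks (suc j)) (cong suc (sym (trans (ranks (inject₁ j)) (toℕ-inject₁ j))))) chain

  -- The top is `⊤` because `r` covers lead from rank 0 to rank `r`, and a flat of rank `r` is the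
  -- whole ground set.
  flag-∷⁺ : ∀ {X} {Xs : Vec (Subset n) r} → Flat X × rank X ≡ 0 → FlagFrom M X Xs → Flag (X ∷ Xs)
  flag-∷⁺ {X} {Xs} (flat , rk) flag = flats , ranks , flagFrom⇒chain X Xs flag ,
    flat-spanning M (flats (fromℕ r)) (trans (ranks (fromℕ r)) (toℕ-fromℕ r))
    where
    flats = flagFrom⇒flats X Xs flat flag
    ranks : ∀ j → rank (lookup (X ∷ Xs) j) ≡ toℕ j
    ranks j = trans (flagFrom⇒ranks X Xs flag j) (trans (cong (toℕ j +_) rk) (+-identityʳ (toℕ j)))

-- The weighted number of ways to add e more elements, one at a time, to a set of
-- size m whose closure has size f and rank k, such that the closures run through
-- a given flag with increments as.
flagWeight : (ℕ → ℕ → ℕ) → ℕ → ℕ → ℕ → ℕ → ∀ {d} → Vec ℕ d → ℕ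
flagWeight φ zero    m f k as       = φ m k
flagWeight φ (suc e) m f k []       = φ m k * ((f ∸ m) * flagWeight φ e (suc m) f k [])
flagWeight φ (suc e) m f k (a ∷ as) =
  φ m k * ((f ∸ m) * flagWeight φ e (suc m) f k (a ∷ as) + a * flagWeight φ e (suc m) (f + a) (suc k) as)

-- The starting state is the empty set: size 0 and rank 0, with the bottom flat of size `a` as its
-- closure.
compositionWeight : (ℕ → ℕ → ℕ) → ℕ → ∀ {r} → Vec ℕ (suc r) → ℕ
compositionWeight φ n (a ∷ as) = flagWeight φ n 0 a 0 as

∑-∉∈≡∣─∣ : ∀ {n} (S X : Subset n) → ∑[ x ← allFin n ] χ (¬? (x ∈? S)) * χ (x ∈? X) ≡ ∣ X ─ S ∣
∑-∉∈≡∣─∣ {n} S X = trans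
  (∑-cong (allFin n) λ x → trans (sym (χ-× (¬? (x ∈? S)) (x ∈? X)))
    (χ-cong (¬? (x ∈? S) ×-dec (x ∈? X)) (x ∈? X ─ S)
      (λ (x∉S , x∈X) → x∈p∧x∉q⇒x∈p─q x∈X x∉S)
      (λ x∈ → x∈p─q⇒x∉q X S x∈ , p─q⊆p X S x∈)))
  (∑-∈≡∣∣ (X ─ S))

module _ {n r : ℕ} (M : Matroid n r) (φ : ℕ → ℕ → ℕ) where

  open Matroid M using (rank; rank-⊤; rank-⊥; rank-mono; Flat; flat?; Flag; flag?)

  flagSum : ℕ → ℕ → ∀ d → Subset n → ℕ
  flagSum e m d F = ∑[ Ys ← vectors (subsets n) d ]
    χ (flagFrom? M F Ys) * flagWeight φ e m ∣ F ∣ (rank F) (increments F Ys)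

  flagSum-suc-zero : ∀ e m F → flagSum (suc e) m 0 F ≡ φ m (rank F) * ((∣ F ∣ ∸ m) * flagSum e (suc m) 0 F)
  flagSum-suc-zero e m F = trans (+-identityʳ _) (trans (*-identityˡ _)
    (cong (λ w → φ m (rank F) * ((∣ F ∣ ∸ m) * w)) (sym (trans (+-identityʳ _) (*-identityˡ _)))))

  flagSum-suc-suc : ∀ e m d F → flagSum (suc e) m (suc d) F ≡
    φ m (rank F) * ((∣ F ∣ ∸ m) * flagSum e (suc m) (suc d) F
                    + (∑[ Y ← subsets n ] χ (cover? M F Y) * (∣ Y ─ F ∣ * flagSum e (suc m) d Y)))
  flagSum-suc-suc e m d F = begin
    flagSum (suc e) m (suc d) F
      ≡⟨ ∑-vectors (subsets n) d _ ⟩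
    ∑[ Y ← subsets n ] (∑[ Ys ← Yss ] χ (flag Y Ys) * (p * (b * stay Y Ys + ∣ Y ─ F ∣ * flagWeight φ e (suc m) (∣ F ∣ + ∣ Y ─ F ∣) (suc k) (increments Y Ys))))
      -- `flagWeight` tracks the size and rank of the closure formally; along an actual flag they
      -- are those of `Y`, which turns the second summand into a weight based at `Y`.
      ≡⟨ ∑-cong (subsets n) (λ Y → ∑-cong Yss λ Ys → χ-*-cong (flag Y Ys) λ { ((_ , rk , F⊂Y) , _) →
           cong (λ w → p * (b * stay Y Ys + ∣ Y ─ F ∣ * w))
             (cong₂ (λ f′ k′ → flagWeight φ e (suc m) f′ k′ (increments Y Ys))
                    (∣p∣+∣q─p∣≡∣q∣ (p⊂q⇒p⊆q F⊂Y)) (sym rk)) }) ⟩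
    ∑[ Y ← subsets n ] (∑[ Ys ← Yss ] χ (flag Y Ys) * (p * (b * stay Y Ys + ∣ Y ─ F ∣ * rise Y Ys)))
      ≡⟨ ∑-cong (subsets n) (λ Y → trans
           (∑-cong Yss λ Ys → *-swap (χ (flag Y Ys)) p _)
           (∑-*ˡ Yss p _)) ⟩
    ∑[ Y ← subsets n ] p * (∑[ Ys ← Yss ] χ (flag Y Ys) * (b * stay Y Ys + ∣ Y ─ F ∣ * rise Y Ys))
      ≡⟨ ∑-*ˡ (subsets n) p _ ⟩
    p * (∑[ Y ← subsets n ] (∑[ Ys ← Yss ] χ (flag Y Ys) * (b * stay Y Ys + ∣ Y ─ F ∣ * rise Y Ys)))
      ≡⟨ cong (p *_) (∑-cong (subsets n) λ Y → trans
           (∑-cong Yss λ Ys → *-distribˡ-+ (χ (flag Y Ys)) _ _) (∑-+ Yss _ _)) ⟩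
    p * (∑[ Y ← subsets n ] ((∑[ Ys ← Yss ] χ (flag Y Ys) * (b * stay Y Ys))
                              + (∑[ Ys ← Yss ] χ (flag Y Ys) * (∣ Y ─ F ∣ * rise Y Ys))))
      ≡⟨ cong (p *_) (∑-+ (subsets n) _ _) ⟩
    p * ((∑[ Y ← subsets n ] (∑[ Ys ← Yss ] χ (flag Y Ys) * (b * stay Y Ys)))
         + (∑[ Y ← subsets n ] (∑[ Ys ← Yss ] χ (flag Y Ys) * (∣ Y ─ F ∣ * rise Y Ys))))
      ≡⟨ cong (p *_) (cong₂ _+_ stay-part (∑-cong (subsets n) rise-part)) ⟩
    p * (b * flagSum e (suc m) (suc d) F
         + (∑[ Y ← subsets n ] χ (cover? M F Y) * (∣ Y ─ F ∣ * flagSum e (suc m) d Y))) ∎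
    where
    open ≡-Reasoning
    k = rank F
    p = φ m k
    b = ∣ F ∣ ∸ m
    Yss = vectors (subsets n) d
    flag = λ Y Ys → flagFrom? M F (Y ∷ Ys)
    stay = λ Y Ys → flagWeight φ e (suc m) ∣ F ∣ k (increments F (Y ∷ Ys))
    rise = λ Y Ys → flagWeight φ e (suc m) ∣ Y ∣ (rank Y) (increments Y Ys)

    stay-part : (∑[ Y ← subsets n ] (∑[ Ys ← Yss ] χ (flag Y Ys) * (b * stay Y Ys))) ≡
                b * flagSum e (suc m) (suc d) F
    stay-part = begin
      ∑[ Y ← subsets n ] (∑[ Ys ← Yss ] χ (flag Y Ys) * (b * stay Y Ys))
        ≡⟨ ∑-cong (subsets n) (λ Y → trans (∑-cong Yss λ Ys → *-swap (χ (flag Y Ys)) b _) (∑-*ˡ Yss b _)) ⟩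
      ∑[ Y ← subsets n ] b * (∑[ Ys ← Yss ] χ (flag Y Ys) * stay Y Ys)
        ≡⟨ ∑-*ˡ (subsets n) b _ ⟩
      b * (∑[ Y ← subsets n ] (∑[ Ys ← Yss ] χ (flag Y Ys) * stay Y Ys))
        ≡⟨ cong (b *_) (∑-vectors (subsets n) d _) ⟨
      b * flagSum e (suc m) (suc d) F ∎

    rise-part : ∀ Y → (∑[ Ys ← Yss ] χ (flag Y Ys) * (∣ Y ─ F ∣ * rise Y Ys)) ≡
                      χ (cover? M F Y) * (∣ Y ─ F ∣ * flagSum e (suc m) d Y)
    rise-part Y = begin
      ∑[ Ys ← Yss ] χ (flag Y Ys) * (∣ Y ─ F ∣ * rise Y Ys)
        ≡⟨ ∑-cong Yss (λ Ys → begin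
             χ (flag Y Ys) * (∣ Y ─ F ∣ * rise Y Ys)
               ≡⟨ cong (_* (∣ Y ─ F ∣ * rise Y Ys)) (χ-× (cover? M F Y) (flagFrom? M Y Ys)) ⟩
             χ (cover? M F Y) * χ (flagFrom? M Y Ys) * (∣ Y ─ F ∣ * rise Y Ys)
               ≡⟨ *-assoc (χ (cover? M F Y)) _ _ ⟩
             χ (cover? M F Y) * (χ (flagFrom? M Y Ys) * (∣ Y ─ F ∣ * rise Y Ys))
               ≡⟨ cong (χ (cover? M F Y) *_) (*-swap (χ (flagFrom? M Y Ys)) ∣ Y ─ F ∣ _) ⟩
             χ (cover? M F Y) * (∣ Y ─ F ∣ * (χ (flagFrom? M Y Ys) * rise Y Ys)) ∎) ⟩
      ∑[ Ys ← Yss ] χ (cover? M F Y) * (∣ Y ─ F ∣ * (χ (flagFrom? M Y Ys) * rise Y Ys))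
        ≡⟨ ∑-*ˡ Yss (χ (cover? M F Y)) _ ⟩
      χ (cover? M F Y) * (∑[ Ys ← Yss ] ∣ Y ─ F ∣ * (χ (flagFrom? M Y Ys) * rise Y Ys))
        ≡⟨ cong (χ (cover? M F Y) *_) (∑-*ˡ Yss ∣ Y ─ F ∣ _) ⟩
      χ (cover? M F Y) * (∣ Y ─ F ∣ * flagSum e (suc m) d Y) ∎

  -- Every `x` outside `F` generates one cover of `F`, and a cover `Y` is generated by exactly the
  -- elements of `Y ─ F`.
  ∑-covers : ∀ {F} → Flat F → ∀ (h : Subset n → ℕ) →
    ∑[ x ← allFin n ] χ (¬? (x ∈? F)) * h (closure M (F ∪ ⁅ x ⁆)) ≡
    ∑[ Y ← subsets n ] χ (cover? M F Y) * (∣ Y ─ F ∣ * h Y)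
  ∑-covers {F} flat h = begin
    ∑[ x ← allFin n ] χ (¬? (x ∈? F)) * h (closure M (F ∪ ⁅ x ⁆))
      ≡⟨ ∑-cong (allFin n) (λ x → χ-*-cong (¬? (x ∈? F)) λ x∉F → sym
           (subsets-enumerates n (λ Y → cover? M F Y ×-dec (x ∈? Y)) h
             (cover-through M flat x∉F) (λ (cover , x∈Y) → cover-unique M flat x∉F cover x∈Y))) ⟩
    ∑[ x ← allFin n ] χ (¬? (x ∈? F)) * (∑[ Y ← subsets n ] χ (cover? M F Y ×-dec (x ∈? Y)) * h Y)
      ≡⟨ ∑-cong (allFin n) (λ x → trans (sym (∑-*ˡ (subsets n) (χ (¬? (x ∈? F))) _))
           (∑-cong (subsets n) λ Y → regroup x Y)) ⟩
    ∑[ x ← allFin n ] (∑[ Y ← subsets n ] χ (cover? M F Y) * (χ (¬? (x ∈? F)) * χ (x ∈? Y) * h Y))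
      ≡⟨ ∑-swap (allFin n) (subsets n) _ ⟩
    ∑[ Y ← subsets n ] (∑[ x ← allFin n ] χ (cover? M F Y) * (χ (¬? (x ∈? F)) * χ (x ∈? Y) * h Y))
      ≡⟨ ∑-cong (subsets n) (λ Y → trans (∑-*ˡ (allFin n) (χ (cover? M F Y)) _)
           (cong (χ (cover? M F Y) *_) (trans (∑-*ʳ (allFin n) (h Y) _)
             (cong (_* h Y) (∑-∉∈≡∣─∣ F Y))))) ⟩
    ∑[ Y ← subsets n ] χ (cover? M F Y) * (∣ Y ─ F ∣ * h Y) ∎
    where
    open ≡-Reasoning
    regroup : ∀ x Y → χ (¬? (x ∈? F)) * (χ (cover? M F Y ×-dec (x ∈? Y)) * h Y) ≡
                      χ (cover? M F Y) * (χ (¬? (x ∈? F)) * χ (x ∈? Y) * h Y)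
    regroup x Y = begin
      χ (¬? (x ∈? F)) * (χ (cover? M F Y ×-dec (x ∈? Y)) * h Y)
        ≡⟨ cong (λ w → χ (¬? (x ∈? F)) * (w * h Y)) (χ-× (cover? M F Y) (x ∈? Y)) ⟩
      χ (¬? (x ∈? F)) * (χ (cover? M F Y) * χ (x ∈? Y) * h Y)
        ≡⟨ cong (χ (¬? (x ∈? F)) *_) (*-assoc (χ (cover? M F Y)) _ _) ⟩
      χ (¬? (x ∈? F)) * (χ (cover? M F Y) * (χ (x ∈? Y) * h Y))
        ≡⟨ *-swap (χ (¬? (x ∈? F))) (χ (cover? M F Y)) _ ⟩
      χ (cover? M F Y) * (χ (¬? (x ∈? F)) * (χ (x ∈? Y) * h Y))
        ≡⟨ cong (χ (cover? M F Y) *_) (*-assoc (χ (¬? (x ∈? F))) _ _) ⟨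
      χ (cover? M F Y) * (χ (¬? (x ∈? F)) * χ (x ∈? Y) * h Y) ∎

  -- The hypotheses say that `F` is the closure of `S`. The next element either lies in `F` and
  -- leaves the closure alone, or lies outside, and then the continuations are grouped by the cover
  -- of `F` that it generates.
  up≡flagSum : ∀ e d {S F} → Flat F → S ⊆ F → rank F ≡ rank S → ∣ S ∣ + e ≡ n → rank F + d ≡ r →
               up (weight φ M) e S ≡ flagSum e ∣ S ∣ d F
  up≡flagSum zero zero {S} {F} flat S⊆F eq size rk =
    sym (trans (+-identityʳ _) (trans (*-identityˡ _) (cong (φ ∣ S ∣) eq)))
  -- With no element left to add, `S` is `⊤`, so `F` already has rank `r` and the flag cannot rise
  -- further.
  up≡flagSum zero (suc d) {S} {F} flat S⊆F eq size rk = contradiction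
    (begin-strict
      rank F            <⟨ m<m+n (rank F) (s≤s z≤n) ⟩
      rank F + suc d    ≡⟨ rk ⟩
      r                 ≡⟨ rank-⊤ ⟨
      rank ⊤            ≡⟨ cong rank (∣p∣≡n⇒p≡⊤ (trans (sym (+-identityʳ _)) size)) ⟨
      rank S            ≡⟨ eq ⟨
      rank F            ∎) (<-irrefl refl)
    where open ≤-Reasoning
  up≡flagSum (suc e) d {S} {F} flat S⊆F eq size rk = begin
    ψ S * (∑[ x ← allFin n ] χ (¬? (x ∈? S)) * up ψ e (S ∪ ⁅ x ⁆))
      ≡⟨ cong₂ _*_ (cong (φ ∣ S ∣) (sym eq)) (∑-cong (allFin n) step) ⟩
    p * (∑[ x ← allFin n ] (χ (¬? (x ∈? S)) * χ (x ∈? F) * G + χ (¬? (x ∈? F)) * up ψ e (S ∪ ⁅ x ⁆)))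
      ≡⟨ cong (p *_) (∑-+ (allFin n) _ _) ⟩
    p * ((∑[ x ← allFin n ] χ (¬? (x ∈? S)) * χ (x ∈? F) * G)
         + (∑[ x ← allFin n ] χ (¬? (x ∈? F)) * up ψ e (S ∪ ⁅ x ⁆)))
      ≡⟨ cong (λ w → p * (w + (∑[ x ← allFin n ] χ (¬? (x ∈? F)) * up ψ e (S ∪ ⁅ x ⁆)))) (trans (∑-*ʳ (allFin n) G _) (cong (_* G) (trans (∑-∉∈≡∣─∣ S F) ∣F─S∣))) ⟩
    p * ((∣ F ∣ ∸ ∣ S ∣) * G + (∑[ x ← allFin n ] χ (¬? (x ∈? F)) * up ψ e (S ∪ ⁅ x ⁆)))
      ≡⟨ finish d rk ⟩
    flagSum (suc e) ∣ S ∣ d F ∎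
    where
    open ≡-Reasoning
    ψ = weight φ M
    p = φ ∣ S ∣ (rank F)
    G = flagSum e (suc ∣ S ∣) d F

    ∣F─S∣ : ∣ F ─ S ∣ ≡ ∣ F ∣ ∸ ∣ S ∣
    ∣F─S∣ = trans (sym (m+n∸m≡n ∣ S ∣ _)) (cong (_∸ ∣ S ∣) (∣p∣+∣q─p∣≡∣q∣ S⊆F))

    size′ : ∀ {x} → x ∉ S → ∣ S ∪ ⁅ x ⁆ ∣ + e ≡ n
    size′ x∉S = trans (cong (_+ e) (∣p∪⁅x⁆∣≡1+∣p∣ x∉S)) (trans (sym (+-suc ∣ S ∣ e)) size)

    within : ∀ {x} → x ∉ S → x ∈ F → up ψ e (S ∪ ⁅ x ⁆) ≡ G
    within {x} x∉S x∈F = trans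
      (up≡flagSum e d flat (∪⁅⁆-least S⊆F x∈F)
        (≤-antisym (≤-trans (≤-reflexive eq) (rank-mono (p⊆p∪q ⁅ x ⁆))) (rank-mono (∪⁅⁆-least S⊆F x∈F)))
        (size′ x∉S) rk)
      (cong (λ m → flagSum e m d F) (∣p∪⁅x⁆∣≡1+∣p∣ x∉S))

    step : ∀ x → χ (¬? (x ∈? S)) * up ψ e (S ∪ ⁅ x ⁆) ≡
                 χ (¬? (x ∈? S)) * χ (x ∈? F) * G + χ (¬? (x ∈? F)) * up ψ e (S ∪ ⁅ x ⁆)
    step x with x ∈? F
    ... | yes x∈F = trans (χ-*-cong (¬? (x ∈? S)) λ x∉S → within x∉S x∈F)
      (sym (trans (+-identityʳ _) (cong (_* G) (*-identityʳ (χ (¬? (x ∈? S)))))))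
    ... | no x∉F = trans (cong (_* up ψ e (S ∪ ⁅ x ⁆)) (χ-yes (¬? (x ∈? S)) (x∉F ∘ S⊆F)))
      (cong (λ w → w * G + 1 * up ψ e (S ∪ ⁅ x ⁆)) (sym (*-zeroʳ (χ (¬? (x ∈? S))))))

    beyond : ∀ d′ → rank F + suc d′ ≡ r → ∀ {x} → x ∉ F →
             up ψ e (S ∪ ⁅ x ⁆) ≡ flagSum e (suc ∣ S ∣) d′ (closure M (F ∪ ⁅ x ⁆))
    beyond d′ rk′ {x} x∉F with cover-through M flat x∉F
    ... | (flatY , rankY , F⊂Y) , x∈Y = trans
      (up≡flagSum e d′ flatY (∪⁅⁆-least (p⊂q⇒p⊆q F⊂Y ∘ S⊆F) x∈Y)
        (trans rankY (≤-antisym rank< (≤-trans (rank-∪⁅⁆ M S x) (≤-reflexive (cong suc (sym eq))))))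
        (size′ (x∉F ∘ S⊆F)) (trans (cong (_+ d′) rankY) (trans (sym (+-suc (rank F) d′)) rk′)))
      (cong (λ m → flagSum e m d′ (closure M (F ∪ ⁅ x ⁆))) (∣p∪⁅x⁆∣≡1+∣p∣ (x∉F ∘ S⊆F)))
      where
      -- If `x` did not raise the rank of `S` it would not raise that of `F`, contrary to `F` being
      -- a flat without `x`. Hence the closure of `F ∪ ⁅ x ⁆` is also that of `S ∪ ⁅ x ⁆`.
      rank< : rank F < rank (S ∪ ⁅ x ⁆)
      rank< = ≤∧≢⇒< (≤-trans (≤-reflexive eq) (rank-mono (p⊆p∪q ⁅ x ⁆))) λ eq′ →
        >⇒≢ (flat x x∉F) (rank-∪⁅⁆-absorb M S⊆F x (trans (sym eq′) eq))

    finish : ∀ d → rank F + d ≡ r →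
      p * ((∣ F ∣ ∸ ∣ S ∣) * flagSum e (suc ∣ S ∣) d F + (∑[ x ← allFin n ] χ (¬? (x ∈? F)) * up ψ e (S ∪ ⁅ x ⁆)))
      ≡ flagSum (suc e) ∣ S ∣ d F
    finish zero rk′ = trans
      (cong (p *_) (trans (cong ((∣ F ∣ ∸ ∣ S ∣) * flagSum e (suc ∣ S ∣) 0 F +_) (∑-zero (allFin n) λ x →
        χ*-zero (¬? (x ∈? F)) λ x∉F → x∉F (subst (x ∈_)
          (sym (flat-spanning M flat (trans (sym (+-identityʳ _)) rk′))) ∈⊤)))
        (+-identityʳ _)))
      (sym (flagSum-suc-zero e ∣ S ∣ F))
    finish (suc d′) rk′ = trans
      (cong (λ w → p * ((∣ F ∣ ∸ ∣ S ∣) * flagSum e (suc ∣ S ∣) (suc d′) F + w)) (trans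
        (∑-cong (allFin n) λ x → χ-*-cong (¬? (x ∈? F)) (beyond d′ rk′))
        (∑-covers flat (flagSum e (suc ∣ S ∣) d′))))
      (sym (flagSum-suc-suc e ∣ S ∣ d′ F))

  chainSum≡∑flags : chainSum φ M ≡
    ∑[ X ← vectors (subsets n) (suc r) ] χ (flag? X) * compositionWeight φ n (flagComposition X)
  chainSum≡∑flags = begin
    up (weight φ M) n ⊥
      ≡⟨ up≡flagSum n r (closure-flat M ⊥) (⊆-closure M) (rank-closure M ⊥)
           (cong (_+ n) (∣⊥∣≡0 n)) (cong (_+ r) (trans (rank-closure M ⊥) rank-⊥)) ⟩
    flagSum n ∣ ⊥ {n} ∣ r (closure M ⊥)
      ≡⟨ cong (λ m → flagSum n m r (closure M ⊥)) (∣⊥∣≡0 n) ⟩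
    flagSum n 0 r (closure M ⊥)
      -- The closure of `⊥` is the only flat of rank 0; replacing it by a sum over all such flats
      -- supplies the first coordinate of the flag vectors.
      ≡⟨ subsets-enumerates n bottom? (flagSum n 0 r)
           (closure-flat M ⊥ , trans (rank-closure M ⊥) rank-⊥)
           (λ (flat , rk) → closure-unique M flat (⊆-min _) (trans rk (sym rank-⊥))) ⟨
    ∑[ X ← subsets n ] χ (bottom? X) * flagSum n 0 r X
      ≡⟨ ∑-cong (subsets n) (λ X → trans (sym (∑-*ˡ (vectors (subsets n) r) (χ (bottom? X)) _))
           (∑-cong (vectors (subsets n) r) λ Xs → flagTerm X Xs)) ⟩
    ∑[ X ← subsets n ] (∑[ Xs ← vectors (subsets n) r ]
      χ (flag? (X ∷ Xs)) * compositionWeight φ n (flagComposition (X ∷ Xs)))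
      ≡⟨ ∑-vectors (subsets n) r _ ⟨
    ∑[ X ← vectors (subsets n) (suc r) ] χ (flag? X) * compositionWeight φ n (flagComposition X) ∎
    where
    open ≡-Reasoning
    bottom? : ∀ X → Dec (Flat X × rank X ≡ 0)
    bottom? X = flat? X ×-dec rank X ≟ 0
    flagTerm : ∀ X (Xs : Vec (Subset n) r) →
      χ (bottom? X) * (χ (flagFrom? M X Xs) * flagWeight φ n 0 ∣ X ∣ (rank X) (increments X Xs)) ≡
      χ (flag? (X ∷ Xs)) * compositionWeight φ n (flagComposition (X ∷ Xs))
    flagTerm X Xs = begin
      χ (bottom? X) * (χ (flagFrom? M X Xs) * flagWeight φ n 0 ∣ X ∣ (rank X) (increments X Xs))
        ≡⟨ χ-*-cong (bottom? X) (λ (_ , rk) → cong (λ k → χ (flagFrom? M X Xs) * flagWeight φ n 0 ∣ X ∣ k (increments X Xs)) rk) ⟩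
      χ (bottom? X) * (χ (flagFrom? M X Xs) * flagWeight φ n 0 ∣ X ∣ 0 (increments X Xs))
        ≡⟨ *-assoc (χ (bottom? X)) _ _ ⟨
      χ (bottom? X) * χ (flagFrom? M X Xs) * flagWeight φ n 0 ∣ X ∣ 0 (increments X Xs)
        ≡⟨ cong₂ _*_
             (trans (sym (χ-× (bottom? X) (flagFrom? M X Xs)))
               (χ-cong (bottom? X ×-dec flagFrom? M X Xs) (flag? (X ∷ Xs))
                 (λ (bottom , flag) → flag-∷⁺ M bottom flag) (flag-∷⁻ M)))
             (cong (compositionWeight φ n) (sym (flagComposition≡ X Xs))) ⟩
      χ (flag? (X ∷ Xs)) * compositionWeight φ n (flagComposition (X ∷ Xs)) ∎

-- Chain sums from the catenary data.

flagCompositions : ∀ {n r} → Matroid n r → List (Vec ℕ (suc r))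
flagCompositions {n} {r} M = map flagComposition (filter (Matroid.flag? M) (vectors (subsets n) (suc r)))

∑-flagCompositions : ∀ {n r} (M : Matroid n r) f →
  ∑ (flagCompositions M) f ≡
  ∑[ X ← vectors (subsets n) (suc r) ] χ (Matroid.flag? M X) * f (flagComposition X)
∑-flagCompositions {n} {r} M f = trans
  (∑-map flagComposition (filter (Matroid.flag? M) (vectors (subsets n) (suc r))) f)
  (∑-filter (Matroid.flag? M) (vectors (subsets n) (suc r)) (f ∘ flagComposition))

ν≡multiplicity : ∀ {n r} (M : Matroid n r) a →
  ν M a ≡ multiplicity (≡-dec _≟_) (Composition.parts a) (flagCompositions M)
ν≡multiplicity {n} {r} M a = trans (length-filter _ (vectors (subsets n) (suc r))) (trans
  (∑-cong (vectors (subsets n) (suc r)) λ X →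
    χ-× (Matroid.flag? M X) (≡-dec _≟_ (flagComposition X) (Composition.parts a)))
  (sym (∑-flagCompositions M λ b → χ (≡-dec _≟_ b (Composition.parts a)))))

∈-flagCompositions⁻ : ∀ {n r} (M : Matroid n r) {b} → b ListMem.∈ flagCompositions M →
                      ∃[ a ] Composition.parts {n} {r} a ≡ b
∈-flagCompositions⁻ {n} {r} M b∈ with ∈-map⁻ flagComposition b∈
... | X , X∈ , refl = composition M {X} (proj₂ (∈-filter⁻ (Matroid.flag? M) {xs = vectors (subsets n) (suc r)} X∈)) , refl

sameCatenaryData⇒sameChainSums : ∀ {n r} (M N : Matroid n r) → SameCatenaryData M N → SameChainSums M N
sameCatenaryData⇒sameChainSums {n} M N same φ = begin
  chainSum φ M                                        ≡⟨ chainSum≡∑flags M φ ⟩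
  _                                                   ≡⟨ ∑-flagCompositions M (compositionWeight φ n) ⟨
  ∑ (flagCompositions M) (compositionWeight φ n)
    ≡⟨ ∑-multiplicity (≡-dec _≟_) (flagCompositions M) (flagCompositions N)
         (λ b → [ multiplicities ∘ ∈-flagCompositions⁻ M , multiplicities ∘ ∈-flagCompositions⁻ N ]′) _ ⟩
  ∑ (flagCompositions N) (compositionWeight φ n)      ≡⟨ ∑-flagCompositions N (compositionWeight φ n) ⟩
  _                                                   ≡⟨ chainSum≡∑flags N φ ⟨
  chainSum φ N                                        ∎
  where
  open ≡-Reasoning
  multiplicities : ∀ {b} → ∃[ a ] Composition.parts a ≡ b →
    multiplicity (≡-dec _≟_) b (flagCompositions M) ≡ multiplicity (≡-dec _≟_) b (flagCompositions N)
  multiplicities (a , refl) = trans (sym (ν≡multiplicity M a)) (trans (same a) (ν≡multiplicity N a))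

-- The 𝒢-invariant

rankWeight : (ℕ → ℕ → ℕ) → ℕ → ℕ → ∀ {d} → Vec ℕ d → ℕ
rankWeight φ m k []       = φ m k
rankWeight φ m k (b ∷ bs) = φ m k * rankWeight φ (suc m) (k + b) bs

unique? : ∀ {n d} (xs : Vec (Fin n) d) → Dec (Unique xs)
unique? = VecAllPairs.allPairs? λ x y → ¬? (x ≟ᶠ y)

Avoids : ∀ {n d} → Subset n → Vec (Fin n) d → Set
Avoids S = VecAll.All (_∉ S)

avoids? : ∀ {n d} S (xs : Vec (Fin n) d) → Dec (Avoids S xs)
avoids? S = VecAll.all? λ x → ¬? (x ∈? S)

-- `orderings` pairs each sequence with its proof of distinctness; this forgets the proofs so that
-- the sum can be matched with a filtered one.
∑-toList : ∀ {A : Set} {P : A → Set} {xs} (pxs : All P xs) (g : A → ℕ) →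
           ∑ (All.toList pxs) (g ∘ proj₁) ≡ ∑ xs g
∑-toList []         g = refl
∑-toList (px ∷ pxs) g = cong (g _ +_) (∑-toList pxs g)

module _ {n r : ℕ} (M : Matroid n r) where

  open Matroid M using (rank; rank-mono; rank-⊥)

  rankSequences : List (Vec ℕ n)
  rankSequences = map (rankSequence M) (orderings n)

  module _ (φ : ℕ → ℕ → ℕ) where

    -- Unfolding the nested sums lists the elements in the order in which they are added. `avoids?`
    -- records that they are new to `S`, which the induction needs for general `S` and which is
    -- vacuous at `⊥`.
    up≡∑orderings : ∀ d S → up (weight φ M) d S ≡
      ∑[ xs ← vectors (allFin n) d ]
        χ (unique? xs ×-dec avoids? S xs) * rankWeight φ ∣ S ∣ (rank S) (rankIncrements M S xs)
    up≡∑orderings zero    S = sym (trans (+-identityʳ _) (*-identityˡ _))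
    up≡∑orderings (suc d) S = begin
      p * (∑[ x ← allFin n ] χ (¬? (x ∈? S)) * up (weight φ M) d (S ∪ ⁅ x ⁆))
        ≡⟨ ∑-*ˡ (allFin n) p _ ⟨
      ∑[ x ← allFin n ] p * (χ (¬? (x ∈? S)) * up (weight φ M) d (S ∪ ⁅ x ⁆))
        ≡⟨ ∑-cong (allFin n) (λ x → trans
             (cong (λ w → p * (χ (¬? (x ∈? S)) * w)) (up≡∑orderings d (S ∪ ⁅ x ⁆)))
             (trans (sym (*-assoc p (χ (¬? (x ∈? S))) _)) (sym (∑-*ˡ xss (p * χ (¬? (x ∈? S))) _)))) ⟩
      ∑[ x ← allFin n ] (∑[ xs ← xss ] p * χ (¬? (x ∈? S)) *
        (χ (unique? xs ×-dec avoids? (S ∪ ⁅ x ⁆) xs) * W x xs))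
        ≡⟨ ∑-cong (allFin n) (λ x → ∑-cong xss (term x)) ⟩
      ∑[ x ← allFin n ] (∑[ xs ← xss ] χ (unique? (x ∷ xs) ×-dec avoids? S (x ∷ xs)) *
        rankWeight φ ∣ S ∣ (rank S) (rankIncrements M S (x ∷ xs)))
        ≡⟨ ∑-vectors (allFin n) d _ ⟨
      ∑[ xs ← vectors (allFin n) (suc d) ]
        χ (unique? xs ×-dec avoids? S xs) * rankWeight φ ∣ S ∣ (rank S) (rankIncrements M S xs) ∎
      where
      open ≡-Reasoning
      p = φ ∣ S ∣ (rank S)
      xss = vectors (allFin n) d
      W : Fin n → Vec (Fin n) d → ℕ
      W x xs = rankWeight φ ∣ S ∪ ⁅ x ⁆ ∣ (rank (S ∪ ⁅ x ⁆)) (rankIncrements M (S ∪ ⁅ x ⁆) xs)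

      split : ∀ {x xs} → Unique (x ∷ xs) × Avoids S (x ∷ xs) → x ∉ S × Unique xs × Avoids (S ∪ ⁅ x ⁆) xs
      split {x} (x≢ VecAllPairs.∷ u , x∉S VecAll.∷ av) = x∉S , u ,
        VecAll.map (λ (y∉S , x≢y) y∈ → [ y∉S , x≢y ∘ sym ]′ (y∈p∪⁅x⁆⁻ S y∈)) (VecAll.zip (av , x≢))

      join : ∀ {x xs} → x ∉ S × Unique xs × Avoids (S ∪ ⁅ x ⁆) xs → Unique (x ∷ xs) × Avoids S (x ∷ xs)
      join {x} (x∉S , u , av) =
        VecAll.map (λ { y∉ refl → y∉ (x∈p∪⁅x⁆ S) }) av VecAllPairs.∷ u ,
        x∉S VecAll.∷ VecAll.map (_∘ p⊆p∪q ⁅ x ⁆) av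

      term : ∀ x xs → p * χ (¬? (x ∈? S)) * (χ (unique? xs ×-dec avoids? (S ∪ ⁅ x ⁆) xs) * W x xs) ≡
        χ (unique? (x ∷ xs) ×-dec avoids? S (x ∷ xs)) *
        (p * rankWeight φ (suc ∣ S ∣) (rank S + (rank (S ∪ ⁅ x ⁆) ∸ rank S)) (rankIncrements M (S ∪ ⁅ x ⁆) xs))
      term x xs = begin
        p * χ (¬? (x ∈? S)) * (χ rest? * W x xs)     ≡⟨ *-assoc p (χ (¬? (x ∈? S))) _ ⟩
        p * (χ (¬? (x ∈? S)) * (χ rest? * W x xs))   ≡⟨ cong (p *_) (*-assoc (χ (¬? (x ∈? S))) (χ rest?) _) ⟨
        p * (χ (¬? (x ∈? S)) * χ rest? * W x xs)
          ≡⟨ cong (λ w → p * (w * W x xs)) (trans (sym (χ-× (¬? (x ∈? S)) rest?))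
               (χ-cong (¬? (x ∈? S) ×-dec rest?) whole? join split)) ⟩
        p * (χ whole? * W x xs)                      ≡⟨ *-swap p (χ whole?) _ ⟩
        χ whole? * (p * W x xs)
          ≡⟨ χ-*-cong whole? (λ good → cong (p *_) (cong₂
               (λ m k → rankWeight φ m k (rankIncrements M (S ∪ ⁅ x ⁆) xs))
               (∣p∪⁅x⁆∣≡1+∣p∣ (proj₁ (split good)))
               (sym (m+[n∸m]≡n (rank-mono (p⊆p∪q ⁅ x ⁆)))))) ⟩
        χ whole? * (p * rankWeight φ (suc ∣ S ∣) (rank S + (rank (S ∪ ⁅ x ⁆) ∸ rank S)) (rankIncrements M (S ∪ ⁅ x ⁆) xs)) ∎
        where
        rest? = unique? xs ×-dec avoids? (S ∪ ⁅ x ⁆) xs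
        whole? = unique? (x ∷ xs) ×-dec avoids? S (x ∷ xs)

    chainSum≡∑rankSequences : chainSum φ M ≡ ∑ rankSequences (rankWeight φ 0 0)
    chainSum≡∑rankSequences = begin
      up (weight φ M) n ⊥
        ≡⟨ up≡∑orderings n ⊥ ⟩
      ∑[ xs ← xss ] χ (unique? xs ×-dec avoids? ⊥ xs) * rankWeight φ ∣ ⊥ {n} ∣ (rank ⊥) (rankIncrements M ⊥ xs)
        ≡⟨ ∑-cong xss (λ xs → cong₂ _*_
             (χ-cong (unique? xs ×-dec avoids? ⊥ xs) (unique? xs) proj₁ (_, VecAll.universal (λ _ → ∉⊥) xs))
             (cong₂ (λ m k → rankWeight φ m k (rankIncrements M ⊥ xs)) (∣⊥∣≡0 n) rank-⊥)) ⟩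
      ∑[ xs ← xss ] χ (unique? xs) * G xs
        ≡⟨ ∑-filter unique? xss G ⟨
      ∑ (filter unique? xss) G
        ≡⟨ ∑-toList (all-filter unique? xss) G ⟨
      ∑ (All.toList (all-filter unique? xss)) (G ∘ proj₁)
        ≡⟨ ∑-map _ (All.toList (all-filter unique? xss)) (rankWeight φ 0 0 ∘ rankSequence M) ⟨
      ∑ (orderings n) (rankWeight φ 0 0 ∘ rankSequence M)
        ≡⟨ ∑-map (rankSequence M) (orderings n) (rankWeight φ 0 0) ⟨
      ∑ rankSequences (rankWeight φ 0 0) ∎
      where
      open ≡-Reasoning
      xss = vectors (allFin n) n
      G = λ xs → rankWeight φ 0 0 (rankIncrements M ⊥ xs)

module _ {c ℓ₁ ℓ₂ : Level} (K : HeytingField c ℓ₁ ℓ₂) where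

  private
    ring = HeytingCommutativeRing.commutativeRing (HeytingField.heytingCommutativeRing K)
    module R = CommutativeRing ring
  open R using (_≈_; 0#; 1#) renaming (_+_ to _+ᴷ_)
  open Mult R.+-monoid using (×-homo-+) renaming (_×_ to _×ᴷ_)
  open GroupProperties R.+-group using (∙-cancelˡ)

  -- The coefficients of the 𝒢-invariant are counts mapped into the field, and characteristic zero
  -- makes them recoverable: cancelling the smaller multiple leaves a multiple of `1#` that is zero.
  ×1-injective : CharacteristicZero K → ∀ k l → k ×ᴷ 1# ≈ l ×ᴷ 1# → k ≡ l
  ×1-injective char0 k l eq = [ (λ k≤l → below k≤l eq) , (λ l≤k → sym (below l≤k (R.sym eq))) ]′ (≤-total k l)
    where
    below : ∀ {k l} → k ≤ l → k ×ᴷ 1# ≈ l ×ᴷ 1# → k ≡ l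
    below {k} k≤l eq with m≤n⇒∃[o]m+o≡n k≤l
    ... | o , refl = sym (trans (cong (k +_) (char0 o (∙-cancelˡ (k ×ᴷ 1#) _ _
      (R.trans (R.sym (×-homo-+ 1# k o)) (R.trans (R.sym eq) (R.sym (R.+-identityʳ (k ×ᴷ 1#)))))))) (+-identityʳ k))

  𝒢≈multiplicity : ∀ {n r} (M : Matroid n r) σ →
    𝒢 K M σ ≈ multiplicity (≡-dec _≟_) (Symbol.bits σ) (rankSequences M) ×ᴷ 1#
  𝒢≈multiplicity {n} M σ = go (orderings n)
    where
    equal? : ∀ π → Dec (rankSequence M π ≡ Symbol.bits σ)
    equal? π = ≡-dec _≟_ (rankSequence M π) (Symbol.bits σ)

    head : ∀ {P : Set} (p : Dec P) → (if does p then 1# else 0#) ≈ χ p ×ᴷ 1#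
    head (yes _) = R.sym (R.+-identityʳ 1#)
    head (no _)  = R.refl

    go : ∀ πs → List.foldr (λ u v σ → u σ +ᴷ v σ) (λ _ → 0#) (map (basis K ∘ rankSymbol M) πs) σ ≈
                multiplicity (≡-dec _≟_) (Symbol.bits σ) (map (rankSequence M) πs) ×ᴷ 1#
    go []       = R.refl
    go (π ∷ πs) = R.trans (R.+-cong (head (equal? π)) (go πs))
      (R.sym (×-homo-+ 1# (χ (equal? π)) _))

  𝒢Equal⇒sameChainSums : CharacteristicZero K → ∀ {n r} (M N : Matroid n r) →
    𝒢Equal K (𝒢 K M) (𝒢 K N) → SameChainSums M N
  𝒢Equal⇒sameChainSums char0 M N same φ = begin
    chainSum φ M                             ≡⟨ chainSum≡∑rankSequences M φ ⟩
    ∑ (rankSequences M) (rankWeight φ 0 0)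
      ≡⟨ ∑-multiplicity (≡-dec _≟_) (rankSequences M) (rankSequences N)
           (λ b → [ multiplicities ∘ symbol M , multiplicities ∘ symbol N ]′) (rankWeight φ 0 0) ⟩
    ∑ (rankSequences N) (rankWeight φ 0 0)   ≡⟨ chainSum≡∑rankSequences N φ ⟨
    chainSum φ N                             ∎
    where
    open ≡-Reasoning
    symbol : ∀ {n r} (L : Matroid n r) {b} → b ListMem.∈ rankSequences L →
             ∃[ σ ] Symbol.bits {n} {r} σ ≡ b
    symbol L b∈ with ∈-map⁻ (rankSequence L) b∈
    ... | π , _ , refl = rankSymbol L π , refl

    multiplicities : ∀ {b} → ∃[ σ ] Symbol.bits σ ≡ b →
      multiplicity (≡-dec _≟_) b (rankSequences M) ≡ multiplicity (≡-dec _≟_) b (rankSequences N)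
    multiplicities (σ , refl) = ×1-injective char0 _ _
      (R.trans (R.sym (𝒢≈multiplicity M σ)) (R.trans (same σ) (𝒢≈multiplicity N σ)))

-- Hamiltonian graphs

toℕ-mod : ∀ {m n} → m < suc n → toℕ (m mod suc n) ≡ m
toℕ-mod {m} {n} m<1+n = trans (toℕ-fromℕ< (m%n<n m (suc n))) (m<n⇒m%n≡m m<1+n)

toℕ-self-mod : ∀ n → toℕ (suc n mod suc n) ≡ 0
toℕ-self-mod n = trans (toℕ-fromℕ< (m%n<n (suc n) (suc n))) (n%n≡0 (suc n))

-- A `Cycle` names the edge leaving each index; the edge arriving at `k` is the one leaving the
-- cyclic predecessor of `k`.
predecessor : ∀ {n} (k : Fin (suc n)) → Σ (Fin (suc n)) λ p → suc (toℕ p) mod suc n ≡ k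
predecessor {n} zero = fromℕ n , toℕ-injective
  (trans (cong (λ m → toℕ (suc m mod suc n)) (toℕ-fromℕ n)) (toℕ-self-mod n))
predecessor {suc n} (suc k) = inject₁ k , toℕ-injective
  (trans (cong (λ m → toℕ (suc m mod suc (suc n))) (toℕ-inject₁ k)) (toℕ-mod (s≤s (toℕ<n k))))

surjective⇒≥ : ∀ {m n} {f : Fin m → Fin n} → (∀ y → ∃[ x ] f x ≡ y) → n ≤ m
surjective⇒≥ {f = f} surj = injective⇒≤ {f = proj₁ ∘ surj} λ {y} {z} eq →
  trans (sym (proj₂ (surj y))) (trans (cong f eq) (proj₂ (surj z)))

injective⇒surjective : ∀ {m n} {f : Fin m → Fin n} → Injective _≡_ _≡_ f → m ≡ n → ∀ y → ∃[ x ] f x ≡ y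
injective⇒surjective {m} {n} {f} inj m≡n y with any? (λ x → f x ≟ᶠ y)
... | yes found = found
... | no missed = contradiction (injective⇒≤ g-inj) (<⇒≱ (≤-reflexive (cong suc (sym m≡n))))
  where
  g : Fin (suc m) → Fin n
  g zero    = y
  g (suc x) = f x
  g-inj : Injective _≡_ _≡_ g
  g-inj {zero}  {zero}  eq = refl
  g-inj {zero}  {suc x} eq = contradiction (x , sym eq) missed
  g-inj {suc x} {zero}  eq = contradiction (x , eq) missed
  g-inj {suc x} {suc z} eq = cong suc (inj eq)

∑-one : ∀ n → ∑[ i ← allFin n ] 1 ≡ n
∑-one zero    = refl
∑-one (suc n) = trans (∑-allFin-suc n (λ _ → 1)) (cong suc (∑-one n))

module _ {v n : ℕ} (G : Graph v n) where

  open Graph G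

  joins-sym : ∀ {e x y} → Joins e x y → Joins e y x
  joins-sym = Sum.swap

  joins-unique : ∀ {e x y x′ y′} → Joins e x y → Joins e x′ y′ → (x ≡ x′ × y ≡ y′) ⊎ (x ≡ y′ × y ≡ x′)
  joins-unique (inj₁ eq) (inj₁ eq′) = inj₁ (,-injective (trans (sym eq) eq′))
  joins-unique (inj₁ eq) (inj₂ eq′) = inj₂ (,-injective (trans (sym eq) eq′))
  joins-unique (inj₂ eq) (inj₁ eq′) = let p , q = ,-injective (trans (sym eq) eq′) in inj₂ (q , p)
  joins-unique (inj₂ eq) (inj₂ eq′) = let p , q = ,-injective (trans (sym eq) eq′) in inj₁ (q , p)

  leaving-edge : ∀ {A : Fin v → Set} → Decidable A → ∀ {x y} → Star Adjacent x y → A x → ¬ A y →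
    ∃[ e ] ∃[ a ] ∃[ b ] Joins e a b × A a × ¬ A b
  leaving-edge A? ε                    Ax ¬Ax = contradiction Ax ¬Ax
  leaving-edge A? (_◅_ {x} {y} (e , joined) path) Ax ¬Az with A? y
  ... | yes Ay = leaving-edge A? path Ay ¬Az
  ... | no ¬Ay = e , x , y , joined , Ax , ¬Ay

  module _ (C : Cycle) where

    OnCycle : Fin v → Set
    OnCycle x = ∃[ i ] vertex C i ≡ x

    edgeSet : Subset n
    edgeSet = comprehension λ e → any? λ i → edge C i ≟ᶠ e

    edgeSet-correct : HasEdgeSet C edgeSet
    edgeSet-correct e = mk⇔ (∈-comprehension⁻ λ e → any? λ i → edge C i ≟ᶠ e)
                            (∈-comprehension⁺ λ e → any? λ i → edge C i ≟ᶠ e)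

    -- Double counting of the pairs of an edge and an index at which it occurs: an edge in `X`
    -- occurs once by injectivity, any other never.
    hasEdgeSet⇒size : ∀ {X} → HasEdgeSet C X → ∣ X ∣ ≡ suc (length-1 C)
    hasEdgeSet⇒size {X} has = begin
      ∣ X ∣
        ≡⟨ ∑-∈≡∣∣ X ⟨
      ∑[ e ← allFin n ] χ (e ∈? X)
        ≡⟨ ∑-cong (allFin n) fibre ⟩
      ∑[ e ← allFin n ] (∑[ i ← allFin l ] χ (edge C i ≟ᶠ e) * 1)
        ≡⟨ ∑-swap (allFin n) (allFin l) _ ⟩
      ∑[ i ← allFin l ] (∑[ e ← allFin n ] χ (edge C i ≟ᶠ e) * 1)
        ≡⟨ ∑-cong (allFin l) (λ i → allFin-enumerates n (edge C i ≟ᶠ_) (λ _ → 1) refl sym) ⟩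
      ∑[ i ← allFin l ] 1
        ≡⟨ ∑-one l ⟩
      l ∎
      where
      open ≡-Reasoning
      l = suc (length-1 C)
      fibre : ∀ e → χ (e ∈? X) ≡ ∑[ i ← allFin l ] χ (edge C i ≟ᶠ e) * 1
      fibre e = by-cases (e ∈? X)
        where
        by-cases : (d : Dec (e ∈ X)) → χ d ≡ ∑[ i ← allFin l ] χ (edge C i ≟ᶠ e) * 1
        by-cases (no e∉X) = sym (∑-zero (allFin l) λ i →
          χ*-zero (edge C i ≟ᶠ e) λ eq → e∉X (Equivalence.from (has e) (i , eq)))
        by-cases (yes e∈X) = let i , eq = Equivalence.to (has e) e∈X in
          sym (allFin-enumerates l (λ i → edge C i ≟ᶠ e) (λ _ → 1) eq
                 (λ eq′ → edge-inj C (trans eq′ (sym eq))))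

    edge-ends-on : ∀ {i x y} → Joins (edge C i) x y → OnCycle x × OnCycle y
    edge-ends-on {i} joined with joins-unique (joins C i) joined
    ... | inj₁ (refl , refl) = (i , refl) , (_ , refl)
    ... | inj₂ (refl , refl) = (_ , refl) , (i , refl)

    module _ {e} (e∉C : ∀ i → edge C i ≢ e) {i j} (i≤j : toℕ i ≤ toℕ j)
             (chord : Joins e (vertex C j) (vertex C i)) where

      private
        l = length-1 C
        d = toℕ j ∸ toℕ i

        i+d≡j : toℕ i + d ≡ toℕ j
        i+d≡j = m+[n∸m]≡n i≤j

        index : ℕ → Fin (suc l)
        index k = (toℕ i + k) mod suc l

        toℕ-index : ∀ {k} → k ≤ d → toℕ (index k) ≡ toℕ i + k
        toℕ-index k≤d = toℕ-mod (≤-<-trans (+-monoʳ-≤ (toℕ i) k≤d)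
                                  (subst (_< suc l) (sym i+d≡j) (toℕ<n j)))

        k≤d : ∀ (k : Fin (suc d)) → toℕ k ≤ d
        k≤d k = ≤-pred (toℕ<n k)

        index-inj : ∀ {k k′ : Fin (suc d)} → index (toℕ k) ≡ index (toℕ k′) → k ≡ k′
        index-inj {k} {k′} eq = toℕ-injective (+-cancelˡ-≡ (toℕ i) _ _
          (trans (sym (toℕ-index (k≤d k))) (trans (cong toℕ eq) (toℕ-index (k≤d k′)))))

        edge′ : ∀ (k : Fin (suc d)) → Dec (toℕ k < d) → Fin n
        edge′ k (yes _) = edge C (index (toℕ k))
        edge′ k (no _)  = e

        last : ∀ {k : Fin (suc d)} → ¬ toℕ k < d → toℕ k ≡ d
        last {k} k≮d = ≤-antisym (k≤d k) (≮⇒≥ k≮d)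

        edge′-inj : ∀ {k k′ : Fin (suc d)} (p : Dec (toℕ k < d)) (p′ : Dec (toℕ k′ < d)) →
                    edge′ k p ≡ edge′ k′ p′ → k ≡ k′
        edge′-inj (yes _)  (yes _)   eq = index-inj (edge-inj C eq)
        edge′-inj (yes _)  (no _)    eq = contradiction eq (e∉C _)
        edge′-inj (no _)   (yes _)   eq = contradiction (sym eq) (e∉C _)
        edge′-inj (no k≮d) (no k′≮d) eq = toℕ-injective (trans (last k≮d) (sym (last k′≮d)))

        edge′-joins : ∀ (k : Fin (suc d)) (p : Dec (toℕ k < d)) →
          Joins (edge′ k p) (vertex C (index (toℕ k))) (vertex C (index (toℕ (suc (toℕ k) mod suc d))))
        edge′-joins k (yes k<d) = subst (λ m → Joins (edge C (index (toℕ k))) (vertex C (index (toℕ k))) (vertex C (m mod suc l)))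
          (begin
            suc (toℕ (index (toℕ k)))              ≡⟨ cong suc (toℕ-index (k≤d k)) ⟩
            suc (toℕ i + toℕ k)                    ≡⟨ +-suc (toℕ i) (toℕ k) ⟨
            toℕ i + suc (toℕ k)                    ≡⟨ cong (toℕ i +_) (toℕ-mod (s≤s k<d)) ⟨
            toℕ i + toℕ (suc (toℕ k) mod suc d)    ∎)
          (joins C (index (toℕ k)))
          where open ≡-Reasoning
        edge′-joins k (no k≮d) = subst₂ (λ a b → Joins e (vertex C a) (vertex C b))
          (toℕ-injective (sym (trans (toℕ-index (k≤d k)) (trans (cong (toℕ i +_) (last k≮d)) i+d≡j))))
          (toℕ-injective (sym (trans
            (cong (toℕ ∘ index) (trans (cong (λ m → toℕ (suc m mod suc d)) (last k≮d)) (toℕ-self-mod d)))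
            (trans (toℕ-index z≤n) (+-identityʳ (toℕ i))))))
          chord

      -- The arc of `C` from index `i` to index `j`, closed up by the chord `e`. As `i ≤ j`, the arc
      -- does not wrap around the end of `C`. If `i` and `j` coincide, `e` is a loop and the cycle
      -- has length one.
      chordCycle : Cycle
      chordCycle = record
        { length-1   = d
        ; vertex     = λ k → vertex C (index (toℕ k))
        ; edge       = λ k → edge′ k (toℕ k <? d)
        ; vertex-inj = index-inj ∘ vertex-inj C
        ; edge-inj   = λ {k} {k′} → edge′-inj (toℕ k <? d) (toℕ k′ <? d)
        ; joins      = λ k → edge′-joins k (toℕ k <? d)
        }

      chordCycle-edges : ∀ k → edge chordCycle k ≡ e ⊎ (∃[ i ] edge C i ≡ edge chordCycle k)
      chordCycle-edges k with toℕ k <? d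
      ... | yes _ = inj₂ (_ , refl)
      ... | no _  = inj₁ refl

      chord-on-chordCycle : ∃[ k ] edge chordCycle k ≡ e
      chord-on-chordCycle = fromℕ d , is-chord (toℕ (fromℕ d) <? d)
        where
        is-chord : ∀ p → edge′ (fromℕ d) p ≡ e
        is-chord (yes d<d) = contradiction (toℕ-fromℕ d) (<⇒≢ d<d)
        is-chord (no _)    = refl

  -- Hamiltonian cycles as circuits of the cycle matroid.

  module _ {r : ℕ} (M : Matroid n r) (cycleMatroid : IsCycleMatroid G M) where

    open Matroid M using (rank; rank-⊤; rank-mono; Circuit)

    cycle⇒circuit : ∀ C → Circuit (edgeSet C)
    cycle⇒circuit C = Equivalence.from (cycleMatroid (edgeSet C)) (C , edgeSet-correct C)

    hamiltonian⇒circuit : Hamiltonian → ∃[ X ] Circuit X × ∣ X ∣ ≡ v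
    hamiltonian⇒circuit (C , passes) = edgeSet C , cycle⇒circuit C ,
      trans (hasEdgeSet⇒size C (edgeSet-correct C))
            (≤-antisym (injective⇒≤ (vertex-inj C)) (surjective⇒≥ passes))

    circuit⇒hamiltonian : ∀ {X} → Circuit X → ∣ X ∣ ≡ v → Hamiltonian
    circuit⇒hamiltonian {X} circuit size with Equivalence.to (cycleMatroid X) circuit
    ... | C , has = C , injective⇒surjective (vertex-inj C) (trans (sym (hasEdgeSet⇒size C has)) size)

    -- The chord closes a cycle whose other edges belong to `C`, so it lies on a circuit inside
    -- `edgeSet C ∪ ⁅ e ⁆` and is no coloop of that set.
    chord-spanned : ∀ (C : Cycle) {e} → e ∉ edgeSet C → ∀ {i j} → toℕ i ≤ toℕ j →
      Joins e (vertex C j) (vertex C i) → rank (edgeSet C ∪ ⁅ e ⁆) ≡ rank (edgeSet C)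
    chord-spanned C {e} e∉ {i} {j} i≤j chord = begin
      rank (X ∪ ⁅ e ⁆)         ≡⟨ rank≡-extend M Y⊆ e∈Y (circuit⇒coloopless M (cycle⇒circuit D) e∈Y) ⟨
      rank ((X ∪ ⁅ e ⁆) - e)   ≡⟨ cong rank (p∪⁅x⁆-x≡p e∉) ⟩
      rank X                   ∎
      where
      open ≡-Reasoning
      X = edgeSet C
      e∉C : ∀ i → edge C i ≢ e
      e∉C i eq = e∉ (Equivalence.from (edgeSet-correct C e) (i , eq))
      D = chordCycle C e∉C i≤j chord
      e∈Y : e ∈ edgeSet D
      e∈Y = Equivalence.from (edgeSet-correct D e) (chord-on-chordCycle C e∉C i≤j chord)
      Y⊆ : edgeSet D ⊆ X ∪ ⁅ e ⁆
      Y⊆ {f} f∈ with Equivalence.to (edgeSet-correct D f) f∈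
      ... | k , refl with chordCycle-edges C e∉C i≤j chord k
      ... | inj₁ eq = subst (_∈ X ∪ ⁅ e ⁆) (sym eq) (x∈p∪⁅x⁆ X)
      ... | inj₂ on = p⊆p∪q ⁅ e ⁆ (Equivalence.from (edgeSet-correct C (edge D k)) on)

    -- Both ends of any edge lie on the Hamiltonian cycle, so each edge belongs to the cycle or is a
    -- chord of it, and chords do not raise the rank.
    hamiltonian⇒spanning : Hamiltonian → HasSpanningCircuit M
    hamiltonian⇒spanning (C , passes) = X , cycle⇒circuit C , ≤-antisym (rank≤r M X) (begin
      r               ≡⟨ rank-⊤ ⟨
      rank ⊤          ≤⟨ rank-mono (q⊆p∪q X ⊤) ⟩
      rank (X ∪ ⊤)    ≡⟨ rank-∪-absorb M ⊤ (λ {e} _ → spanned e) ⟩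
      rank X          ∎)
      where
      open ≤-Reasoning
      X = edgeSet C

      spanned : ∀ e → rank (X ∪ ⁅ e ⁆) ≡ rank X
      spanned e with e ∈? X
      ... | yes e∈X = cong rank (x∈p⇒p∪⁅x⁆≡p e∈X)
      ... | no e∉X with passes (proj₁ (ends e)) | passes (proj₂ (ends e))
      ... | i , vi≡ | j , vj≡ with ≤-total (toℕ i) (toℕ j)
      ... | inj₁ i≤j = chord-spanned C e∉X i≤j (inj₂ (sym (cong₂ _,_ vi≡ vj≡)))
      ... | inj₂ j≤i = chord-spanned C e∉X j≤i (inj₁ (sym (cong₂ _,_ vi≡ vj≡)))

    -- An edge leaving the cycle cannot lie on a cycle whose other edges are in X:
    -- the next edge at its outer end would have to be in X.
    ¬circuit-leaving : ∀ C {X} → HasEdgeSet C X → ∀ {e a b} → Joins e a b → OnCycle C a → ¬ OnCycle C b →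
      ∀ {Y} → Circuit Y → e ∈ Y → ¬ Y ⊆ X ∪ ⁅ e ⁆
    ¬circuit-leaving C {X} hasX {e} {a} {b} joined onA offB {Y} circuit e∈Y Y⊆
      with Equivalence.to (cycleMatroid Y) circuit
    ... | D , hasY with Equivalence.to (hasY e) e∈Y
    ... | k , refl = [ outgoing , incoming ]′ (joins-unique (joins D k) joined)
      where
      next = suc (toℕ k) mod suc (length-1 D)

      off : ∀ p {y} → Joins (edge D p) b y → p ≡ k
      off p joins-b with y∈p∪⁅x⁆⁻ X (Y⊆ (Equivalence.from (hasY (edge D p)) (p , refl)))
      ... | inj₂ eq = edge-inj D eq
      ... | inj₁ p∈X with Equivalence.to (hasX (edge D p)) p∈X
      ... | i , eq = contradiction
        (proj₁ (edge-ends-on C {i} (subst (λ f → Joins f b _) (sym eq) joins-b))) offB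

      a≢b : a ≢ b
      a≢b refl = offB onA

      outgoing : ¬ (vertex D k ≡ a × vertex D next ≡ b)
      outgoing (refl , refl) = a≢b (cong (vertex D) (sym (off next (joins D next))))

      incoming : ¬ (vertex D k ≡ b × vertex D next ≡ a)
      incoming (vk≡b , vnext≡a) =
        let p , p+1≡k = predecessor k
            arriving = subst (λ q → Joins (edge D p) (vertex D p) (vertex D q)) p+1≡k (joins D p)
            p≡k = off p (joins-sym {edge D p} (subst (Joins (edge D p) (vertex D p)) vk≡b arriving))
            next≡k = trans (cong (λ q → suc (toℕ q) mod suc (length-1 D)) (sym p≡k)) p+1≡k
        in a≢b (trans (sym vnext≡a) (trans (cong (vertex D) next≡k) vk≡b))

    -- If the cycle missed a vertex, connectivity would give an edge with exactly one end on it.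
    -- Because `X` spans, that edge lies on a circuit within `X` and itself, which
    -- `¬circuit-leaving` forbids.
    spanning⇒hamiltonian : Connected → HasSpanningCircuit M → Hamiltonian
    spanning⇒hamiltonian connected (X , circuit , spanning) with Equivalence.to (cycleMatroid X) circuit
    ... | C , has = C , on
      where
      onCycle? : Decidable (OnCycle C)
      onCycle? x = any? λ i → vertex C i ≟ᶠ x

      on : ∀ x → OnCycle C x
      on x with onCycle? x
      ... | yes onX = onX
      ... | no offX with leaving-edge onCycle? (connected (vertex C zero) x) (zero , refl) offX
      ... | e , a , b , joined , onA , offB with e ∈? X
      -- An edge of the cycle has both ends on it, so the leaving edge is outside `X`.
      ... | yes e∈X = let i , eq = Equivalence.to (has e) e∈X in
        contradiction (proj₂ (edge-ends-on C {i} (subst (λ f → Joins f a b) (sym eq) joined))) offB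
      ... | no e∉X =
        let Y , circuitY , e∈Y , Y⊆ = circuit-through M X e∉X (≤-antisym
              (≤-trans (rank≤r M (X ∪ ⁅ e ⁆)) (≤-reflexive (sym spanning)))
              (rank-mono (p⊆p∪q ⁅ e ⁆)))
        in ⊥-elim (¬circuit-leaving C has joined onA offB circuitY e∈Y Y⊆)

sameChainSums⇒hamiltonian : ∀ {v n r} (G H : Graph v n) (M N : Matroid n r) →
  IsCycleMatroid G M → IsCycleMatroid H N → SameChainSums M N → Graph.Hamiltonian G → Graph.Hamiltonian H
sameChainSums⇒hamiltonian {v} G H M N cycleG cycleH same ham =
  let X , circuit , size = hamiltonian⇒circuit G M cycleG ham
      Y , circuit′ , size′ = #circuits-positive⁻ N v (subst (0 <_) (sameChainSums⇒#circuits M N same v)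
        (subst (λ s → 0 < #circuits M s) size (#circuits-positive M circuit)))
  in circuit⇒hamiltonian H N cycleH circuit′ size′

sameChainSums⇒hamiltonian-connected : ∀ {v w n r} (G : Graph v n) (H : Graph w n) (M N : Matroid n r) →
  Graph.Connected H → IsCycleMatroid G M → IsCycleMatroid H N → SameChainSums M N →
  Graph.Hamiltonian G → Graph.Hamiltonian H
sameChainSums⇒hamiltonian-connected G H M N connected cycleG cycleH same ham =
  spanning⇒hamiltonian H N cycleH connected
    (sameChainSums⇒spanningCircuit M N same (hamiltonian⇒spanning G M cycleG ham))

sameChainSums-sym : ∀ {n r} (M N : Matroid n r) → SameChainSums M N → SameChainSums N M
sameChainSums-sym M N same φ = sym (same φ)

corollary5p3 : (c ℓ₁ ℓ₂ : Level) →
    (∀ (s : ℕ) → Derivable (λ M → #cocircuits M s))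
    × (∀ (s : ℕ) → Derivable (λ M → #circuits M s))
    × (∀ (s j : ℕ) → Derivable (λ M → #cyclicSets M s j))
    × DerivableProperty HasSpanningCircuit
    × (∀ (K : HeytingField c ℓ₁ ℓ₂) → CharacteristicZero K →
    ∀ {v n r : ℕ} (G H : Graph v n) (M N : Matroid n r) →
    IsCycleMatroid G M → IsCycleMatroid H N →
    𝒢Equal K (𝒢 K M) (𝒢 K N) →
    Graph.Hamiltonian G ⇔ Graph.Hamiltonian H)
    × (∀ (K : HeytingField c ℓ₁ ℓ₂) → CharacteristicZero K →
    ∀ {v w n r : ℕ} (G : Graph v n) (H : Graph w n) (M N : Matroid n r) →
    Graph.Connected G → Graph.Connected H →
    IsCycleMatroid G M → IsCycleMatroid H N →
    𝒢Equal K (𝒢 K M) (𝒢 K N) →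
    Graph.Hamiltonian G ⇔ Graph.Hamiltonian H)
corollary5p3 c ℓ₁ ℓ₂ =
    (λ s M N cat → sameChainSums⇒#cocircuits M N (sameCatenaryData⇒sameChainSums M N cat) s)
  , (λ s M N cat → sameChainSums⇒#circuits M N (sameCatenaryData⇒sameChainSums M N cat) s)
  , (λ s j M N cat → sameChainSums⇒#cyclicSets M N (sameCatenaryData⇒sameChainSums M N cat) s j)
  , (λ M N cat → let same = sameCatenaryData⇒sameChainSums M N cat in
       mk⇔ (sameChainSums⇒spanningCircuit M N same)
           (sameChainSums⇒spanningCircuit N M (sameChainSums-sym M N same)))
  , (λ K char0 G H M N cycleG cycleH eq → let same = 𝒢Equal⇒sameChainSums K char0 M N eq in
       mk⇔ (sameChainSums⇒hamiltonian G H M N cycleG cycleH same)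
           (sameChainSums⇒hamiltonian H G N M cycleH cycleG (sameChainSums-sym M N same)))
  , (λ K char0 G H M N connectedG connectedH cycleG cycleH eq →
       let same = 𝒢Equal⇒sameChainSums K char0 M N eq in
       mk⇔ (sameChainSums⇒hamiltonian-connected G H M N connectedH cycleG cycleH same)
           (sameChainSums⇒hamiltonian-connected H G N M connectedG cycleH cycleG (sameChainSums-sym M N same)))
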